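{- There exist positive real constants $C_1$ and $C_2$ such that for all sufficiently large positive integers $n$, $$C_1 n \le \mathrm{maximaginary}(n) \le C_2 n,$$ where $\mathrm{maximaginary}(n)$ denotes the maximum of $\Im(z)$ over all chromatic roots $z \in \mathbb{C}$ of graphs of order $n$.
   Context: All graphs are finite, undirected and simple. The order of a graph is its number of vertices. For a graph $G$ and a nonnegative integer $k$, a $k$-colouring of $G$ is a function $f: V(G) \to \{1,\ldots,k\}$ with $f(u) \ne f(v)$ whenever $uv$ is an edge of $G$. The number $\pi(G,k)$ of $k$-colourings of $G$ is a polynomial function of $k$; its extension $\pi(G,x)$ to all complex numbers $x$ is the chromatic polynomial of $G$. A chromatic root of $G$ is a complex root of $\pi(G,x)$. For a positive integer $n$, $$\mathrm{maximaginary}(n) = \max\{\Im(z) : z \text{ is a chromatic root of a graph of order } n\},$$ the maximum being taken over all graphs of order $n$ and all of their chromatic roots. -}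

module Defs where

open import Data.Bool using (Bool; true; false)
import Data.Bool.Properties as Bool
open import Data.Fin using (Fin; finToFun)
import Data.Fin.Properties as Fin
open import Data.Integer using (+_)
open import Data.List using (List; []; _∷_; length; filter; allFin)
open import Data.Nat as ℕ using (ℕ; _⊔_)
import Data.Nat.Properties as ℕ
open import Data.Product using (Σ; ∃-syntax; _×_; _,_; proj₁; proj₂)
open import Data.Rational as ℚ using (ℚ; 0ℚ; 1ℚ; ½; ∣_∣)
import Data.Rational.Properties as ℚ
open import Data.Rational.Solver using (module +-*-Solver)
open import Relation.Binary.PropositionalEquality
  using (_≡_; _≢_; refl; sym; trans; cong; cong₂; subst)
open import Relation.Nullary using (Dec; ¬?; _→-dec_)

------------------------------------------------------------------------
-- Real numbers: Cauchy sequences of rationals, compared by _≃ᵣ_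

Cauchy : (ℕ → ℚ) → Set
Cauchy x = ∀ ε → 0ℚ ℚ.< ε →
  ∃[ N ] (∀ m n → N ℕ.≤ m → N ℕ.≤ n → ∣ x m ℚ.- x n ∣ ℚ.< ε)

record ℝ : Set where
  constructor mkℝ
  field
    seq    : ℕ → ℚ
    cauchy : Cauchy seq

open ℝ public

infix 4 _≃ᵣ_ _≤ᵣ_ _<ᵣ_

_≃ᵣ_ : ℝ → ℝ → Set
x ≃ᵣ y = ∀ ε → 0ℚ ℚ.< ε →
  ∃[ N ] (∀ n → N ℕ.≤ n → ∣ seq x n ℚ.- seq y n ∣ ℚ.< ε)

_≤ᵣ_ : ℝ → ℝ → Set
x ≤ᵣ y = ∀ ε → 0ℚ ℚ.< ε →
  ∃[ N ] (∀ n → N ℕ.≤ n → seq x n ℚ.≤ seq y n ℚ.+ ε)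

-- The sequence of x must stay below that of y by a margin ε that does not
-- depend on n.
_<ᵣ_ : ℝ → ℝ → Set
x <ᵣ y = ∃[ ε ] 0ℚ ℚ.< ε ×
  ∃[ N ] (∀ n → N ℕ.≤ n → seq x n ℚ.+ ε ℚ.≤ seq y n)

0<½* : ∀ ε → 0ℚ ℚ.< ε → 0ℚ ℚ.< ½ ℚ.* ε
0<½* ε 0<ε =
  ℚ.positive⁻¹ (½ ℚ.* ε) {{ℚ.pos*pos⇒pos ½ ε {{ℚ.positive 0<ε}}}}

½+½ : ∀ ε → ½ ℚ.* ε ℚ.+ ½ ℚ.* ε ≡ ε
½+½ ε = trans (sym (ℚ.*-distribʳ-+ ε ½ ½)) (ℚ.*-identityˡ ε)

const-cauchy : ∀ q → Cauchy (λ _ → q)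
const-cauchy q ε 0<ε = 0 , λ _ _ _ _ →
  subst (λ d → ∣ d ∣ ℚ.< ε) (sym (ℚ.+-inverseʳ q)) 0<ε

+-cauchy : ∀ x y → Cauchy x → Cauchy y → Cauchy (λ n → x n ℚ.+ y n)
+-cauchy x y cx cy ε 0<ε = M ⊔ N , λ m n M⊔N≤m M⊔N≤n → begin-strict
    ∣ (x m ℚ.+ y m) ℚ.- (x n ℚ.+ y n) ∣
      ≡⟨ cong ∣_∣ (rearrange (x m) (y m) (x n) (y n)) ⟩
    ∣ (x m ℚ.- x n) ℚ.+ (y m ℚ.- y n) ∣
      ≤⟨ ℚ.∣p+q∣≤∣p∣+∣q∣ (x m ℚ.- x n) (y m ℚ.- y n) ⟩
    ∣ x m ℚ.- x n ∣ ℚ.+ ∣ y m ℚ.- y n ∣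
      <⟨ ℚ.+-mono-<
           (xM m n (ℕ.m⊔n≤o⇒m≤o M N M⊔N≤m) (ℕ.m⊔n≤o⇒m≤o M N M⊔N≤n))
           (yN m n (ℕ.m⊔n≤o⇒n≤o M N M⊔N≤m) (ℕ.m⊔n≤o⇒n≤o M N M⊔N≤n)) ⟩
    ½ ℚ.* ε ℚ.+ ½ ℚ.* ε
      ≡⟨ ½+½ ε ⟩
    ε ∎
  where
  open ℚ.≤-Reasoning
  open +-*-Solver
  M = proj₁ (cx (½ ℚ.* ε) (0<½* ε 0<ε))
  xM = proj₂ (cx (½ ℚ.* ε) (0<½* ε 0<ε))
  N = proj₁ (cy (½ ℚ.* ε) (0<½* ε 0<ε))
  yN = proj₂ (cy (½ ℚ.* ε) (0<½* ε 0<ε))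
  rearrange : ∀ a b c d →
    (a ℚ.+ b) ℚ.- (c ℚ.+ d) ≡ (a ℚ.- c) ℚ.+ (b ℚ.- d)
  rearrange = solve 4 (λ a b c d →
    (a :+ b) :- (c :+ d) := (a :- c) :+ (b :- d)) refl

neg-cauchy : ∀ x → Cauchy x → Cauchy (λ n → ℚ.- x n)
neg-cauchy x cx ε 0<ε = proj₁ (cx ε 0<ε) , λ m n N≤m N≤n →
  subst (ℚ._< ε)
    (trans (sym (ℚ.∣-p∣≡∣p∣ (x m ℚ.- x n)))
           (cong ∣_∣ (ℚ.neg-distrib-+ (x m) (ℚ.- x n))))
    (proj₂ (cx ε 0<ε) m n N≤m N≤n)

eventually-bounded : ∀ x → Cauchy x →
  ∃[ B ] 0ℚ ℚ.< B × ∃[ N ] (∀ n → N ℕ.≤ n → ∣ x n ∣ ℚ.≤ B)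
eventually-bounded x cx = 1ℚ ℚ.+ ∣ x N ∣ , 0<B , N , λ n N≤n → begin
    ∣ x n ∣                        ≡⟨ cong ∣_∣ (split (x n) (x N)) ⟩
    ∣ (x n ℚ.- x N) ℚ.+ x N ∣      ≤⟨ ℚ.∣p+q∣≤∣p∣+∣q∣ (x n ℚ.- x N) (x N) ⟩
    ∣ x n ℚ.- x N ∣ ℚ.+ ∣ x N ∣
      ≤⟨ ℚ.+-monoˡ-≤ ∣ x N ∣ (ℚ.<⇒≤ (xN n N N≤n ℕ.≤-refl)) ⟩
    1ℚ ℚ.+ ∣ x N ∣                 ∎
  where
  open ℚ.≤-Reasoning
  open +-*-Solver
  N = proj₁ (cx 1ℚ (ℚ.positive⁻¹ 1ℚ))
  xN = proj₂ (cx 1ℚ (ℚ.positive⁻¹ 1ℚ))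
  0<B : 0ℚ ℚ.< 1ℚ ℚ.+ ∣ x N ∣
  0<B = ℚ.+-mono-<-≤ (ℚ.positive⁻¹ 1ℚ) (ℚ.0≤∣p∣ (x N))
  split : ∀ a b → a ≡ (a ℚ.- b) ℚ.+ b
  split = solve 2 (λ a b → a := (a :- b) :+ b) refl

rescale : ∀ K ε → 0ℚ ℚ.< K → 0ℚ ℚ.< ε → ∃[ δ ] 0ℚ ℚ.< δ × K ℚ.* δ ≡ ε
rescale K ε 0<K 0<ε = K⁻¹ ℚ.* ε , 0<δ , Kδ≡ε
  where
  instance
    K-pos : ℚ.Positive K
    K-pos = ℚ.positive 0<K
    K-nonZero : ℚ.NonZero K
    K-nonZero = ℚ.pos⇒nonZero K
  K⁻¹ : ℚ
  K⁻¹ = ℚ.1/ K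
  0<δ : 0ℚ ℚ.< K⁻¹ ℚ.* ε
  0<δ = ℚ.positive⁻¹ (K⁻¹ ℚ.* ε)
    {{ℚ.pos*pos⇒pos K⁻¹ {{ℚ.1/pos⇒pos K}} ε {{ℚ.positive 0<ε}}}}
  Kδ≡ε : K ℚ.* (K⁻¹ ℚ.* ε) ≡ ε
  Kδ≡ε = trans (sym (ℚ.*-assoc K K⁻¹ ε))
    (trans (cong (ℚ._* ε) (ℚ.*-inverseʳ K)) (ℚ.*-identityˡ ε))

*-close : ∀ a b c d A B δ → 0ℚ ℚ.< A → 0ℚ ℚ.< B →
  ∣ a ∣ ℚ.≤ A → ∣ d ∣ ℚ.≤ B → ∣ a ℚ.- c ∣ ℚ.< δ → ∣ b ℚ.- d ∣ ℚ.< δ →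
  ∣ a ℚ.* b ℚ.- c ℚ.* d ∣ ℚ.< (A ℚ.+ B) ℚ.* δ
*-close a b c d A B δ 0<A 0<B a≤A d≤B a-c<δ b-d<δ = begin-strict
    ∣ a ℚ.* b ℚ.- c ℚ.* d ∣
      ≡⟨ cong ∣_∣ (rearrange a b c d) ⟩
    ∣ a ℚ.* (b ℚ.- d) ℚ.+ d ℚ.* (a ℚ.- c) ∣
      ≤⟨ ℚ.∣p+q∣≤∣p∣+∣q∣ (a ℚ.* (b ℚ.- d)) (d ℚ.* (a ℚ.- c)) ⟩
    ∣ a ℚ.* (b ℚ.- d) ∣ ℚ.+ ∣ d ℚ.* (a ℚ.- c) ∣
      <⟨ ℚ.+-mono-< (scale a (b ℚ.- d) A 0<A a≤A b-d<δ)
                    (scale d (a ℚ.- c) B 0<B d≤B a-c<δ) ⟩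
    A ℚ.* δ ℚ.+ B ℚ.* δ
      ≡⟨ sym (ℚ.*-distribʳ-+ δ A B) ⟩
    (A ℚ.+ B) ℚ.* δ ∎
  where
  open ℚ.≤-Reasoning
  open +-*-Solver
  rearrange : ∀ a b c d →
    a ℚ.* b ℚ.- c ℚ.* d ≡ a ℚ.* (b ℚ.- d) ℚ.+ d ℚ.* (a ℚ.- c)
  rearrange = solve 4 (λ a b c d →
    a :* b :- c :* d := a :* (b :- d) :+ d :* (a :- c)) refl
  scale : ∀ p q C → 0ℚ ℚ.< C → ∣ p ∣ ℚ.≤ C → ∣ q ∣ ℚ.< δ →
    ∣ p ℚ.* q ∣ ℚ.< C ℚ.* δ
  scale p q C 0<C p≤C q<δ = begin-strict
    ∣ p ℚ.* q ∣      ≡⟨ ℚ.∣p*q∣≡∣p∣*∣q∣ p q ⟩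
    ∣ p ∣ ℚ.* ∣ q ∣
      ≤⟨ ℚ.*-monoʳ-≤-nonNeg ∣ q ∣ {{ℚ.nonNegative (ℚ.0≤∣p∣ q)}} p≤C ⟩
    C ℚ.* ∣ q ∣      <⟨ ℚ.*-monoʳ-<-pos C {{ℚ.positive 0<C}} q<δ ⟩
    C ℚ.* δ          ∎

*-cauchy : ∀ x y → Cauchy x → Cauchy y → Cauchy (λ n → x n ℚ.* y n)
*-cauchy x y cx cy ε 0<ε =
  let A , 0<A , M₁ , xA = eventually-bounded x cx
      B , 0<B , N₁ , yB = eventually-bounded y cy
      δ , 0<δ , [A+B]δ≡ε = rescale (A ℚ.+ B) ε (ℚ.+-mono-< 0<A 0<B) 0<ε
      M₂ , xδ = cx δ 0<δ
      N₂ , yδ = cy δ 0<δ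
  in combine A B δ M₁ M₂ N₁ N₂ 0<A 0<B xA yB xδ yδ [A+B]δ≡ε
  where
  combine : ∀ A B δ M₁ M₂ N₁ N₂ → 0ℚ ℚ.< A → 0ℚ ℚ.< B →
    (∀ n → M₁ ℕ.≤ n → ∣ x n ∣ ℚ.≤ A) →
    (∀ n → N₁ ℕ.≤ n → ∣ y n ∣ ℚ.≤ B) →
    (∀ m n → M₂ ℕ.≤ m → M₂ ℕ.≤ n → ∣ x m ℚ.- x n ∣ ℚ.< δ) →
    (∀ m n → N₂ ℕ.≤ m → N₂ ℕ.≤ n → ∣ y m ℚ.- y n ∣ ℚ.< δ) →
    (A ℚ.+ B) ℚ.* δ ≡ ε →
    ∃[ N ] (∀ m n → N ℕ.≤ m → N ℕ.≤ n →
      ∣ x m ℚ.* y m ℚ.- x n ℚ.* y n ∣ ℚ.< ε)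
  combine A B δ M₁ M₂ N₁ N₂ 0<A 0<B xA yB xδ yδ refl =
    (M₁ ⊔ M₂) ⊔ (N₁ ⊔ N₂) , λ m n K≤m K≤n →
      let M = M₁ ⊔ M₂ ; N = N₁ ⊔ N₂
          M≤m = ℕ.m⊔n≤o⇒m≤o M N K≤m ; M≤n = ℕ.m⊔n≤o⇒m≤o M N K≤n
          N≤m = ℕ.m⊔n≤o⇒n≤o M N K≤m ; N≤n = ℕ.m⊔n≤o⇒n≤o M N K≤n
      in *-close (x m) (y m) (x n) (y n) A B δ 0<A 0<B
        (xA m (ℕ.m⊔n≤o⇒m≤o M₁ M₂ M≤m))
        (yB n (ℕ.m⊔n≤o⇒m≤o N₁ N₂ N≤n))
        (xδ m n (ℕ.m⊔n≤o⇒n≤o M₁ M₂ M≤m) (ℕ.m⊔n≤o⇒n≤o M₁ M₂ M≤n))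
        (yδ m n (ℕ.m⊔n≤o⇒n≤o N₁ N₂ N≤m) (ℕ.m⊔n≤o⇒n≤o N₁ N₂ N≤n))

infixl 6 _+ᵣ_
infixl 7 _*ᵣ_
infix  8 -ᵣ_

_+ᵣ_ : ℝ → ℝ → ℝ
x +ᵣ y = mkℝ (λ n → seq x n ℚ.+ seq y n)
  (+-cauchy (seq x) (seq y) (cauchy x) (cauchy y))

-ᵣ_ : ℝ → ℝ
-ᵣ x = mkℝ (λ n → ℚ.- seq x n) (neg-cauchy (seq x) (cauchy x))

_*ᵣ_ : ℝ → ℝ → ℝ
x *ᵣ y = mkℝ (λ n → seq x n ℚ.* seq y n)
  (*-cauchy (seq x) (seq y) (cauchy x) (cauchy y))

fromℚ : ℚ → ℝ
fromℚ q = mkℝ (λ _ → q) (const-cauchy q)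

fromℕᵣ : ℕ → ℝ
fromℕᵣ k = fromℚ (+ k ℚ./ 1)

0ᵣ : ℝ
0ᵣ = fromℕᵣ 0

------------------------------------------------------------------------
-- Complex numbers

record ℂ : Set where
  constructor _+i_
  field
    Re : ℝ
    Im : ℝ

open ℂ public

infix  4 _≃_
infixl 6 _+_
infixl 7 _*_

_≃_ : ℂ → ℂ → Set
z ≃ w = Re z ≃ᵣ Re w × Im z ≃ᵣ Im w

_+_ : ℂ → ℂ → ℂ
z + w = (Re z +ᵣ Re w) +i (Im z +ᵣ Im w)

_*_ : ℂ → ℂ → ℂ
z * w = (Re z *ᵣ Re w +ᵣ -ᵣ (Im z *ᵣ Im w)) +i (Re z *ᵣ Im w +ᵣ Im z *ᵣ Re w)

fromℕ : ℕ → ℂ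
fromℕ k = fromℕᵣ k +i 0ᵣ

-- Coefficient lists, constant term first; trailing zeros are allowed.
Polynomial : Set
Polynomial = List ℂ

eval : Polynomial → ℂ → ℂ
eval []      z = fromℕ 0
eval (a ∷ p) z = a + z * eval p z

------------------------------------------------------------------------
-- Graphs and colourings

-- A graph of order n is taken on the vertex set Fin n; every graph of
-- order n is isomorphic to one of these.
record Graph (n : ℕ) : Set where
  field
    adj         : Fin n → Fin n → Bool
    symmetric   : ∀ u v → adj u v ≡ adj v u
    irreflexive : ∀ v → adj v v ≡ false

open Graph public

IsColouring : ∀ {n k} → Graph n → (Fin n → Fin k) → Set
IsColouring G f = ∀ u v → adj G u v ≡ true → f u ≢ f v

isColouring? : ∀ {n k} (G : Graph n) (f : Fin n → Fin k) → Dec (IsColouring G f)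
isColouring? G f = Fin.all? λ u → Fin.all? λ v →
  (adj G u v Bool.≟ true) →-dec ¬? (f u Fin.≟ f v)

-- finToFun enumerates the k ^ n functions Fin n → Fin k, each exactly once.
π : ∀ {n} → Graph n → ℕ → ℕ
π {n} G k =
  length (filter (λ i → isColouring? G (finToFun {k} {n} i)) (allFin (k ℕ.^ n)))

-- A polynomial is determined by its values at the natural numbers, so this
-- singles out the chromatic polynomial of G up to trailing zeros and _≃_ of
-- coefficients.
IsChromaticPolynomial : ∀ {n} → Graph n → Polynomial → Set
IsChromaticPolynomial G p = ∀ k → eval p (fromℕ k) ≃ fromℕ (π G k)

IsChromaticRoot : ∀ {n} → Graph n → ℂ → Set
IsChromaticRoot G z = ∃[ p ] IsChromaticPolynomial G p × eval p z ≃ fromℕ 0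

-- M = maximaginary(n): the value M is attained and is an upper bound.
IsMaximaginary : ℕ → ℝ → Set
IsMaximaginary n M =
    (Σ (Graph n) λ G → ∃[ z ] IsChromaticRoot G z × Im z ≃ᵣ M)
  × (∀ (G : Graph n) z → IsChromaticRoot G z → Im z ≤ᵣ M)

{-# OPTIONS --safe #-}

-- Upper bound.  Let v be a vertex of G with neighbours u₁, …, u_d, and H = G − v.
-- Counting the colours used on the neighbours by the last neighbour that carries
-- each of them gives P_G(q) = q P_H(q) − Σ_j P_{H_j}(q), where H_j is H with u_j
-- joined to the later u_i.  If |q| ≥ 8n, induction on the number of vertices
-- shows that |P_G(q)|² and |q P_{G−v}(q)|² differ at most by a factor of 4 for
-- every v: as H_j − u_j = H − u_j, this bounds |P_{H_j}(q)| by 4 |P_H(q)|, and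
-- the term q P_H(q) dominates.  Hence P_G has no roots with |q| > 8n.
--
-- Lower bound.  A triangle-free graph with m edges has chromatic polynomial
-- xⁿ − m xⁿ⁻¹ + C(m,2) xⁿ⁻² − ⋯, so the roots satisfy Σ z = Σ z² = m.  Hence
-- Σ (Re z)² ≥ m²/n and Σ (Im z)² ≥ m²/n − m, and for a balanced complete bipartite
-- graph, where m is about n²/4, some root has |Im z| ≥ n/8.
--
-- The roots exist by the fundamental theorem of algebra, proved by minimising
-- |p|² over nested squares.

module Submission where

open import Algebra using (CommutativeRing)
open import Axiom.ExcludedMiddle using (ExcludedMiddle)
open import Data.Bool as Bool using (Bool; true; false; if_then_else_; _∧_; _∨_; not; _xor_)
import Data.Bool.Properties as Bool
open import Data.Fin as Fin using (Fin; zero; suc; punchIn; combine; finToFun; funToFin; _↑ˡ_; _↑ʳ_)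
import Data.Fin.Properties as Fin
import Data.Integer as ℤ
import Data.Integer.Properties as ℤ
open import Data.List as List using (List; []; _∷_; length)
import Data.List.Properties as List
open import Data.List.Relation.Unary.All using (All; []; _∷_)
open import Data.Nat as ℕ using (ℕ; zero; suc; _⊔_)
open import Data.Nat.Induction using (<-rec)
import Data.Nat.Properties as ℕ
open import Data.Product using (∃; ∃-syntax; _×_; _,_; proj₁; proj₂)
open import Data.Rational as ℚ using (ℚ; 0ℚ; 1ℚ; ½)
import Data.Rational.Properties as ℚ
import Data.Rational.Unnormalised as ℚᵘ
import Data.Rational.Unnormalised.Properties as ℚᵘ
open import Data.Sum using (_⊎_; inj₁; inj₂)
open import Data.Vec as Vec using (Vec; []; _∷_; _∷ʳ_)
open import Data.Vec.Functional as Vector using (insertAt)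
import Data.Vec.Functional.Properties as Vector
open import Function using (_∘_; id)
open import Level using (0ℓ)
open import Relation.Binary.PropositionalEquality as ≡
  using (_≡_; _≢_; _≗_; refl; sym; trans; cong; cong₂; subst)
open import Relation.Nullary using (¬_; Dec; yes; no; does; contradiction; ¬?; _×-dec_; _→-dec_)
open import Relation.Nullary.Decidable using (dec-true; dec-false; decidable-stable)
open import Relation.Unary using (Pred; Decidable)

open import Defs using (Graph; adj; symmetric; irreflexive; IsColouring; isColouring?; π; ½+½)

-- Neither |z| nor the reciprocal of a real is formed: every estimate compares squares N z = |z|²,
-- and the parallelogram law stands in for the triangle inequality. This fixes the constants of the
-- upper bound. A star costs a factor 4 · 4 = 16, the sum over at most n neighbours a factor n² ·
-- 16, and another 4 lets the leading term dominate, so N q ≥ 64 n² is asked for, that is |q| ≥ 8n.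
-- The descent step of the fundamental theorem usually takes a k-th root; here a direction u with
-- ⟨a, b u^k⟩ < 0 is used. Explicit directions exist for odd k and for k = 2; the latter give
-- complex square roots, and these halve every even k. The statement asks for an attained maximum.
-- Excluded middle decides comparisons of reals, and the maximum then runs over finitely many graph
-- codes and the finite list of roots of each. Since conjugates of chromatic roots are chromatic
-- roots, a root with large |Im z| gives one with large Im z. The reals stay an abstract interface
-- until the end, so that arithmetic is not unfolded to Cauchy sequences.

-- The real numbers as an Archimedean, complete ordered ring.

record RealNumbers : Set₁ where
  field
    commutativeRing : CommutativeRing 0ℓ 0ℓ
  open CommutativeRing commutativeRing public
    renaming (refl to ≈-refl; sym to ≈-sym; trans to ≈-trans; reflexive to ≈-reflexive)
    hiding (zero)
  infix 4 _≤_
  field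
    _≤_          : Carrier → Carrier → Set
    ≤-reflexive  : ∀ {x y} → x ≈ y → x ≤ y
    ≤-trans      : ∀ {x y z} → x ≤ y → y ≤ z → x ≤ z
    ≤-antisym    : ∀ {x y} → x ≤ y → y ≤ x → x ≈ y
    ≤-total      : ∀ x y → x ≤ y ⊎ y ≤ x
    +-monoʳ-≤    : ∀ x {y z} → y ≤ z → x + y ≤ x + z
    *-nonNeg     : ∀ {x y} → 0# ≤ x → 0# ≤ y → 0# ≤ x * y
    ι            : ℚ → Carrier
    ι-+          : ∀ p q → ι (p ℚ.+ q) ≈ ι p + ι q
    ι-*          : ∀ p q → ι (p ℚ.* q) ≈ ι p * ι q
    ι-neg        : ∀ p → ι (ℚ.- p) ≈ - ι p
    ι-0          : ι 0ℚ ≈ 0#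
    ι-1          : ι 1ℚ ≈ 1#
    ι-mono-≤     : ∀ {p q} → p ℚ.≤ q → ι p ≤ ι q
    ι-cancel-≤   : ∀ {p q} → ι p ≤ ι q → p ℚ.≤ q
    ι-above      : ∀ x → ∃[ q ] x ≤ ι q
    ι-below      : ∀ x → ¬ (x ≤ 0#) → ∃[ q ] 0ℚ ℚ.< q × ι q ≤ x
    -- Completeness, with rational endpoints because the bisection that locates a minimum stays
    -- among rational squares.
    nested       : ∀ (a w : ℕ → ℚ) →
                   (∀ n → 0ℚ ℚ.≤ w n) →
                   (∀ n → a n ℚ.≤ a (suc n)) →
                   (∀ n → a (suc n) ℚ.+ w (suc n) ℚ.≤ a n ℚ.+ w n) →
                   (∀ ε → 0ℚ ℚ.< ε → ∃[ n ] w n ℚ.< ε) →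
                   ∃[ x ] (∀ n → ι (a n) ≤ x × x ≤ ι (a n ℚ.+ w n))

-- Order and arithmetic of the reals.

module OrderedField (𝓡 : RealNumbers) (em : ExcludedMiddle 0ℓ) where

  open RealNumbers 𝓡 public

  open import Data.Maybe using (Maybe; just; nothing)
  open import Algebra.Solver.Ring.AlmostCommutativeRing
    using (fromCommutativeRing; _-Raw-AlmostCommutative⟶_)
  open import Algebra.Bundles.Raw using (RawRing)
  open import Algebra.Properties.Ring ring public
    using (-0#≈0#; -‿involutive; -‿distribˡ-*; -‿+-comm)

  rationalsRaw : RawRing 0ℓ 0ℓ
  rationalsRaw = CommutativeRing.rawRing ℚ.+-*-commutativeRing

  -- Makes the rationals the coefficients of the ring solver, so that numerical constants in an
  -- identity are combined by computation.
  ι-homomorphism : rationalsRaw -Raw-AlmostCommutative⟶ fromCommutativeRing commutativeRing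
  ι-homomorphism = record
    { ⟦_⟧ = ι ; +-homo = ι-+ ; *-homo = ι-* ; -‿homo = ι-neg ; 0-homo = ι-0 ; 1-homo = ι-1 }

  sameRational? : ∀ p q → Maybe (ι p ≈ ι q)
  sameRational? p q with p ℚ.≟ q
  ... | yes ≡.refl = just ≈-refl
  ... | no _       = nothing

  module Solver where
    open import Algebra.Solver.Ring rationalsRaw (fromCommutativeRing commutativeRing)
      ι-homomorphism sameRational? public
      using (solve; _:=_; _:+_; _:*_; _:-_; :-_; con)

  open Solver

  infix 4 _<_

  -- As a negation, strict order fits proofs by contradiction: `≮⇒≥` is double negation elimination.
  _<_ : Carrier → Carrier → Set
  x < y = ¬ (y ≤ x)

  ≤-refl : ∀ {x} → x ≤ x
  ≤-refl = ≤-reflexive ≈-refl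

  <⇒≤ : ∀ {x y} → x < y → x ≤ y
  <⇒≤ {x} {y} x<y with ≤-total x y
  ... | inj₁ x≤y = x≤y
  ... | inj₂ y≤x = contradiction y≤x x<y

  ≮⇒≥ : ∀ {x y} → ¬ (x < y) → y ≤ x
  ≮⇒≥ = decidable-stable em

  ≤-<-trans : ∀ {x y z} → x ≤ y → y < z → x < z
  ≤-<-trans x≤y y<z z≤x = y<z (≤-trans z≤x x≤y)

  <-≤-trans : ∀ {x y z} → x < y → y ≤ z → x < z
  <-≤-trans x<y y≤z z≤x = x<y (≤-trans y≤z z≤x)

  ≤-respʳ : ∀ {x y z} → y ≈ z → x ≤ y → x ≤ z
  ≤-respʳ y≈z x≤y = ≤-trans x≤y (≤-reflexive y≈z)

  ≤-respˡ : ∀ {x y z} → x ≈ y → x ≤ z → y ≤ z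
  ≤-respˡ x≈y x≤z = ≤-trans (≤-reflexive (≈-sym x≈y)) x≤z

  +-monoˡ-≤ : ∀ z {x y} → x ≤ y → x + z ≤ y + z
  +-monoˡ-≤ z {x} {y} x≤y =
    ≤-respˡ (+-comm z x) (≤-respʳ (+-comm z y) (+-monoʳ-≤ z x≤y))

  +-mono-≤ : ∀ {x y u v} → x ≤ y → u ≤ v → x + u ≤ y + v
  +-mono-≤ {y = y} {u = u} x≤y u≤v = ≤-trans (+-monoˡ-≤ u x≤y) (+-monoʳ-≤ y u≤v)

  +-nonNeg : ∀ {x y} → 0# ≤ x → 0# ≤ y → 0# ≤ x + y
  +-nonNeg 0≤x 0≤y = ≤-respˡ (+-identityˡ 0#) (+-mono-≤ 0≤x 0≤y)

  -- An inequality is proved by exhibiting the difference of its two sides.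
  ≤-by : ∀ {x y d} → 0# ≤ d → x + d ≈ y → x ≤ y
  ≤-by {x} 0≤d x+d≈y = ≤-respʳ x+d≈y (≤-respˡ (+-identityʳ x) (+-monoʳ-≤ x 0≤d))

  difference : ∀ {x y} → x ≤ y → 0# ≤ y - x
  difference {x} {y} x≤y = ≤-respˡ (-‿inverseʳ x) (+-monoˡ-≤ (- x) x≤y)

  neg-mono-≤ : ∀ {x y} → x ≤ y → - y ≤ - x
  neg-mono-≤ {x} {y} x≤y =
    ≤-by (difference x≤y) (solve 2 (λ x y → :- y :+ (y :- x) := :- x) ≈-refl x y)

  neg-nonNeg : ∀ {x} → x ≤ 0# → 0# ≤ - x
  neg-nonNeg x≤0 = ≤-respˡ -0#≈0# (neg-mono-≤ x≤0)

  *-monoˡ-≤ : ∀ {x y z} → 0# ≤ x → y ≤ z → x * y ≤ x * z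
  *-monoˡ-≤ {x} {y} {z} 0≤x y≤z = ≤-by (*-nonNeg 0≤x (difference y≤z))
    (solve 3 (λ x y z → x :* y :+ x :* (z :- y) := x :* z) ≈-refl x y z)

  *-mono-≤ : ∀ {x y u v} → 0# ≤ x → 0# ≤ v → x ≤ y → u ≤ v → x * u ≤ y * v
  *-mono-≤ {x} {y} {u} {v} 0≤x 0≤v x≤y u≤v = ≤-trans (*-monoˡ-≤ 0≤x u≤v)
    (≤-respˡ (*-comm v x) (≤-respʳ (*-comm v y) (*-monoˡ-≤ 0≤v x≤y)))

  square-nonNeg : ∀ x → 0# ≤ x * x
  square-nonNeg x with ≤-total 0# x
  ... | inj₁ 0≤x = *-nonNeg 0≤x 0≤x
  ... | inj₂ x≤0 = ≤-respʳ (solve 1 (λ x → :- x :* :- x := x :* x) ≈-refl x)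
                     (*-nonNeg (neg-nonNeg x≤0) (neg-nonNeg x≤0))

  ι-nonNeg : ∀ {p} → 0ℚ ℚ.≤ p → 0# ≤ ι p
  ι-nonNeg 0≤p = ≤-respˡ ι-0 (ι-mono-≤ 0≤p)

  ι-pos : ∀ {p} → 0ℚ ℚ.< p → 0# < ι p
  ι-pos 0<p ιp≤0 = ℚ.<-irrefl ≡.refl (ℚ.<-≤-trans 0<p (ι-cancel-≤ (≤-respʳ (≈-sym ι-0) ιp≤0)))

  rational-below : ∀ {x} → 0# < x → ∃[ q ] 0ℚ ℚ.< q × ι q ≤ x
  rational-below {x} = ι-below x

  0≤1 : 0# ≤ 1#
  0≤1 = ≤-respʳ (*-identityˡ 1#) (square-nonNeg 1#)

  -- The interface gives only nonnegativity of products. Strictness comes from positive rationals p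
  -- ≤ x and q ≤ y, since p q is then a positive rational below x y.
  pos-*-pos : ∀ {x y} → 0# < x → 0# < y → 0# < x * y
  pos-*-pos 0<x 0<y with rational-below 0<x | rational-below 0<y
  ... | p , 0<p , p≤x | q , 0<q , q≤y = <-≤-trans
    (ι-pos {p ℚ.* q} (ℚ.positive⁻¹ (p ℚ.* q) {{ℚ.pos*pos⇒pos p {{ℚ.positive 0<p}} q {{ℚ.positive 0<q}}}}))
    (≤-respˡ (≈-sym (ι-* p q)) (*-mono-≤ (ι-nonNeg (ℚ.<⇒≤ 0<p)) (<⇒≤ 0<y) p≤x q≤y))

  -- Stands in for division by c: if y < x, then c (x - y) would be positive.
  *-cancelˡ-≤ : ∀ {c x y} → 0# < c → c * x ≤ c * y → x ≤ y
  *-cancelˡ-≤ {c} {x} {y} 0<c cx≤cy = ≮⇒≥ λ y<x →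
    pos-*-pos 0<c (λ x-y≤0 → y<x (≤-by (neg-nonNeg x-y≤0)
      (solve 2 (λ x y → x :+ :- (x :- y) := y) ≈-refl x y)))
      (≤-by (difference cx≤cy)
        (≈-trans (solve 3 (λ c x y → c :* (x :- y) :+ (c :* y :- c :* x) := con 0ℚ) ≈-refl c x y) ι-0))

  positive-product⇒positive : ∀ {c x} → 0# ≤ c → 0# < c * x → 0# < x
  positive-product⇒positive {c} {x} 0≤c 0<cx x≤0 =
    0<cx (≤-respʳ (zeroʳ c) (*-monoˡ-≤ 0≤c x≤0))

  -- Only rationals are inverted: by the Archimedean property this suffices to
  -- find a factor t that makes a given real as small as required.
  shrink : ∀ L {ρ} → 0# < ρ →
    ∃[ t ] 0ℚ ℚ.< t × t ℚ.≤ 1ℚ × ι t * L ≤ ρ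
  shrink L {ρ} 0<ρ with ι-above L | rational-below 0<ρ
  ... | A₀ , L≤A₀ | r , 0<r , r≤ρ = t , 0<t , t≤1 , bound
    where
    A = A₀ ℚ.⊔ 1ℚ
    0<A : 0ℚ ℚ.< A
    0<A = ℚ.<-≤-trans (ℚ.positive⁻¹ 1ℚ) (ℚ.p≤q⊔p A₀ 1ℚ)
    instance
      A-pos : ℚ.Positive A
      A-pos = ℚ.positive 0<A
      A-nonZero : ℚ.NonZero A
      A-nonZero = ℚ.pos⇒nonZero A
      A⁻¹-pos : ℚ.Positive (ℚ.1/ A)
      A⁻¹-pos = ℚ.1/pos⇒pos A
    s = ℚ.1/ A ℚ.* r
    t = s ℚ.⊓ 1ℚ
    0<s : 0ℚ ℚ.< s
    0<s = ℚ.positive⁻¹ s {{ℚ.pos*pos⇒pos (ℚ.1/ A) r {{ℚ.positive 0<r}}}}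
    0<t : 0ℚ ℚ.< t
    0<t with ℚ.⊓-sel s 1ℚ
    ... | inj₁ eq = ≡.subst (0ℚ ℚ.<_) (≡.sym eq) 0<s
    ... | inj₂ eq = ≡.subst (0ℚ ℚ.<_) (≡.sym eq) (ℚ.positive⁻¹ 1ℚ)
    t≤1 : t ℚ.≤ 1ℚ
    t≤1 = ℚ.p⊓q≤q s 1ℚ
    tA≤r : t ℚ.* A ℚ.≤ r
    tA≤r = ℚ.≤-trans (ℚ.*-monoʳ-≤-nonNeg A {{ℚ.pos⇒nonNeg A}} (ℚ.p⊓q≤p s 1ℚ))
      (ℚ.≤-reflexive (≡.trans (ℚ.*-comm s A) (≡.trans (≡.sym (ℚ.*-assoc A (ℚ.1/ A) r))
        (≡.trans (≡.cong (ℚ._* r) (ℚ.*-inverseʳ A)) (ℚ.*-identityˡ r)))))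
    bound : ι t * L ≤ ρ
    bound = ≤-trans (*-monoˡ-≤ (ι-nonNeg (ℚ.<⇒≤ 0<t))
              (≤-trans L≤A₀ (ι-mono-≤ (ℚ.p≤p⊔q A₀ 1ℚ))))
            (≤-trans (≤-respˡ (ι-* t A) (ι-mono-≤ tA≤r)) r≤ρ)

  sign : ∀ x → x < 0# ⊎ x ≈ 0# ⊎ 0# < x
  sign x with em {P = 0# ≤ x} | em {P = x ≤ 0#}
  ... | no x<0  | _       = inj₁ x<0
  ... | yes _   | no 0<x  = inj₂ (inj₂ 0<x)
  ... | yes 0≤x | yes x≤0 = inj₂ (inj₁ (≤-antisym x≤0 0≤x))

  square-pos : ∀ {x} → ¬ (x ≈ 0#) → 0# < x * x
  square-pos {x} x≉0 with sign x
  ... | inj₁ x<0 = λ xx≤0 → pos-*-pos 0<-x 0<-x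
        (≤-respˡ (solve 1 (λ x → x :* x := :- x :* :- x) ≈-refl x) xx≤0)
    where
    0<-x : 0# < - x
    0<-x -x≤0 = x<0 (≤-respʳ (-‿involutive x) (neg-nonNeg -x≤0))
  ... | inj₂ (inj₁ x≈0) = contradiction x≈0 x≉0
  ... | inj₂ (inj₂ 0<x) = pos-*-pos 0<x 0<x

  maximum : ∀ {n} (f : Fin (suc n) → Carrier) → ∃[ i ] (∀ j → f j ≤ f i)
  maximum {zero}  f = Fin.zero , λ { Fin.zero → ≤-refl }
  maximum {suc n} f with maximum (λ i → f (Fin.suc i))
  ... | i , f≤fi with ≤-total (f Fin.zero) (f (Fin.suc i))
  ...   | inj₁ f0≤ = Fin.suc i , λ { Fin.zero → f0≤ ; (Fin.suc j) → f≤fi j }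
  ...   | inj₂ ≤f0 = Fin.zero , λ { Fin.zero → ≤-refl ; (Fin.suc j) → ≤-trans (f≤fi j) ≤f0 }

-- Complex numbers, their squared norm and their inner product.

module ComplexNumbers (𝓡 : RealNumbers) (em : ExcludedMiddle 0ℓ) where

  open OrderedField 𝓡 em
  open Solver
  open import Algebra.Bundles.Raw using (RawRing)
  open import Algebra.Solver.Ring.AlmostCommutativeRing
    using (fromCommutativeRing; _-Raw-AlmostCommutative⟶_)
  open import Data.Maybe using (Maybe; just; nothing)

  infix  4 _≋_
  infixl 6 _⊕_ _⊖_
  infixl 7 _⊗_
  infix  8 ⊝_

  record Cx : Set where
    constructor _+i_
    field
      re im : Carrier
  open Cx public

  record _≋_ (z w : Cx) : Set where
    constructor _&_
    field
      re-≈ : re z ≈ re w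
      im-≈ : im z ≈ im w
  open _≋_ public

  2ℚ : ℚ
  2ℚ = 1ℚ ℚ.+ 1ℚ

  -- Sealed so that complex terms stay atomic for unification and for the ring solver; only blocks
  -- that unfold them see real and imaginary parts.
  opaque
    _⊕_ : Cx → Cx → Cx
    z ⊕ w = (re z + re w) +i (im z + im w)

    _⊗_ : Cx → Cx → Cx
    z ⊗ w = (re z * re w + - (im z * im w)) +i (re z * im w + im z * re w)

    ⊝_ : Cx → Cx
    ⊝ z = (- re z) +i (- im z)

    real : Carrier → Cx
    real x = x +i 0#

    -- |z|² rather than |z|, to avoid square roots of reals.
    N : Cx → Carrier
    N z = re z * re z + im z * im z

    -- The Euclidean inner product of the plane, Re (z · conj w). Its sign tells whether a small
    -- step from z along w raises or lowers `N`.
    ⟨_,_⟩ : Cx → Cx → Carrier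
    ⟨ z , w ⟩ = re z * re w + im z * im w

    𝕚 : Cx
    𝕚 = 0# +i 1#

    conj : Cx → Cx
    conj z = re z +i (- im z)

  𝟘 𝟙 : Cx
  𝟘 = real 0#
  𝟙 = real 1#

  ≋-refl : ∀ {z} → z ≋ z
  ≋-refl = ≈-refl & ≈-refl

  ≋-sym : ∀ {z w} → z ≋ w → w ≋ z
  ≋-sym (p & q) = ≈-sym p & ≈-sym q

  ≋-trans : ∀ {z w u} → z ≋ w → w ≋ u → z ≋ u
  ≋-trans (p & q) (p′ & q′) = ≈-trans p p′ & ≈-trans q q′

  opaque
    unfolding _⊕_

    ⊕-cong : ∀ {z z′ w w′} → z ≋ z′ → w ≋ w′ → z ⊕ w ≋ z′ ⊕ w′
    ⊕-cong (p & q) (p′ & q′) = +-cong p p′ & +-cong q q′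

    ⊗-cong : ∀ {z z′ w w′} → z ≋ z′ → w ≋ w′ → z ⊗ w ≋ z′ ⊗ w′
    ⊗-cong (p & q) (p′ & q′) =
      +-cong (*-cong p p′) (-‿cong (*-cong q q′)) & +-cong (*-cong p q′) (*-cong q p′)

    ⊝-cong : ∀ {z w} → z ≋ w → ⊝ z ≋ ⊝ w
    ⊝-cong (p & q) = -‿cong p & -‿cong q

    ⊕-assoc : ∀ z w u → (z ⊕ w) ⊕ u ≋ z ⊕ (w ⊕ u)
    ⊕-assoc _ _ _ = +-assoc _ _ _ & +-assoc _ _ _

    ⊕-comm : ∀ z w → z ⊕ w ≋ w ⊕ z
    ⊕-comm _ _ = +-comm _ _ & +-comm _ _

    ⊕-identityˡ : ∀ z → 𝟘 ⊕ z ≋ z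
    ⊕-identityˡ _ = +-identityˡ _ & +-identityˡ _

    ⊝-inverseˡ : ∀ z → ⊝ z ⊕ z ≋ 𝟘
    ⊝-inverseˡ _ = -‿inverseˡ _ & -‿inverseˡ _

    ⊗-assoc : ∀ z w u → (z ⊗ w) ⊗ u ≋ z ⊗ (w ⊗ u)
    ⊗-assoc (a +i b) (c +i d) (e +i f) =
      solve 6 (λ a b c d e f → (a :* c :+ :- (b :* d)) :* e :+ :- ((a :* d :+ b :* c) :* f)
                := a :* (c :* e :+ :- (d :* f)) :+ :- (b :* (c :* f :+ d :* e)))
        ≈-refl a b c d e f &
      solve 6 (λ a b c d e f → (a :* c :+ :- (b :* d)) :* f :+ (a :* d :+ b :* c) :* e
                := a :* (c :* f :+ d :* e) :+ b :* (c :* e :+ :- (d :* f)))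
        ≈-refl a b c d e f

    ⊗-comm : ∀ z w → z ⊗ w ≋ w ⊗ z
    ⊗-comm (a +i b) (c +i d) =
      +-cong (*-comm a c) (-‿cong (*-comm b d)) &
      ≈-trans (+-comm _ _) (+-cong (*-comm b c) (*-comm a d))

    ⊗-identityˡ : ∀ z → 𝟙 ⊗ z ≋ z
    ⊗-identityˡ (a +i b) =
      ≈-trans (+-cong (*-identityˡ a) (≈-trans (-‿cong (zeroˡ b)) -0#≈0#)) (+-identityʳ a) &
      ≈-trans (+-cong (*-identityˡ b) (zeroˡ a)) (+-identityʳ b)

    ⊗-distribʳ-⊕ : ∀ z w u → (w ⊕ u) ⊗ z ≋ w ⊗ z ⊕ u ⊗ z
    ⊗-distribʳ-⊕ (a +i b) (c +i d) (e +i f) =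
      solve 6 (λ a b c d e f → (c :+ e) :* a :+ :- ((d :+ f) :* b)
                := (c :* a :+ :- (d :* b)) :+ (e :* a :+ :- (f :* b))) ≈-refl a b c d e f &
      solve 6 (λ a b c d e f → (c :+ e) :* b :+ (d :+ f) :* a
                := (c :* b :+ d :* a) :+ (e :* b :+ f :* a)) ≈-refl a b c d e f

    real-cong : ∀ {x y} → x ≈ y → real x ≋ real y
    real-cong x≈y = x≈y & ≈-refl

    real-+ : ∀ x y → real (x + y) ≋ real x ⊕ real y
    real-+ x y = ≈-refl & ≈-sym (+-identityˡ 0#)

    real-* : ∀ x y → real (x * y) ≋ real x ⊗ real y
    real-* x y =
      ≈-sym (≈-trans (+-congˡ (≈-trans (-‿cong (zeroˡ 0#)) -0#≈0#)) (+-identityʳ _)) &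
      ≈-sym (≈-trans (+-cong (zeroʳ x) (zeroˡ y)) (+-identityʳ 0#))

    real-neg : ∀ x → real (- x) ≋ ⊝ real x
    real-neg x = ≈-refl & ≈-sym -0#≈0#

    N-cong : ∀ {z w} → z ≋ w → N z ≈ N w
    N-cong (p & q) = +-cong (*-cong p p) (*-cong q q)

    N-⊗ : ∀ z w → N (z ⊗ w) ≈ N z * N w
    N-⊗ (a +i b) (c +i d) = solve 4 (λ a b c d →
      (a :* c :+ :- (b :* d)) :* (a :* c :+ :- (b :* d)) :+ (a :* d :+ b :* c) :* (a :* d :+ b :* c)
        := (a :* a :+ b :* b) :* (c :* c :+ d :* d)) ≈-refl a b c d

    N-nonNeg : ∀ z → 0# ≤ N z
    N-nonNeg z = +-nonNeg (square-nonNeg (re z)) (square-nonNeg (im z))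

    -- The parallelogram law with the term N (z - w) dropped.
    N-⊕ : ∀ z w → N (z ⊕ w) ≤ ι 2ℚ * N z + ι 2ℚ * N w
    N-⊕ z@(a +i b) w@(c +i d) = ≤-by (N-nonNeg (z ⊕ ⊝ w)) (solve 4 (λ a b c d →
      ((a :+ c) :* (a :+ c) :+ (b :+ d) :* (b :+ d)) :+ ((a :- c) :* (a :- c) :+ (b :- d) :* (b :- d))
        := con 2ℚ :* (a :* a :+ b :* b) :+ con 2ℚ :* (c :* c :+ d :* d)) ≈-refl a b c d)

    N-⊝ : ∀ z → N (⊝ z) ≈ N z
    N-⊝ (a +i b) = solve 2 (λ a b → :- a :* :- a :+ :- b :* :- b := a :* a :+ b :* b) ≈-refl a b

    N-real : ∀ x → N (real x) ≈ x * x
    N-real x = ≈-trans (+-congˡ (zeroˡ 0#)) (+-identityʳ _)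

    N-expand : ∀ z w → N (z ⊕ w) ≈ N z + ι 2ℚ * ⟨ z , w ⟩ + N w
    N-expand (a +i b) (c +i d) = solve 4 (λ a b c d →
      (a :+ c) :* (a :+ c) :+ (b :+ d) :* (b :+ d)
        := (a :* a :+ b :* b) :+ con 2ℚ :* (a :* c :+ b :* d) :+ (c :* c :+ d :* d)) ≈-refl a b c d

    ⟨⟩-cong : ∀ z {w w′} → w ≋ w′ → ⟨ z , w ⟩ ≈ ⟨ z , w′ ⟩
    ⟨⟩-cong z (p & q) = +-cong (*-congˡ p) (*-congˡ q)

    ⟨⟩-⊕ : ∀ z w w′ → ⟨ z , w ⊕ w′ ⟩ ≈ ⟨ z , w ⟩ + ⟨ z , w′ ⟩
    ⟨⟩-⊕ (a +i b) (c +i d) (e +i f) = solve 6 (λ a b c d e f →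
      a :* (c :+ e) :+ b :* (d :+ f) := (a :* c :+ b :* d) :+ (a :* e :+ b :* f))
        ≈-refl a b c d e f

    ⟨⟩-⊝ : ∀ z w → ⟨ z , ⊝ w ⟩ ≈ - ⟨ z , w ⟩
    ⟨⟩-⊝ (a +i b) (c +i d) = solve 4 (λ a b c d →
      a :* :- c :+ b :* :- d := :- (a :* c :+ b :* d)) ≈-refl a b c d

    ⟨⟩-real : ∀ x z w → ⟨ z , real x ⊗ w ⟩ ≈ x * ⟨ z , w ⟩
    ⟨⟩-real x (a +i b) (c +i d) = ≈-trans
      (+-cong (*-congˡ (+-congˡ (-‿cong (zeroˡ d)))) (*-congˡ (+-congˡ (zeroˡ c))))
      (≈-trans (+-cong (*-congˡ (≈-trans (+-congˡ -0#≈0#) (+-identityʳ _))) (*-congˡ (+-identityʳ _)))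
        (solve 5 (λ x a b c d → a :* (x :* c) :+ b :* (x :* d) := x :* (a :* c :+ b :* d))
          ≈-refl x a b c d))

    -- Pythagoras in the orthogonal frame w, w i, whose two vectors have equal norm. It shows that a
    -- nonzero z is not orthogonal to both when w is nonzero.
    ⟨⟩-𝕚-square : ∀ z w → ⟨ z , w ⟩ * ⟨ z , w ⟩ + ⟨ z , w ⊗ 𝕚 ⟩ * ⟨ z , w ⊗ 𝕚 ⟩ ≈ N z * N w
    ⟨⟩-𝕚-square (a +i b) (c +i d) = ≈-trans (+-congˡ (*-cong step step))
      (solve 4 (λ a b c d → (a :* c :+ b :* d) :* (a :* c :+ b :* d) :+
          (a :* (:- d) :+ b :* c) :* (a :* (:- d) :+ b :* c)
            := (a :* a :+ b :* b) :* (c :* c :+ d :* d)) ≈-refl a b c d)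
      where
      step : a * (c * 0# + - (d * 1#)) + b * (c * 1# + d * 0#) ≈ a * (- d) + b * c
      step = +-cong
        (*-congˡ (≈-trans (+-cong (zeroʳ c) (-‿cong (*-identityʳ d))) (+-identityˡ _)))
        (*-congˡ (≈-trans (+-cong (*-identityʳ c) (zeroʳ d)) (+-identityʳ _)))

    𝕚²≋-1 : 𝕚 ⊗ 𝕚 ≋ ⊝ 𝟙
    𝕚²≋-1 =
      ≈-trans (+-cong (zeroˡ 0#) (-‿cong (*-identityˡ 1#))) (+-identityˡ _) &
      ≈-trans (+-cong (zeroˡ 1#) (zeroʳ 1#)) (≈-trans (+-identityˡ 0#) (≈-sym -0#≈0#))

    N≈0⇒≋𝟘 : ∀ {z} → N z ≈ 0# → z ≋ 𝟘
    N≈0⇒≋𝟘 {z} Nz≈0 = zero-square re²≤0 & zero-square im²≤0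
      where
      zero-square : ∀ {x} → x * x ≤ 0# → x ≈ 0#
      zero-square {x} xx≤0 with em {P = x ≈ 0#}
      ... | yes x≈0 = x≈0
      ... | no  x≉0 = contradiction xx≤0 (square-pos x≉0)
      re²≤0 : re z * re z ≤ 0#
      re²≤0 = ≤-by (square-nonNeg (im z)) Nz≈0
      im²≤0 : im z * im z ≤ 0#
      im²≤0 = ≤-by (square-nonNeg (re z)) (≈-trans (+-comm _ _) Nz≈0)

    ⊕-pair : ∀ a b c d → (a +i b) ⊕ (c +i d) ≋ (a + c) +i (b + d)
    ⊕-pair a b c d = ≋-refl

    ⊗-pair : ∀ a b c d → (a +i b) ⊗ (c +i d) ≋ (a * c + - (b * d)) +i (a * d + b * c)
    ⊗-pair a b c d = ≋-refl

    real-pair : ∀ x → real x ≋ x +i 0#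
    real-pair x = ≋-refl

    re-⊕ : ∀ z w → re (z ⊕ w) ≈ re z + re w
    re-⊕ z w = ≈-refl

    re²≤N : ∀ z → re z * re z ≤ N z
    re²≤N z = ≤-by (square-nonNeg (im z)) ≈-refl

    im²≤N : ∀ z → im z * im z ≤ N z
    im²≤N z = ≤-by (square-nonNeg (re z)) (+-comm _ _)

    N-bound : ∀ {z K} → re z * re z ≤ K → im z * im z ≤ K → N z ≤ K + K
    N-bound = +-mono-≤

    conj-⊕ : ∀ z w → conj (z ⊕ w) ≋ conj z ⊕ conj w
    conj-⊕ z w = ≈-refl & ≈-sym (-‿+-comm _ _)

    conj-⊗ : ∀ z w → conj (z ⊗ w) ≋ conj z ⊗ conj w
    conj-⊗ (a +i b) (c +i d) =
      solve 4 (λ a b c d → a :* c :+ :- (b :* d) := a :* c :+ :- (:- b :* :- d)) ≈-refl a b c d &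
      solve 4 (λ a b c d → :- (a :* d :+ b :* c) := a :* :- d :+ :- b :* c) ≈-refl a b c d

    conj-real : ∀ x → conj (real x) ≋ real x
    conj-real x = ≈-refl & -0#≈0#

    conj-cong : ∀ {z w} → z ≋ w → conj z ≋ conj w
    conj-cong (p & q) = p & -‿cong q

    im-conj : ∀ z → im (conj z) ≈ - im z
    im-conj z = ≈-refl

    re-square : ∀ z → re (z ⊗ z) ≈ re z * re z - im z * im z
    re-square z = ≈-refl

    re-real : ∀ x → re (real x) ≈ x
    re-real x = ≈-refl

  complexRing : CommutativeRing 0ℓ 0ℓ
  complexRing = record
    { Carrier = Cx ; _≈_ = _≋_ ; _+_ = _⊕_ ; _*_ = _⊗_ ; -_ = ⊝_ ; 0# = 𝟘 ; 1# = 𝟙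
    ; isCommutativeRing = record
      { isRing = record
        { +-isAbelianGroup = record
          { isGroup = record
            { isMonoid = record
              { isSemigroup = record
                { isMagma = record
                  { isEquivalence = record { refl = ≋-refl ; sym = ≋-sym ; trans = ≋-trans }
                  ; ∙-cong = ⊕-cong }
                ; assoc = ⊕-assoc }
              ; identity = comm∧idˡ⇒id ⊕-comm ⊕-identityˡ }
            ; inverse = comm∧invˡ⇒inv ⊕-comm ⊝-inverseˡ
            ; ⁻¹-cong = ⊝-cong }
          ; comm = ⊕-comm }
        ; *-cong = ⊗-cong
        ; *-assoc = ⊗-assoc
        ; *-identity = comm∧idˡ⇒id ⊗-comm ⊗-identityˡ
        ; distrib = comm∧distrʳ⇒distr ⊕-cong ⊗-comm ⊗-distribʳ-⊕ }
      ; *-comm = ⊗-comm } }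
    where
    open import Relation.Binary using (Setoid)
    ≋-setoid : Setoid 0ℓ 0ℓ
    ≋-setoid = record { isEquivalence = record { refl = ≋-refl ; sym = ≋-sym ; trans = ≋-trans } }
    open import Algebra.Consequences.Setoid ≋-setoid

  module ℂ = CommutativeRing complexRing

  open import Algebra.Properties.CommutativeSemiring.Exp ℂ.commutativeSemiring public
    using (_^_; ^-congˡ; ^-distrib-*; ^-assocʳ)

  _⊖_ : Cx → Cx → Cx
  z ⊖ w = z ⊕ ⊝ w

  ιᶜ-homomorphism : rationalsRaw -Raw-AlmostCommutative⟶ fromCommutativeRing complexRing
  ιᶜ-homomorphism = record
    { ⟦_⟧    = λ p → real (ι p)
    ; +-homo = λ p q → ≋-trans (real-cong (ι-+ p q)) (real-+ _ _)
    ; *-homo = λ p q → ≋-trans (real-cong (ι-* p q)) (real-* _ _)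
    ; -‿homo = λ p → ≋-trans (real-cong (ι-neg p)) (real-neg _)
    ; 0-homo = real-cong ι-0
    ; 1-homo = real-cong ι-1 }

  sameComplexRational? : ∀ p q → Maybe (real (ι p) ≋ real (ι q))
  sameComplexRational? p q with p ℚ.≟ q
  ... | yes ≡.refl = just ≋-refl
  ... | no _       = nothing

  module ℂSolver where
    open import Algebra.Solver.Ring rationalsRaw (fromCommutativeRing complexRing)
      ιᶜ-homomorphism sameComplexRational? public
      using () renaming (solve to solveᶜ; con to conᶜ; _:=_ to infix 4 _:≋_;
        _:+_ to infixl 6 _:⊕_; _:-_ to infixl 6 _:⊖_; _:*_ to infixl 7 _:⊗_; :-_ to infix 8 :⊝_)

  open ℂSolver public

  N-𝟘 : N 𝟘 ≈ 0#
  N-𝟘 = ≈-trans (N-real 0#) (zeroˡ 0#)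

  N-𝟙 : N 𝟙 ≈ 1#
  N-𝟙 = ≈-trans (N-real 1#) (*-identityˡ 1#)

  N-pos : ∀ {z} → ¬ (z ≋ 𝟘) → 0# < N z
  N-pos z≉0 Nz≤0 = z≉0 (N≈0⇒≋𝟘 (≤-antisym Nz≤0 (N-nonNeg _)))

  ⊗-zero : ∀ {z w} → z ⊗ w ≋ 𝟘 → z ≋ 𝟘 ⊎ w ≋ 𝟘
  ⊗-zero {z} {w} zw≋0 with em {P = z ≋ 𝟘} | em {P = w ≋ 𝟘}
  ... | yes z≋0 | _       = inj₁ z≋0
  ... | no  _   | yes w≋0 = inj₂ w≋0
  ... | no  z≉0 | no  w≉0 = contradiction
    (≤-reflexive (≈-trans (≈-sym (N-⊗ z w)) (≈-trans (N-cong zw≋0) N-𝟘)))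
    (pos-*-pos (N-pos z≉0) (N-pos w≉0))

  N-⊕-cancel : ∀ z w → N z ≤ ι 2ℚ * N (z ⊕ w) + ι 2ℚ * N w
  N-⊕-cancel z w = ≤-respˡ
    (N-cong (solveᶜ 2 (λ z w → (z :⊕ w) :⊕ :⊝ w :≋ z) ≋-refl z w))
    (≤-respʳ (+-congˡ (*-congˡ (N-⊝ w))) (N-⊕ (z ⊕ w) (⊝ w)))

-- Polynomials: growth at infinity, Taylor shift and local descent.

module Polynomials (𝓡 : RealNumbers) (em : ExcludedMiddle 0ℓ) where

  open OrderedField 𝓡 em public
  open ComplexNumbers 𝓡 em public
  open Solver

  evaluate : List Cx → Cx → Cx
  evaluate []      z = 𝟘
  evaluate (a ∷ p) z = a ⊕ z ⊗ evaluate p z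

  evaluate-cong : ∀ p {z w} → z ≋ w → evaluate p z ≋ evaluate p w
  evaluate-cong []      z≋w = ≋-refl
  evaluate-cong (a ∷ p) z≋w = ⊕-cong ≋-refl (⊗-cong z≋w (evaluate-cong p z≋w))

  Zero : List Cx → Set
  Zero = All (_≋ 𝟘)

  evaluate-Zero : ∀ {p} → Zero p → ∀ z → evaluate p z ≋ 𝟘
  evaluate-Zero {[]}    []            z = ≋-refl
  evaluate-Zero {a ∷ p} (a≋0 ∷ p≋0) z =
    ≋-trans (⊕-cong a≋0 (⊗-cong ≋-refl (evaluate-Zero p≋0 z)))
      (≋-trans (⊕-identityˡ _) (ℂ.zeroʳ z))

  -- The divisor c stays rational so that it can be inverted.
  BoundedBelow : List Cx → Set
  BoundedBelow p = ∃[ c ] 0ℚ ℚ.< c × ∃[ R ] 0# ≤ R × (∀ w → R ≤ N w → ι c ≤ N (evaluate p w))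

  Unbounded : List Cx → Set
  Unbounded p = ∀ K → 0# ≤ K → ∃[ R ] 0# ≤ R × (∀ w → R ≤ N w → K ≤ N (evaluate p w))

  0≤2 : 0# ≤ ι 2ℚ
  0≤2 = ι-nonNeg (ℚ.<⇒≤ (ℚ.positive⁻¹ 2ℚ))

  -- The threshold T is chosen with T c = 2 (K + N a). Beyond it N (w v) ≥ 2 (K + N a), and adding a
  -- leaves at least N (w v) / 2 - N a ≥ K.
  Unbounded-∷ : ∀ a {p} → BoundedBelow p → Unbounded (a ∷ p)
  Unbounded-∷ a {p} (c , 0<c , R , 0≤R , c≤Np) K 0≤K = R + T , +-nonNeg 0≤R 0≤T , λ w R+T≤Nw →
    let v = evaluate p w
        R≤Nw : R ≤ N w
        R≤Nw = ≤-trans (≤-by 0≤T ≈-refl) R+T≤Nw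
        T≤Nw : T ≤ N w
        T≤Nw = ≤-trans (≤-by 0≤R (+-comm T R)) R+T≤Nw
        2[K+Na]≤Nwv : ι 2ℚ * (K + N a) ≤ N (w ⊗ v)
        2[K+Na]≤Nwv = ≤-respʳ (≈-sym (N-⊗ w v)) (≤-respˡ Tc≈
          (*-mono-≤ 0≤T (N-nonNeg v) T≤Nw (c≤Np w R≤Nw)))
        step : ι 2ℚ * K + ι 2ℚ * N a ≤ ι 2ℚ * N (a ⊕ w ⊗ v) + ι 2ℚ * N a
        step = ≤-trans (≤-respˡ (distribˡ (ι 2ℚ) K (N a)) 2[K+Na]≤Nwv)
          (≤-respʳ (+-congʳ (*-congˡ (N-cong (⊕-comm (w ⊗ v) a)))) (N-⊕-cancel (w ⊗ v) a))
    in *-cancelˡ-≤ (ι-pos (ℚ.positive⁻¹ 2ℚ)) (+-cancelʳ-≤ step)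
    where
    instance
      c-nonZero : ℚ.NonZero c
      c-nonZero = ℚ.pos⇒nonZero c {{ℚ.positive 0<c}}
    c⁻¹ = ℚ.1/ c
    0≤c⁻¹ : 0# ≤ ι c⁻¹
    0≤c⁻¹ = ι-nonNeg (ℚ.<⇒≤ (ℚ.positive⁻¹ c⁻¹ {{ℚ.1/pos⇒pos c {{ℚ.positive 0<c}}}}))
    T = ι c⁻¹ * (ι 2ℚ * (K + N a))
    0≤T : 0# ≤ T
    0≤T = *-nonNeg 0≤c⁻¹ (*-nonNeg 0≤2 (+-nonNeg 0≤K (N-nonNeg a)))
    Tc≈ : T * ι c ≈ ι 2ℚ * (K + N a)
    Tc≈ = ≈-trans (solve 3 (λ x y z → x :* y :* z := (x :* z) :* y) ≈-refl (ι c⁻¹) (ι 2ℚ * (K + N a)) (ι c))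
      (≈-trans (*-congʳ (≈-trans (≈-sym (ι-* c⁻¹ c))
        (≈-trans (≈-reflexive (≡.cong ι (ℚ.*-inverseˡ c))) ι-1))) (*-identityˡ _))
    +-cancelʳ-≤ : ∀ {x y z} → x + z ≤ y + z → x ≤ y
    +-cancelʳ-≤ {x} {y} {z} x+z≤y+z = ≤-by (difference x+z≤y+z)
      (solve 3 (λ x y z → x :+ ((y :+ z) :- (x :+ z)) := y) ≈-refl x y z)

  -- Takes the place of a degree. The highest nonzero coefficient is a constant bounded away from
  -- zero, and each lower coefficient is absorbed by `Unbounded-∷`.
  Zero⊎BoundedBelow : ∀ p → Zero p ⊎ BoundedBelow p
  Zero⊎BoundedBelow [] = inj₁ []
  Zero⊎BoundedBelow (a ∷ p) with Zero⊎BoundedBelow p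
  ... | inj₂ below = inj₂ (
    let R , 0≤R , 1≤N = Unbounded-∷ a {p} below 1# 0≤1
    in 1ℚ , ℚ.positive⁻¹ 1ℚ , R , 0≤R , λ w R≤ → ≤-respˡ (≈-sym ι-1) (1≤N w R≤))
  ... | inj₁ p≋0 with em {P = a ≋ 𝟘}
  ... | yes a≋0 = inj₁ (a≋0 ∷ p≋0)
  ... | no  a≉0 with rational-below (N-pos a≉0)
  ...   | c , 0<c , c≤Na = inj₂ (c , 0<c , 0# , ≤-refl , λ w _ →
          ≤-respʳ (N-cong (≋-sym (≋-trans (⊕-cong ≋-refl
            (≋-trans (⊗-cong ≋-refl (evaluate-Zero {p} p≋0 w)) (ℂ.zeroʳ w))) (ℂ.+-identityʳ a)))) c≤Na)

  bounded : ∀ p → ∃[ K ] 0# ≤ K × (∀ h → N h ≤ 1# → N (evaluate p h) ≤ K)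
  bounded [] = 0# , ≤-refl , λ h _ → ≤-reflexive N-𝟘
  bounded (a ∷ p) with bounded p
  ... | K , 0≤K , Np≤K = ι 2ℚ * N a + ι 2ℚ * K ,
    +-nonNeg (*-nonNeg 0≤2 (N-nonNeg a)) (*-nonNeg 0≤2 0≤K) , λ h Nh≤1 →
    ≤-trans (N-⊕ a (h ⊗ evaluate p h)) (+-monoʳ-≤ _ (*-monoˡ-≤ 0≤2
      (≤-respˡ (≈-sym (N-⊗ h (evaluate p h))) (≤-respʳ (*-identityˡ K)
        (*-mono-≤ (N-nonNeg h) 0≤K Nh≤1 (Np≤K h Nh≤1))))))

  linearTimes : Cx → Cx → List Cx → List Cx
  linearTimes z a []      = a ∷ []
  linearTimes z a (b ∷ p) = (a ⊕ z ⊗ b) ∷ linearTimes z b p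

  evaluate-linearTimes : ∀ z a p h →
    evaluate (linearTimes z a p) h ≋ a ⊕ (z ⊕ h) ⊗ evaluate p h
  evaluate-linearTimes z a []      h = ⊕-cong ≋-refl (≋-trans (ℂ.zeroʳ h) (≋-sym (ℂ.zeroʳ _)))
  evaluate-linearTimes z a (b ∷ p) h =
    ≋-trans (⊕-cong ≋-refl (⊗-cong ≋-refl (evaluate-linearTimes z b p h)))
      (solveᶜ 5 (λ z a b e h → (a :⊕ z :⊗ b) :⊕ h :⊗ (b :⊕ (z :⊕ h) :⊗ e)
        :≋ a :⊕ (z :⊕ h) :⊗ (b :⊕ h :⊗ e)) ≋-refl z a b (evaluate p h) h)

  -- Horner's scheme for the Taylor coefficients at z.
  shift : Cx → List Cx → List Cx
  shift z []      = []
  shift z (a ∷ p) = linearTimes z a (shift z p)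

  evaluate-shift : ∀ z p h → evaluate (shift z p) h ≋ evaluate p (z ⊕ h)
  evaluate-shift z []      h = ≋-refl
  evaluate-shift z (a ∷ p) h = ≋-trans (evaluate-linearTimes z a (shift z p) h)
    (⊕-cong ≋-refl (⊗-cong ≋-refl (evaluate-shift z p h)))

  length-linearTimes : ∀ z a p → length (linearTimes z a p) ≡ suc (length p)
  length-linearTimes z a []      = ≡.refl
  length-linearTimes z a (b ∷ p) = ≡.cong suc (length-linearTimes z b p)

  length-shift : ∀ z p → length (shift z p) ≡ length p
  length-shift z []      = ≡.refl
  length-shift z (a ∷ p) = ≡.trans (length-linearTimes z a (shift z p)) (≡.cong suc (length-shift z p))

  -- In place of a solution of b u^k = -a, a u is sought for which b u^k makes an obtuse angle with
  -- a: then a + s b u^k is closer to 0 than a for small s > 0.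
  Descends : ℕ → Set
  Descends k = ∀ {a b} → ¬ (a ≋ 𝟘) → ¬ (b ≋ 𝟘) → ∃[ u ] ⟨ a , b ⊗ u ^ k ⟩ < 0#

  real-^ : ∀ t → 0# ≤ t → t ≤ 1# → ∀ k → ∃[ τ ] 0# ≤ τ × τ ≤ 1# × (0# < t → 0# < τ) × real t ^ k ≋ real τ
  real-^ t 0≤t t≤1 zero = 1# , 0≤1 , ≤-refl ,
    (λ _ → <-≤-trans (ι-pos (ℚ.positive⁻¹ 1ℚ)) (≤-reflexive ι-1)) , ≋-refl
  real-^ t 0≤t t≤1 (suc k) with real-^ t 0≤t t≤1 k
  ... | τ , 0≤τ , τ≤1 , 0<τ , eq = t * τ , *-nonNeg 0≤t 0≤τ ,
    ≤-respʳ (*-identityˡ 1#) (*-mono-≤ 0≤t 0≤1 t≤1 τ≤1) ,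
    (λ 0<t → pos-*-pos 0<t (0<τ 0<t)) ,
    ≋-trans (⊗-cong ≋-refl eq) (≋-sym (real-* t τ))

  shrink₂ : ∀ L M {ρ σ} → 0# < ρ → 0# < σ →
    ∃[ t ] 0# < t × t ≤ 1# × t * L ≤ ρ × t * M ≤ σ
  shrink₂ L M {ρ} {σ} 0<ρ 0<σ =
    let s , 0<s , s≤1 , sL≤ρ = shrink L 0<ρ
        t , 0<t , t≤1 , tM≤σ = shrink M 0<σ
        s≤1′ = ≤-respʳ ι-1 (ι-mono-≤ s≤1)
        t≤1′ = ≤-respʳ ι-1 (ι-mono-≤ t≤1)
        0≤s = ι-nonNeg (ℚ.<⇒≤ 0<s)
        0≤t = ι-nonNeg (ℚ.<⇒≤ 0<t)
    in ι s * ι t , pos-*-pos (ι-pos 0<s) (ι-pos 0<t) ,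
       ≤-respʳ (*-identityˡ 1#) (*-mono-≤ 0≤s 0≤1 s≤1′ t≤1′) ,
       ≤-respˡ (solve 3 (λ s t L → t :* (s :* L) := s :* t :* L) ≈-refl (ι s) (ι t) L)
         (≤-respʳ (*-identityˡ ρ) (*-mono-≤ 0≤t (<⇒≤ 0<ρ) t≤1′ sL≤ρ)) ,
       ≤-respˡ (≈-sym (*-assoc (ι s) (ι t) M))
         (≤-respʳ (*-identityˡ σ) (*-mono-≤ 0≤s (<⇒≤ 0<σ) s≤1′ tM≤σ))

  -- From N (z - w) ≥ 0: a form of Cauchy-Schwarz without square roots.
  2⟨⟩≤ : ∀ z w → ι 2ℚ * ⟨ z , w ⟩ ≤ N z + N w
  2⟨⟩≤ z w = ≤-by (N-nonNeg (z ⊕ ⊝ w)) (≈-trans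
    (+-congˡ (≈-trans (N-expand z (⊝ w)) (+-cong (+-congˡ (*-congˡ (⟨⟩-⊝ z w))) (N-⊝ w))))
    (solve 3 (λ x n m → con 2ℚ :* x :+ (n :+ con 2ℚ :* :- x :+ m) := n :+ m)
      ≈-refl ⟨ z , w ⟩ (N z) (N w)))

  N-real-⊗ : ∀ t z → N (real t ⊗ z) ≈ t * t * N z
  N-real-⊗ t z = ≈-trans (N-⊗ (real t) z) (*-congʳ (N-real t))

  t²≤1 : ∀ {t} → 0# ≤ t → t ≤ 1# → t * t ≤ 1#
  t²≤1 0≤t t≤1 = ≤-respʳ (*-identityˡ 1#) (*-mono-≤ 0≤t 0≤1 t≤1 t≤1)

  -- For small t, the perturbation t^k (x + t y) of a has the sign of ⟨a, x⟩.
  decrease-along : ∀ {a x ρ} → ⟨ a , x ⟩ ≈ - ρ → 0# < ρ → ∀ {K} → 0# ≤ K → ∀ {t τ} →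
    0# < t → t ≤ 1# → 0# < τ → τ ≤ t →
    t * (N a + K + (ι 2ℚ * N x + ι 2ℚ * K)) ≤ ρ →
    ∀ {y} → N y ≤ K → N (a ⊕ real τ ⊗ (x ⊕ real t ⊗ y)) < N a
  decrease-along {a} {x} {ρ} ⟨a,x⟩ 0<ρ {K} 0≤K {t} {τ} 0<t t≤1 0<τ τ≤t tL≤ρ {y} Ny≤K Na≤ =
    pos-*-pos 0<τ 0<-E (difference-nonPos (≤-respʳ expand Na≤))
    where
    0≤t = <⇒≤ 0<t
    0≤τ = <⇒≤ 0<τ
    v = x ⊕ real t ⊗ y
    -- The difference quotient of `N` at a along v. The hypothesis on t bounds the last two summands
    -- together by ρ, so E ≤ -2ρ + ρ.
    E = ι 2ℚ * (- ρ) + t * (ι 2ℚ * ⟨ a , y ⟩) + τ * N v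
    expand : N (a ⊕ real τ ⊗ v) ≈ N a + τ * E
    expand = ≈-trans (N-expand a (real τ ⊗ v))
      (≈-trans (+-cong (+-congˡ (*-congˡ (≈-trans (⟨⟩-real τ a v) (*-congˡ
          (≈-trans (⟨⟩-⊕ a x (real t ⊗ y)) (+-cong ⟨a,x⟩ (⟨⟩-real t a y)))))))
          (N-real-⊗ τ v))
        (solve 6 (λ n τ ρ t p m →
          n :+ con 2ℚ :* (τ :* (:- ρ :+ t :* p)) :+ τ :* τ :* m
            := n :+ τ :* (con 2ℚ :* :- ρ :+ t :* (con 2ℚ :* p) :+ τ :* m))
          ≈-refl (N a) τ ρ t ⟨ a , y ⟩ (N v)))
    difference-nonPos : ∀ {n e} → n ≤ n + τ * e → τ * (- e) ≤ 0#
    difference-nonPos {n} {e} n≤ = ≤-by (difference n≤)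
      (≈-trans (solve 3 (λ n τ e → τ :* :- e :+ ((n :+ τ :* e) :- n) := con 0ℚ) ≈-refl n τ e) ι-0)
    Nv≤ : N v ≤ ι 2ℚ * N x + ι 2ℚ * K
    Nv≤ = ≤-trans (N-⊕ x (real t ⊗ y)) (+-monoʳ-≤ _ (*-monoˡ-≤ 0≤2
      (≤-respˡ (≈-sym (N-real-⊗ t y)) (≤-respʳ (*-identityˡ K)
        (*-mono-≤ (*-nonNeg 0≤t 0≤t) 0≤K (t²≤1 0≤t t≤1) Ny≤K)))))
    E≤-ρ : E ≤ - ρ
    E≤-ρ = ≤-trans
      (+-mono-≤ (+-monoʳ-≤ (ι 2ℚ * (- ρ)) (*-monoˡ-≤ 0≤t (≤-trans (2⟨⟩≤ a y) (+-monoʳ-≤ (N a) Ny≤K))))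
        (*-mono-≤ 0≤τ (+-nonNeg (*-nonNeg 0≤2 (N-nonNeg x)) (*-nonNeg 0≤2 0≤K)) τ≤t Nv≤))
      (≤-by (difference tL≤ρ) (solve 5 (λ ρ t n K m →
        con 2ℚ :* :- ρ :+ t :* (n :+ K) :+ t :* (con 2ℚ :* m :+ con 2ℚ :* K) :+
          (ρ :- t :* (n :+ K :+ (con 2ℚ :* m :+ con 2ℚ :* K))) := :- ρ) ≈-refl ρ t (N a) K (N x)))
    0<-E : 0# < - E
    0<-E = <-≤-trans 0<ρ (≤-respˡ (-‿involutive ρ) (neg-mono-≤ E≤-ρ))

  -- Zero coefficients are skipped by raising k. The first nonzero one, b, dominates near 0, so a
  -- short step along a direction u for the exponent k + 1 lowers `N`. The bound m records up to
  -- which exponent directions are available.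
  decrease : ∀ m → (∀ j → j ℕ.< m → Descends (suc j)) → ∀ {a} → ¬ (a ≋ 𝟘) →
    ∀ k r → k ℕ.+ length r ℕ.≤ m → ¬ Zero r →
    ∃[ h ] N (a ⊕ h ^ suc k ⊗ evaluate r h) < N a
  decrease m descends a≉0 k [] k≤m r≉0 = contradiction [] r≉0
  decrease m descends {a} a≉0 k (b ∷ r) k+r≤m r≉0 with em {P = b ≋ 𝟘}
  ... | yes b≋0 =
    let h , less = decrease m descends a≉0 (suc k) r
          (≡.subst (ℕ._≤ m) (ℕ.+-suc k (length r)) k+r≤m) (λ r≋0 → r≉0 (b≋0 ∷ r≋0))
    in h , ≤-<-trans (≤-reflexive (N-cong (⊕-cong ≋-refl
         (≋-trans (⊗-cong ≋-refl (≋-trans (⊕-cong b≋0 ≋-refl) (⊕-identityˡ _)))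
           (≋-trans (≋-sym (⊗-assoc _ _ _)) (⊗-cong (⊗-comm _ h) ≋-refl)))))) less
  ... | no  b≉0 =
    let j<m = ℕ.≤-trans (ℕ.≤-trans (ℕ.s≤s (ℕ.m≤m+n k (length r)))
                (ℕ.≤-reflexive (≡.sym (ℕ.+-suc k (length r))))) k+r≤m
        u , neg = descends k j<m a≉0 b≉0
        x  = b ⊗ u ^ suc k
        ρ  = - ⟨ a , x ⟩
        0<ρ : 0# < ρ
        0<ρ ρ≤0 = neg (≤-respʳ (-‿involutive _) (neg-nonNeg ρ≤0))
        K , 0≤K , Nr≤K = bounded r
        -- With h = t u, the increment h^(k+1) (b + h e) equals t^(k+1) (x + t c e), so c e is the
        -- perturbation and K′ its bound.
        c  = u ^ suc (suc k)
        K′ = N c * K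
        0≤K′ = *-nonNeg (N-nonNeg c) 0≤K
        t , 0<t , t≤1 , tL≤ρ , tNu≤1 =
          shrink₂ (N a + K′ + (ι 2ℚ * N x + ι 2ℚ * K′)) (N u) 0<ρ 0<1
        0≤t = <⇒≤ 0<t
        σ , 0≤σ , σ≤1 , 0<σ , t^k≋ = real-^ t 0≤t t≤1 k
        h  = real t ⊗ u
        e  = evaluate r h
        Nh≤1 : N h ≤ 1#
        Nh≤1 = ≤-respˡ (≈-sym (≈-trans (N-real-⊗ t u) (*-assoc t t (N u))))
          (≤-respʳ (*-identityˡ 1#) (*-mono-≤ 0≤t 0≤1 t≤1 tNu≤1))
        Ny≤K′ : N (c ⊗ e) ≤ K′
        Ny≤K′ = ≤-respˡ (≈-sym (N-⊗ c e)) (*-monoˡ-≤ (N-nonNeg c) (Nr≤K h Nh≤1))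
        h^≋ : h ^ suc k ≋ real (t * σ) ⊗ u ^ suc k
        h^≋ = ≋-trans (^-distrib-* (real t) u (suc k)) (⊗-cong
          (≋-trans (⊗-cong ≋-refl t^k≋) (≋-sym (real-* t σ))) ≋-refl)
    in h , ≤-<-trans
         (≤-reflexive (N-cong (⊕-cong ≋-refl (≋-trans (⊗-cong h^≋ ≋-refl)
           (rearrange (real (t * σ)) (u ^ suc k) b (real t) u e)))))
         (decrease-along (≈-sym (-‿involutive _)) 0<ρ 0≤K′ 0<t t≤1 (pos-*-pos 0<t (0<σ 0<t))
           (≤-respʳ (*-identityʳ t) (*-monoˡ-≤ 0≤t σ≤1)) tL≤ρ Ny≤K′)
    where
    0<1 : 0# < 1#
    0<1 = <-≤-trans (ι-pos (ℚ.positive⁻¹ 1ℚ)) (≤-reflexive ι-1)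
    rearrange : ∀ T U b t u e → (T ⊗ U) ⊗ (b ⊕ (t ⊗ u) ⊗ e) ≋ T ⊗ (b ⊗ U ⊕ t ⊗ ((u ⊗ U) ⊗ e))
    rearrange = solveᶜ 6 (λ T U b t u e →
      (T :⊗ U) :⊗ (b :⊕ (t :⊗ u) :⊗ e) :≋ T :⊗ (b :⊗ U :⊕ t :⊗ ((u :⊗ U) :⊗ e))) ≋-refl

-- Bisection of squares towards a minimum of |p|².

module Minimum (𝓡 : RealNumbers) (em : ExcludedMiddle 0ℓ) where

  open import Data.Integer using (+_; -[1+_])
  open Polynomials 𝓡 em public
  open Solver

  0≤½* : ∀ {q} → 0ℚ ℚ.≤ q → 0ℚ ℚ.≤ ½ ℚ.* q
  0≤½* {q} 0≤q = ℚ.nonNegative⁻¹ (½ ℚ.* q) {{ℚ.nonNeg*nonNeg⇒nonNeg ½ q {{ℚ.nonNegative 0≤q}}}}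

  width : ℚ → ℕ → ℚ
  width W zero    = W
  width W (suc n) = ½ ℚ.* width W n

  width-nonNeg : ∀ {W} → 0ℚ ℚ.≤ W → ∀ n → 0ℚ ℚ.≤ width W n
  width-nonNeg 0≤W zero    = 0≤W
  width-nonNeg 0≤W (suc n) = 0≤½* (width-nonNeg 0≤W n)

  fromℕℚ : ℕ → ℚ
  fromℕℚ zero    = 0ℚ
  fromℕℚ (suc n) = 1ℚ ℚ.+ fromℕℚ n

  fromℕℚ-nonNeg : ∀ n → 0ℚ ℚ.≤ fromℕℚ n
  fromℕℚ-nonNeg zero    = ℚ.≤-refl
  fromℕℚ-nonNeg (suc n) = ℚ.+-mono-≤ (ℚ.<⇒≤ (ℚ.positive⁻¹ 1ℚ)) (fromℕℚ-nonNeg n)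

  -- The inequality n + 1 ≤ 2^n, in the form that makes the widths tend to zero.
  width-bound : ∀ {W} → 0ℚ ℚ.≤ W → ∀ n → width W n ℚ.* fromℕℚ (suc n) ℚ.≤ W
  width-bound {W} 0≤W zero = ℚ.≤-reflexive (ℚ.*-identityʳ W)
  width-bound {W} 0≤W (suc n) = ℚ.≤-trans step (width-bound 0≤W n)
    where
    v = width W n
    m = fromℕℚ (suc n)
    step : ½ ℚ.* v ℚ.* (1ℚ ℚ.+ m) ℚ.≤ v ℚ.* m
    step = begin
      ½ ℚ.* v ℚ.* (1ℚ ℚ.+ m)   ≤⟨ ℚ.*-monoˡ-≤-nonNeg (½ ℚ.* v) {{ℚ.nonNegative (0≤½* (width-nonNeg 0≤W n))}}
                                    (ℚ.+-monoˡ-≤ m (ℚ.≤-trans (ℚ.≤-reflexive (≡.sym (ℚ.+-identityʳ 1ℚ)))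
                                      (ℚ.+-monoʳ-≤ 1ℚ (fromℕℚ-nonNeg n)))) ⟩
      ½ ℚ.* v ℚ.* (m ℚ.+ m)    ≡⟨ ℚ.*-distribˡ-+ (½ ℚ.* v) m m ⟩
      ½ ℚ.* v ℚ.* m ℚ.+ ½ ℚ.* v ℚ.* m ≡⟨ ≡.sym (ℚ.*-distribʳ-+ m (½ ℚ.* v) (½ ℚ.* v)) ⟩
      (½ ℚ.* v ℚ.+ ½ ℚ.* v) ℚ.* m ≡⟨ ≡.cong (ℚ._* m) (½+½ v) ⟩
      v ℚ.* m ∎
      where open ℚ.≤-Reasoning

  fromℕℚ-/ : ∀ n → fromℕℚ n ≡ + n ℚ./ 1
  fromℕℚ-/ zero    = ≡.refl
  fromℕℚ-/ (suc n) = ≡.trans (≡.cong (1ℚ ℚ.+_) (fromℕℚ-/ n)) (≡.sym (ℚ.toℚᵘ-injective step))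
    where
    step : ℚ.toℚᵘ (+ suc n ℚ./ 1) ℚᵘ.≃ ℚ.toℚᵘ (1ℚ ℚ.+ (+ n ℚ./ 1))
    step = ℚᵘ.≃-trans (ℚ.toℚᵘ-fromℚᵘ (+ suc n ℚᵘ./ 1))
      (ℚᵘ.≃-trans (ℚᵘ.*≡* (≡.cong (λ k → (+ 1 ℤ.+ k) ℤ.* + 1) (≡.sym (ℤ.*-identityʳ (+ n)))))
        (ℚᵘ.≃-sym (ℚᵘ.≃-trans (ℚ.toℚᵘ-homo-+ 1ℚ (+ n ℚ./ 1))
          (ℚᵘ.+-congʳ (ℚ.toℚᵘ 1ℚ) (ℚ.toℚᵘ-fromℚᵘ (+ n ℚᵘ./ 1))))))

  archimedean : ∀ q → ∃[ n ] q ℚ.≤ fromℕℚ n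
  archimedean q@record{} = ℤ.∣ ℚ.numerator q ∣ , ≡.subst (q ℚ.≤_) (≡.sym (fromℕℚ-/ ℤ.∣ ℚ.numerator q ∣)) bound
    where
    a = ℚ.numerator q
    d = ℚ.denominator q
    i≤∣i∣ : ∀ i → i ℤ.≤ + ℤ.∣ i ∣
    i≤∣i∣ (+ n)    = ℤ.≤-refl
    i≤∣i∣ -[1+ n ] = ℤ.-≤+
    bound : q ℚ.≤ + ℤ.∣ a ∣ ℚ./ 1
    bound = ℚ.toℚᵘ-cancel-≤ (ℚᵘ.≤-trans {j = (+ ℤ.∣ a ∣) ℚᵘ./ 1} (ℚᵘ.*≤* (begin
        a ℤ.* + 1               ≡⟨ ℤ.*-identityʳ a ⟩
        a                       ≤⟨ i≤∣i∣ a ⟩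
        + ℤ.∣ a ∣               ≤⟨ ℤ.+≤+ (ℕ.m≤m*n ℤ.∣ a ∣ (ℚ.denominatorℕ q)) ⟩
        + (ℤ.∣ a ∣ ℕ.* ℚ.denominatorℕ q) ≡⟨ ℤ.pos-* ℤ.∣ a ∣ _ ⟩
        + ℤ.∣ a ∣ ℤ.* d ∎))
      (ℚᵘ.≤-reflexive (ℚᵘ.≃-sym (ℚ.toℚᵘ-fromℚᵘ (+ ℤ.∣ a ∣ ℚᵘ./ 1)))))
      where open ℤ.≤-Reasoning

  width-small : ∀ {W} → 0ℚ ℚ.≤ W → ∀ ε → 0ℚ ℚ.< ε → ∃[ n ] width W n ℚ.< ε
  width-small {W} 0≤W ε 0<ε = n , ℚ.≰⇒> λ ε≤w → ℚ.<-irrefl ≡.refl (begin-strict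
      ε ℚ.* fromℕℚ n          ≡⟨ ≡.sym (ℚ.+-identityˡ _) ⟩
      0ℚ ℚ.+ ε ℚ.* fromℕℚ n   <⟨ ℚ.+-monoˡ-< (ε ℚ.* fromℕℚ n) 0<ε ⟩
      ε ℚ.+ ε ℚ.* fromℕℚ n    ≡⟨ ≡.cong (ℚ._+ ε ℚ.* fromℕℚ n) (≡.sym (ℚ.*-identityʳ ε)) ⟩
      ε ℚ.* 1ℚ ℚ.+ ε ℚ.* fromℕℚ n ≡⟨ ≡.sym (ℚ.*-distribˡ-+ ε 1ℚ (fromℕℚ n)) ⟩
      ε ℚ.* fromℕℚ (suc n)    ≤⟨ ℚ.*-monoʳ-≤-nonNeg (fromℕℚ (suc n)) {{ℚ.nonNegative (fromℕℚ-nonNeg (suc n))}} ε≤w ⟩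
      width W n ℚ.* fromℕℚ (suc n) ≤⟨ width-bound 0≤W n ⟩
      W                       ≡⟨ ≡.sym εε⁻¹W≡W ⟩
      ε ℚ.* (ℚ.1/ ε ℚ.* W)    ≤⟨ ℚ.*-monoˡ-≤-nonNeg ε {{ℚ.pos⇒nonNeg ε}} W/ε≤n ⟩
      ε ℚ.* fromℕℚ n          ∎)
    where
    open ℚ.≤-Reasoning
    instance
      ε-pos : ℚ.Positive ε
      ε-pos = ℚ.positive 0<ε
      ε-nonZero : ℚ.NonZero ε
      ε-nonZero = ℚ.pos⇒nonZero ε
    n = proj₁ (archimedean (ℚ.1/ ε ℚ.* W))
    W/ε≤n = proj₂ (archimedean (ℚ.1/ ε ℚ.* W))
    εε⁻¹W≡W : ε ℚ.* (ℚ.1/ ε ℚ.* W) ≡ W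
    εε⁻¹W≡W = ≡.trans (≡.sym (ℚ.*-assoc ε (ℚ.1/ ε) W))
      (≡.trans (≡.cong (ℚ._* W) (ℚ.*-inverseʳ ε)) (ℚ.*-identityˡ W))

  Between : ℚ → ℚ → Carrier → Set
  Between a w x = ι a ≤ x × x ≤ ι (a ℚ.+ w)

  Between-halves : ∀ a w {x} → Between a w x →
    Between a (½ ℚ.* w) x ⊎ Between (a ℚ.+ ½ ℚ.* w) (½ ℚ.* w) x
  Between-halves a w {x} (a≤x , x≤a+w) with ≤-total x (ι (a ℚ.+ ½ ℚ.* w))
  ... | inj₁ x≤mid = inj₁ (a≤x , x≤mid)
  ... | inj₂ mid≤x = inj₂ (mid≤x , ≤-respʳ (≈-reflexive (≡.cong ι
    (≡.trans (≡.cong (a ℚ.+_) (≡.sym (½+½ w))) (≡.sym (ℚ.+-assoc a _ _))))) x≤a+w)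

  Box : ℚ → ℚ → ℚ → Cx → Set
  Box a b w z = Between a w (re z) × Between b w (im z)

  -- No single point of S has to be a minimiser: every competitor w may be matched by a different z.
  -- In this form the property passes to one of two halves of S.
  Low : List Cx → (Cx → Set) → Set
  Low p S = ∀ w → ∃[ z ] S z × N (evaluate p z) ≤ N (evaluate p w)

  -- If neither part were low, each would have a competitor lying strictly below all its values. The
  -- lower of the two competitors lies below both parts, so nothing in S matches it.
  Low-split : ∀ p {S A B : Cx → Set} → (∀ z → S z → A z ⊎ B z) → Low p S → Low p A ⊎ Low p B
  Low-split p {S} {A} {B} split low with em {P = Low p A} | em {P = Low p B}
  ... | yes lowA | _        = inj₁ lowA
  ... | no _     | yes lowB = inj₂ lowB
  ... | no ¬lowA | no ¬lowB = contradiction low λ low →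
        let wA , above-A = witness ¬lowA
            wB , above-B = witness ¬lowB
        in both above-A above-B (≤-total (F wA) (F wB))
    where
    F : Cx → Carrier
    F z = N (evaluate p z)
    witness : ∀ {T : Cx → Set} → ¬ Low p T → ∃[ w ] (∀ z → T z → F w < F z)
    witness {T} ¬low with em {P = ∃[ w ] (∀ z → T z → F w < F z)}
    ... | yes w = w
    ... | no ¬w = contradiction (λ w → point w) ¬low
      where
      point : ∀ w → ∃[ z ] T z × F z ≤ F w
      point w with em {P = ∃[ z ] T z × F z ≤ F w}
      ... | yes z = z
      ... | no ¬z = contradiction (w , λ z Tz Fz≤ → ¬z (z , Tz , Fz≤)) ¬w
    both : ∀ {wA wB} → (∀ z → A z → F wA < F z) → (∀ z → B z → F wB < F z) →
      ¬ (F wA ≤ F wB ⊎ F wB ≤ F wA)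
    both {wA} {wB} above-A above-B (inj₁ A≤B) with low wA
    ... | z , Sz , Fz≤ with split z Sz
    ...   | inj₁ Az = above-A z Az Fz≤
    ...   | inj₂ Bz = above-B z Bz (≤-trans Fz≤ A≤B)
    both {wA} {wB} above-A above-B (inj₂ B≤A) with low wB
    ... | z , Sz , Fz≤ with split z Sz
    ...   | inj₁ Az = above-A z Az (≤-trans Fz≤ B≤A)
    ...   | inj₂ Bz = above-B z Bz Fz≤

  record LowSquare (p : List Cx) (w : ℚ) : Set where
    field
      left bottom : ℚ
      low         : Low p (Box left bottom w)
  open LowSquare

  Nested : (a w a′ w′ : ℚ) → Set
  Nested a w a′ w′ = a ℚ.≤ a′ × a′ ℚ.+ w′ ℚ.≤ a ℚ.+ w

  lower-half : ∀ a {w} → 0ℚ ℚ.≤ w → Nested a w a (½ ℚ.* w)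
  lower-half a {w} 0≤w = ℚ.≤-refl , ℚ.+-monoʳ-≤ a (ℚ.≤-trans
    (ℚ.≤-reflexive (≡.sym (ℚ.+-identityʳ _)))
    (ℚ.≤-trans (ℚ.+-monoʳ-≤ (½ ℚ.* w) (0≤½* 0≤w)) (ℚ.≤-reflexive (½+½ w))))

  upper-half : ∀ a {w} → 0ℚ ℚ.≤ w → Nested a w (a ℚ.+ ½ ℚ.* w) (½ ℚ.* w)
  upper-half a {w} 0≤w =
    ℚ.≤-trans (ℚ.≤-reflexive (≡.sym (ℚ.+-identityʳ a))) (ℚ.+-monoʳ-≤ a (0≤½* 0≤w)) ,
    ℚ.≤-reflexive (≡.trans (ℚ.+-assoc a _ _) (≡.cong (a ℚ.+_) (½+½ w)))

  refine : ∀ p {w} → 0ℚ ℚ.≤ w → (s : LowSquare p w) → ∃ λ (s′ : LowSquare p (½ ℚ.* w)) →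
    Nested (left s) w (left s′) (½ ℚ.* w) × Nested (bottom s) w (bottom s′) (½ ℚ.* w)
  refine p {w} 0≤w s = horizontal (Low-split p
      (λ z (x , y) → distribute y (Between-halves (left s) w x)) (low s))
    where
    h = ½ ℚ.* w
    a = left s
    b = bottom s
    Strip : ℚ → Cx → Set
    Strip a′ z = Between a′ h (re z) × Between b w (im z)
    distribute : ∀ {x y} → Between b w y → Between a h x ⊎ Between (a ℚ.+ h) h x →
      Between a h x × Between b w y ⊎ Between (a ℚ.+ h) h x × Between b w y
    distribute y (inj₁ x) = inj₁ (x , y)
    distribute y (inj₂ x) = inj₂ (x , y)
    distribute′ : ∀ {a′ x y} → Between a′ h x → Between b h y ⊎ Between (b ℚ.+ h) h y →
      Between a′ h x × Between b h y ⊎ Between a′ h x × Between (b ℚ.+ h) h y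
    distribute′ x (inj₁ y) = inj₁ (x , y)
    distribute′ x (inj₂ y) = inj₂ (x , y)
    Result = ∃ λ (s′ : LowSquare p h) → Nested a w (left s′) h × Nested b w (bottom s′) h
    vertical : ∀ a′ → Nested a w a′ h → Low p (Box a′ b h) ⊎ Low p (Box a′ (b ℚ.+ h) h) → Result
    vertical a′ na (inj₁ l) = record { left = a′ ; bottom = b ; low = l } , na , lower-half b 0≤w
    vertical a′ na (inj₂ l) = record { left = a′ ; bottom = b ℚ.+ h ; low = l } , na , upper-half b 0≤w
    split : ∀ a′ → Low p (Strip a′) → Low p (Box a′ b h) ⊎ Low p (Box a′ (b ℚ.+ h) h)
    split a′ l = Low-split p (λ z (x , y) → distribute′ x (Between-halves b w y)) l
    horizontal : Low p (Strip a) ⊎ Low p (Strip (a ℚ.+ h)) → Result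
    horizontal (inj₁ l) = vertical a (lower-half a 0≤w) (split a l)
    horizontal (inj₂ l) = vertical (a ℚ.+ h) (upper-half a 0≤w) (split (a ℚ.+ h) l)

  LimitPoint : List Cx → Cx → Set
  LimitPoint p z = ∀ ε → 0ℚ ℚ.< ε →
    ∃[ w ] 0ℚ ℚ.≤ w × w ℚ.< ε × ∃[ a ] ∃[ b ] Box a b w z × Low p (Box a b w)

  limitPoint : ∀ p {W} → 0ℚ ℚ.≤ W → LowSquare p W → ∃[ z ] LimitPoint p z
  limitPoint p {W} 0≤W s₀ = x +i y , λ ε 0<ε →
      let n , w<ε = width-small 0≤W ε 0<ε
      in width W n , width-nonNeg 0≤W n , w<ε , left (square n) , bottom (square n) ,
         (proj₂ nested-x n , proj₂ nested-y n) , low (square n)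
    where
    square : ∀ n → LowSquare p (width W n)
    square zero    = s₀
    square (suc n) = proj₁ (refine p (width-nonNeg 0≤W n) (square n))
    l b : ℕ → ℚ
    l n = left (square n)
    b n = bottom (square n)
    shrinks : ∀ n → Nested (l n) (width W n) (l (suc n)) (width W (suc n)) ×
      Nested (b n) (width W n) (b (suc n)) (width W (suc n))
    shrinks n = proj₂ (refine p (width-nonNeg 0≤W n) (square n))
    nested-x = nested l (width W) (width-nonNeg 0≤W)
      (λ n → proj₁ (proj₁ (shrinks n))) (λ n → proj₂ (proj₁ (shrinks n))) (width-small 0≤W)
    nested-y = nested b (width W) (width-nonNeg 0≤W)
      (λ n → proj₁ (proj₂ (shrinks n))) (λ n → proj₂ (proj₂ (shrinks n))) (width-small 0≤W)
    x = proj₁ nested-x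
    y = proj₁ nested-y

  square-cancel-≤ : ∀ {x r} → 0# ≤ r → x * x ≤ r * r → x ≤ r
  square-cancel-≤ {x} {r} 0≤r xx≤rr = ≮⇒≥ λ r<x → pos-*-pos (0<x-r r<x) (0<x+r r<x)
    (≤-by (difference xx≤rr) (≈-trans
      (solve 2 (λ x r → (x :- r) :* (x :+ r) :+ (r :* r :- x :* x) := con 0ℚ) ≈-refl x r) ι-0))
    where
    0<x-r : r < x → 0# < x - r
    0<x-r r<x x-r≤0 = r<x (≤-by (neg-nonNeg x-r≤0) (solve 2 (λ x r → x :+ :- (x :- r) := r) ≈-refl x r))
    0<x+r : r < x → 0# < x + r
    0<x+r r<x = <-≤-trans (≤-<-trans 0≤r r<x) (≤-by 0≤r ≈-refl)

  -- Where N w ≥ R, the value is at least the one at 0, so 0 matches every competitor outside the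
  -- disc N w ≤ R; inside, w matches itself.
  initialSquare : ∀ {p} → Unbounded p → ∃[ W ] 0ℚ ℚ.≤ W × LowSquare p W
  initialSquare {p} unbounded = ρ ℚ.+ ρ , ℚ.<⇒≤ (ℚ.+-mono-< 0<ρ 0<ρ) ,
    record { left = ℚ.- ρ ; bottom = ℚ.- ρ ; low = low₀ }
    where
    K = N (evaluate p 𝟘)
    R = proj₁ (unbounded K (N-nonNeg _))
    K≤ : ∀ w → R ≤ N w → K ≤ N (evaluate p w)
    K≤ = proj₂ (proj₂ (unbounded K (N-nonNeg _)))
    q = proj₁ (ι-above R)
    -- Being at least 1 and at least R, it satisfies ρ² ≥ R, so the square contains the disc.
    ρ = (q ℚ.⊔ 0ℚ) ℚ.+ 1ℚ
    1≤ρ : 1ℚ ℚ.≤ ρ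
    1≤ρ = ℚ.≤-trans (ℚ.≤-reflexive (≡.sym (ℚ.+-identityˡ 1ℚ))) (ℚ.+-monoˡ-≤ 1ℚ (ℚ.p≤q⊔p q 0ℚ))
    0<ρ : 0ℚ ℚ.< ρ
    0<ρ = ℚ.<-≤-trans (ℚ.positive⁻¹ 1ℚ) 1≤ρ
    0≤ιρ : 0# ≤ ι ρ
    0≤ιρ = ι-nonNeg (ℚ.<⇒≤ 0<ρ)
    q≤ρ : q ℚ.≤ ρ
    q≤ρ = ℚ.≤-trans (ℚ.p≤p⊔q q 0ℚ) (ℚ.≤-trans (ℚ.≤-reflexive (≡.sym (ℚ.+-identityʳ _)))
      (ℚ.+-monoʳ-≤ (q ℚ.⊔ 0ℚ) (ℚ.<⇒≤ (ℚ.positive⁻¹ 1ℚ))))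
    R≤ρρ : R ≤ ι ρ * ι ρ
    R≤ρρ = ≤-trans (proj₂ (ι-above R)) (≤-trans (ι-mono-≤ q≤ρ)
      (≤-respˡ (*-identityʳ _) (*-monoˡ-≤ 0≤ιρ (≤-respˡ ι-1 (ι-mono-≤ 1≤ρ)))))
    between : ∀ {x} → x * x ≤ R → Between (ℚ.- ρ) (ρ ℚ.+ ρ) x
    between {x} xx≤R =
      ≤-respˡ (≈-sym (ι-neg ρ)) (≤-respʳ (-‿involutive x) (neg-mono-≤ (square-cancel-≤ 0≤ιρ
        (≤-respˡ (solve 1 (λ x → x :* x := :- x :* :- x) ≈-refl x) (≤-trans xx≤R R≤ρρ))))) ,
      ≤-respʳ (≈-reflexive (≡.cong ι (≡.sym (≡.trans (≡.sym (ℚ.+-assoc (ℚ.- ρ) ρ ρ))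
        (≡.trans (≡.cong (ℚ._+ ρ) (ℚ.+-inverseˡ ρ)) (ℚ.+-identityˡ ρ))))))
        (square-cancel-≤ 0≤ιρ (≤-trans xx≤R R≤ρρ))
    near : ∀ z → N z ≤ R → Box (ℚ.- ρ) (ℚ.- ρ) (ρ ℚ.+ ρ) z
    near z Nz≤R = between (≤-trans (re²≤N z) Nz≤R) , between (≤-trans (im²≤N z) Nz≤R)
    low₀ : Low p (Box (ℚ.- ρ) (ℚ.- ρ) (ρ ℚ.+ ρ))
    low₀ w with ≤-total (N w) R
    ... | inj₁ Nw≤R = w , near w Nw≤R , ≤-refl
    ... | inj₂ R≤Nw = 𝟘 , near 𝟘 (≤-respˡ (≈-sym N-𝟘) (proj₁ (proj₂ (unbounded K (N-nonNeg _))))) , K≤ w R≤Nw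

  Between-close : ∀ {a w x y} → Between a w x → Between a w y → (x - y) * (x - y) ≤ ι w * ι w
  Between-close {a} {w} {x} {y} x∈ y∈ with ≤-total 0# (x - y)
  ... | inj₁ 0≤x-y = *-mono-≤ 0≤x-y (≤-trans 0≤x-y gap) gap gap
    where
    gap : x - y ≤ ι w
    gap = ≤-by (+-nonNeg (difference (proj₂ x∈)) (difference (proj₁ y∈)))
      (≈-trans (+-congˡ (+-congʳ (+-congʳ (ι-+ a w))))
        (solve 4 (λ x y a w → (x :- y) :+ ((a :+ w :- x) :+ (y :- a)) := w) ≈-refl x y (ι a) (ι w)))
  ... | inj₂ x-y≤0 = ≤-respˡ (solve 2 (λ x y → (y :- x) :* (y :- x) := (x :- y) :* (x :- y)) ≈-refl x y)
      (*-mono-≤ 0≤y-x (≤-trans 0≤y-x gap) gap gap)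
    where
    0≤y-x : 0# ≤ y - x
    0≤y-x = ≤-respʳ (solve 2 (λ x y → :- (x :- y) := y :- x) ≈-refl x y) (neg-nonNeg x-y≤0)
    gap : y - x ≤ ι w
    gap = ≤-by (+-nonNeg (difference (proj₂ y∈)) (difference (proj₁ x∈)))
      (≈-trans (+-congˡ (+-congʳ (+-congʳ (ι-+ a w))))
        (solve 4 (λ x y a w → (y :- x) :+ ((a :+ w :- y) :+ (x :- a)) := w) ≈-refl x y (ι a) (ι w)))

-- Attained minima are roots; directions of descent.

module Roots (𝓡 : RealNumbers) (em : ExcludedMiddle 0ℓ) where

  open Minimum 𝓡 em public
  open Solver

  0<1 : 0# < 1#
  0<1 = <-≤-trans (ι-pos (ℚ.positive⁻¹ 1ℚ)) (≤-reflexive ι-1)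

  -- The square N (e + θ a) ≥ 0 bounds the cross term in N (e + a).
  N-perturb : ∀ e a θ → θ * N a - θ * N (e ⊕ a) ≤ N e + θ * (θ * N a) - θ * N e
  N-perturb e a θ = ≤-by (N-nonNeg (e ⊕ real θ ⊗ a)) (≈-trans
    (+-cong (+-congˡ (-‿cong (*-congˡ (N-expand e a))))
      (≈-trans (N-expand e (real θ ⊗ a)) (+-cong (+-congˡ (*-congˡ (⟨⟩-real θ e a))) (N-real-⊗ θ a))))
    (solve 4 (λ θ a e p →
      θ :* a :- θ :* (e :+ con 2ℚ :* p :+ a) :+ (e :+ con 2ℚ :* (θ :* p) :+ θ :* θ :* a)
        := e :+ θ :* (θ :* a) :- θ :* e) ≈-refl θ (N a) (N e) ⟨ e , a ⟩))

  value-at-centre : ∀ {p z a r} → (∀ h → evaluate (a ∷ r) h ≋ evaluate p (z ⊕ h)) → evaluate p z ≋ a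
  value-at-centre {p} {z} {a} {r} eq = ≋-trans
    (evaluate-cong p (≋-sym (ℂ.+-identityʳ z)))
    (≋-trans (≋-sym (eq 𝟘)) (≋-trans (⊕-cong ≋-refl (ℂ.zeroˡ _)) (ℂ.+-identityʳ a)))

  opaque
    unfolding _⊕_
    re-⊖ : ∀ z w → re (z ⊖ w) ≈ re z - re w
    re-⊖ z w = ≈-refl
    im-⊖ : ∀ z w → im (z ⊖ w) ≈ im z - im w
    im-⊖ z w = ≈-refl

  -- The squared distance is at most 2 v², and v ≤ 1 replaces v² by v.
  Box-diameter : ∀ {a b v t z z′} → 0ℚ ℚ.≤ v → ι v + ι v ≤ t → t ≤ 1# →
    Box a b v z → Box a b v z′ → N (z′ ⊖ z) ≤ t
  Box-diameter {a} {b} {v} {t} {z} {z′} 0≤v 2v≤t t≤1 (x∈ , y∈) (x′∈ , y′∈) =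
    ≤-trans (N-bound
      (≤-respˡ (≈-sym (*-cong (re-⊖ z′ z) (re-⊖ z′ z))) (≤-trans (Between-close {a} {v} x′∈ x∈) v²≤v))
      (≤-respˡ (≈-sym (*-cong (im-⊖ z′ z) (im-⊖ z′ z))) (≤-trans (Between-close {b} {v} y′∈ y∈) v²≤v))) 2v≤t
    where
    0≤ιv = ι-nonNeg 0≤v
    v²≤v : ι v * ι v ≤ ι v
    v²≤v = ≤-respʳ (*-identityʳ (ι v)) (*-monoˡ-≤ 0≤ιv
      (≤-trans (≤-trans (≤-by 0≤ιv ≈-refl) 2v≤t) t≤1))

  -- With D = N a - G, `N-perturb` yields θ D ≤ N e + θ² N a. Four times the right side is at most θ
  -- D + 2 θ D, hence 4 θ D ≤ 3 θ D.
  small-perturbation : ∀ e a {G θ t K} → 0# ≤ θ → θ * (ι 2ℚ * N a) ≤ N a - G →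
    t * (ι 2ℚ * (ι 2ℚ * K)) ≤ θ * (N a - G) → N e ≤ t * K → N (e ⊕ a) ≤ G →
    θ * (N a - G) ≤ 0#
  small-perturbation e a {G} {θ} {t} {K} 0≤θ 2θF≤D 4Kt≤θD Ne≤ Np≤G =
    ≤-by (difference 4θD≤3θD) (≈-trans (solve 1 (λ x →
      x :+ (x :+ con 2ℚ :* x :- con 2ℚ :* (con 2ℚ :* x)) := con 0ℚ) ≈-refl (θ * D)) ι-0)
    where
    F = N a
    D = F - G
    θD≤ : θ * D ≤ N e + θ * (θ * F)
    θD≤ = ≤-trans (≤-by (*-nonNeg 0≤θ (difference Np≤G))
        (solve 4 (λ θ f g n → θ :* (f :- g) :+ θ :* (g :- n) := θ :* f :- θ :* n)
          ≈-refl θ F G (N (e ⊕ a))))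
      (≤-trans (N-perturb e a θ) (≤-by (*-nonNeg 0≤θ (N-nonNeg e))
        (solve 2 (λ x y → x :- y :+ y := x) ≈-refl (N e + θ * (θ * F)) (θ * N e))))
    4θD≤3θD : ι 2ℚ * (ι 2ℚ * (θ * D)) ≤ θ * D + ι 2ℚ * (θ * D)
    4θD≤3θD = ≤-trans (*-monoˡ-≤ 0≤2 (*-monoˡ-≤ 0≤2 θD≤))
      (≤-trans (≤-by (*-nonNeg 0≤2 (*-nonNeg 0≤2 (difference Ne≤)))
        (solve 5 (λ θ f n t k →
          con 2ℚ :* (con 2ℚ :* (n :+ θ :* (θ :* f))) :+ con 2ℚ :* (con 2ℚ :* (t :* k :- n))
            := t :* (con 2ℚ :* (con 2ℚ :* k)) :+ con 2ℚ :* (θ :* (θ :* (con 2ℚ :* f))))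
          ≈-refl θ F (N e) t K))
        (+-mono-≤ 4Kt≤θD (*-monoˡ-≤ 0≤2 (*-monoˡ-≤ 0≤θ 2θF≤D))))

  -- Values at points close to z are almost as large as the value at z,
  -- while arbitrarily small squares around z contain values below N (p w).
  limit-is-minimum : ∀ p {z} → LimitPoint p z → ∀ w → N (evaluate p z) ≤ N (evaluate p w)
  limit-is-minimum p {z} limit w = go (shift z p) (evaluate-shift z p)
    where
    G = N (evaluate p w)
    go : ∀ s → (∀ h → evaluate s h ≋ evaluate p (z ⊕ h)) → N (evaluate p z) ≤ G
    go [] eq = ≤-respˡ (≈-trans (≈-sym N-𝟘) (N-cong (≋-trans (eq 𝟘) (evaluate-cong p (ℂ.+-identityʳ z)))))
      (N-nonNeg _)
    go (a ∷ r) eq = ≤-respˡ (N-cong (≋-sym (value-at-centre {p} {z} {a} {r} eq))) (≮⇒≥ absurd)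
      where
      F = N a
      near : ∀ {K} → 0# ≤ K → (∀ h → N h ≤ 1# → N (evaluate r h) ≤ K) →
        ∀ {θ} → 0# ≤ θ → θ * (ι 2ℚ * F) ≤ F - G →
        ∀ {t} → t ℚ.≤ 1ℚ → ι t * (ι 2ℚ * (ι 2ℚ * K)) ≤ θ * (F - G) →
        ∀ {v a b} → 0ℚ ℚ.≤ v → v ℚ.< ½ ℚ.* t → Box a b v z →
        ∃[ z′ ] Box a b v z′ × N (evaluate p z′) ≤ G → θ * (F - G) ≤ 0#
      near {K} 0≤K r≤K {θ} 0≤θ 2θF≤D {t} t≤1 4Kt≤θD {v} 0≤v v<½t z∈ (z′ , z′∈ , pz′≤G) =
        small-perturbation (h ⊗ evaluate r h) a 0≤θ 2θF≤D 4Kt≤θD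
          (≤-respˡ (≈-sym (N-⊗ h _)) (*-mono-≤ (N-nonNeg h) 0≤K Nh≤t (r≤K h (≤-trans Nh≤t ιt≤1))))
          (≤-respˡ (N-cong (≋-trans (evaluate-cong p (solveᶜ 2 (λ z′ z →
              z′ :≋ z :⊕ (z′ :⊕ :⊝ z)) ≋-refl z′ z))
            (≋-trans (≋-sym (eq h)) (⊕-comm a (h ⊗ evaluate r h))))) pz′≤G)
        where
        h = z′ ⊖ z
        ιt≤1 : ι t ≤ 1#
        ιt≤1 = ≤-respʳ ι-1 (ι-mono-≤ t≤1)
        Nh≤t : N h ≤ ι t
        Nh≤t = Box-diameter 0≤v (≤-respˡ (ι-+ v v) (ι-mono-≤ (ℚ.≤-trans
          (ℚ.<⇒≤ (ℚ.+-mono-< v<½t v<½t)) (ℚ.≤-reflexive (½+½ t))))) ιt≤1 z∈ z′∈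
      absurd : ¬ (G < F)
      absurd G<F =
        let K , 0≤K , r≤K = bounded r
            -- The order of choices matters: θ is small relative to D and F, then t relative to θ D
            -- and K, and last the square relative to t.
            θ , 0<θ , _ , 2θF≤D = shrink (ι 2ℚ * F) 0<D
            0<θD = pos-*-pos (ι-pos 0<θ) 0<D
            t , 0<t , t≤1 , 4Kt≤θD = shrink (ι 2ℚ * (ι 2ℚ * K)) 0<θD
            _ , 0≤v , v<½t , _ , _ , z∈ , low =
              limit (½ ℚ.* t) (ℚ.positive⁻¹ (½ ℚ.* t) {{ℚ.pos*pos⇒pos ½ t {{ℚ.positive 0<t}}}})
        in 0<θD (near 0≤K r≤K (ι-nonNeg (ℚ.<⇒≤ 0<θ)) 2θF≤D t≤1 4Kt≤θD 0≤v v<½t z∈ (low w))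
        where
        0<D : 0# < F - G
        0<D D≤0 = G<F (≤-by (neg-nonNeg D≤0) (solve 2 (λ f g → f :+ :- (f :- g) := g) ≈-refl F G))

  minimum : ∀ {p} → Unbounded p → ∃[ z ] (∀ w → N (evaluate p z) ≤ N (evaluate p w))
  minimum {p} unbounded =
    let W , 0≤W , s = initialSquare {p} unbounded
        z , limit = limitPoint p 0≤W s
    in z , limit-is-minimum p limit

  unbounded⇒nonconstant : ∀ {p} → Unbounded p → ∀ a → ¬ (∀ z → evaluate p z ≋ a)
  unbounded⇒nonconstant unbounded a p≋a =
    let R , 0≤R , grows = unbounded (N a + 1#) (+-nonNeg (N-nonNeg a) 0≤1)
        w = real (R + 1#)
        R≤Nw : R ≤ N w
        R≤Nw = ≤-respʳ (≈-sym (N-real (R + 1#))) (≤-trans (≤-by 0≤1 ≈-refl)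
          (≤-respˡ (*-identityʳ _) (*-monoˡ-≤ (+-nonNeg 0≤R 0≤1) (≤-by 0≤R (+-comm 1# R)))))
    in 0<1 (≤-by (difference (≤-respʳ (N-cong (p≋a w)) (grows w R≤Nw)))
         (≈-trans (solve 2 (λ o n → o :+ (n :- (n :+ o)) := con 0ℚ) ≈-refl 1# (N a)) ι-0))

  -- If the value c at z were nonzero, `decrease` applied to the Taylor expansion at z would find a
  -- smaller value. The nonconstant part of the expansion cannot vanish, because the polynomial is
  -- unbounded.
  minimum⇒root : ∀ m → (∀ j → j ℕ.< m → Descends (suc j)) →
    ∀ {a p} → length p ℕ.≤ m → Unbounded (a ∷ p) →
    ∀ {z} → (∀ w → N (evaluate (a ∷ p) z) ≤ N (evaluate (a ∷ p) w)) → evaluate (a ∷ p) z ≋ 𝟘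
  minimum⇒root m descends {a} {p} p≤m unbounded {z} least with em {P = evaluate (a ∷ p) z ≋ 𝟘}
  ... | yes pz≋0 = pz≋0
  ... | no  pz≉0 = contradiction (evaluate-shift z (a ∷ p)) (go (shift z (a ∷ p)) (length-shift z (a ∷ p)))
    where
    go : ∀ s → length s ≡ suc (length p) → ¬ (∀ h → evaluate s h ≋ evaluate (a ∷ p) (z ⊕ h))
    go (c ∷ r) len eq =
      let h , less = decrease m descends (λ c≋0 → pz≉0 (≋-trans pz≋c c≋0)) 0 r
            (≡.subst (ℕ._≤ m) (≡.sym (ℕ.suc-injective len)) p≤m) r≉0
      in less (≤-respˡ (N-cong pz≋c) (≤-respʳ (N-cong (value h)) (least (z ⊕ h))))
      where
      pz≋c : evaluate (a ∷ p) z ≋ c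
      pz≋c = value-at-centre {a ∷ p} {z} {c} {r} eq
      value : ∀ h → evaluate (a ∷ p) (z ⊕ h) ≋ c ⊕ h ^ 1 ⊗ evaluate r h
      value h = ≋-trans (≋-sym (eq h)) (⊕-cong ≋-refl (⊗-cong (≋-sym (ℂ.*-identityʳ h)) ≋-refl))
      r≉0 : ¬ Zero r
      r≉0 r≋0 = unbounded⇒nonconstant {a ∷ p} unbounded c λ w → ≋-trans
        (evaluate-cong (a ∷ p) (solveᶜ 2 (λ w z →
          w :≋ z :⊕ (w :⊕ :⊝ z)) ≋-refl w z))
        (≋-trans (≋-sym (eq (w ⊖ z))) (≋-trans (⊕-cong ≋-refl
          (≋-trans (⊗-cong ≋-refl (evaluate-Zero {r} r≋0 _)) (ℂ.zeroʳ _))) (ℂ.+-identityʳ c)))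

  -- Stated relative to the directions at hand, because it is used twice: with exponents 1 and 2 to
  -- obtain square roots, and then, once these supply all directions, in general.
  root : ∀ m → (∀ j → j ℕ.< m → Descends (suc j)) →
    ∀ a p → length p ℕ.≤ m → ¬ Zero p → ∃[ z ] evaluate (a ∷ p) z ≋ 𝟘
  root m descends a p p≤m p≉0 with Zero⊎BoundedBelow p
  ... | inj₁ p≋0   = contradiction p≋0 p≉0
  ... | inj₂ below =
    let z , least = minimum {a ∷ p} (Unbounded-∷ a {p} below)
    in z , minimum⇒root m descends {a} {p} p≤m (Unbounded-∷ a {p} below) least

  ⊝-square : ∀ u → ⊝ u ⊗ ⊝ u ≋ u ⊗ u
  ⊝-square u = solveᶜ 1 (λ u → :⊝ u :⊗ :⊝ u :≋ u :⊗ u) ≋-refl u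

  𝟙^ : ∀ k → 𝟙 ^ k ≋ 𝟙
  𝟙^ zero    = ≋-refl
  𝟙^ (suc k) = ≋-trans (⊗-identityˡ _) (𝟙^ k)

  -𝟙^ : ∀ k → (⊝ 𝟙) ^ k ≋ 𝟙 ⊎ (⊝ 𝟙) ^ k ≋ ⊝ 𝟙
  -𝟙^ zero = inj₁ ≋-refl
  -𝟙^ (suc k) with -𝟙^ k
  ... | inj₁ eq = inj₂ (≋-trans (⊗-cong ≋-refl eq) (ℂ.*-identityʳ _))
  ... | inj₂ eq = inj₁ (≋-trans (⊗-cong ≋-refl eq) (≋-trans (⊝-square 𝟙) (⊗-identityˡ 𝟙)))

  square-^ : ∀ u {v} j → u ⊗ u ≋ v → u ^ (2 ℕ.* j) ≋ v ^ j
  square-^ u j uu≋v = ≋-trans (≋-sym (^-assocʳ u 2 j))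
    (^-congˡ j (≋-trans (⊗-cong ≋-refl (ℂ.*-identityʳ u)) uu≋v))

  descends-if : ∀ {a b c} k {u} → u ^ k ≋ c → ⟨ a , b ⊗ c ⟩ < 0# → ∃[ u ] ⟨ a , b ⊗ u ^ k ⟩ < 0#
  descends-if {a} k {u} eq neg = u , λ 0≤ → neg (≤-respʳ (⟨⟩-cong a (⊗-cong ≋-refl eq)) 0≤)

  ⟨⟩-⊝-neg : ∀ {a b c} → 0# < ⟨ a , b ⊗ c ⟩ → ⟨ a , b ⊗ ⊝ c ⟩ < 0#
  ⟨⟩-⊝-neg {a} {b} {c} 0<x 0≤ = 0<x (≤-respˡ (-‿involutive _) (≤-respʳ -0#≈0# (neg-mono-≤ (≤-respʳ negated 0≤))))
    where
    negated : ⟨ a , b ⊗ ⊝ c ⟩ ≈ - ⟨ a , b ⊗ c ⟩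
    negated = ≈-trans (⟨⟩-cong a (solveᶜ 2 (λ b c →
      b :⊗ :⊝ c :≋ :⊝ (b :⊗ c)) ≋-refl b c)) (⟨⟩-⊝ a (b ⊗ c))

  -- The powers of u = ±1, ±i, 1 ± i point, between them, into both
  -- half-planes bounded by any given line.
  descends-if-± : ∀ {a b c} k {u v} → u ^ k ≋ c → v ^ k ≋ ⊝ c → ¬ (⟨ a , b ⊗ c ⟩ ≈ 0#) →
    ∃[ u ] ⟨ a , b ⊗ u ^ k ⟩ < 0#
  descends-if-± {a} {b} {c} k u^k v^k ≉0 with sign ⟨ a , b ⊗ c ⟩
  ... | inj₁ neg        = descends-if k u^k neg
  ... | inj₂ (inj₁ ≈0)  = contradiction ≈0 ≉0
  ... | inj₂ (inj₂ pos) = descends-if k v^k (⟨⟩-⊝-neg pos)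

  not-both-orthogonal : ∀ {a b} → ¬ (a ≋ 𝟘) → ¬ (b ≋ 𝟘) →
    ⟨ a , b ⊗ 𝟙 ⟩ ≈ 0# → ¬ (⟨ a , b ⊗ 𝕚 ⟩ ≈ 0#)
  not-both-orthogonal {a} {b} a≉0 b≉0 ⟨a,b⟩≈0 ⟨a,b𝕚⟩≈0 =
    pos-*-pos (N-pos a≉0) (N-pos b≉0) (≤-reflexive
      (≈-trans (≈-sym (⟨⟩-𝕚-square a b)) (≈-trans (+-cong
        (≈-trans (*-congʳ (≈-trans (⟨⟩-cong a (≋-sym (ℂ.*-identityʳ b))) ⟨a,b⟩≈0)) (zeroˡ _))
        (≈-trans (*-congʳ ⟨a,b𝕚⟩≈0) (zeroˡ _))) (+-identityʳ 0#))))

  -𝕚²≋-1 : ⊝ 𝕚 ⊗ ⊝ 𝕚 ≋ ⊝ 𝟙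
  -𝕚²≋-1 = ≋-trans (⊝-square 𝕚) 𝕚²≋-1

  odd-^ : ∀ u {v c} j → u ⊗ u ≋ v → v ^ j ≋ c → u ^ suc (2 ℕ.* j) ≋ u ⊗ c
  odd-^ u j uu≋v v^j≋c = ⊗-cong ≋-refl (≋-trans (square-^ u j uu≋v) v^j≋c)

  ⊗-⊝𝟙 : ∀ u → u ⊗ ⊝ 𝟙 ≋ ⊝ u
  ⊗-⊝𝟙 u = ≋-trans (solveᶜ 2 (λ u o → u :⊗ :⊝ o :≋ :⊝ (o :⊗ u)) ≋-refl u 𝟙) (⊝-cong (⊗-identityˡ u))

  descends-odd : ∀ j → Descends (suc (2 ℕ.* j))
  descends-odd j {a} {b} a≉0 b≉0 with em {P = ⟨ a , b ⊗ 𝟙 ⟩ ≈ 0#}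
  ... | no  ≉0 = descends-if-± (suc (2 ℕ.* j)) {𝟙} {⊝ 𝟙}
          (≋-trans (odd-^ 𝟙 j (⊗-identityˡ 𝟙) (𝟙^ j)) (⊗-identityˡ 𝟙))
          (≋-trans (odd-^ (⊝ 𝟙) j (≋-trans (⊝-square 𝟙) (⊗-identityˡ 𝟙)) (𝟙^ j)) (ℂ.*-identityʳ (⊝ 𝟙))) ≉0
  -- Since i^(2j+1) = (-1)^j i, the sign of (-1)^j decides which of i and -i has power i.
  ... | yes ≈0 with -𝟙^ j
  ...   | inj₁ even = descends-if-± (suc (2 ℕ.* j)) {𝕚} {⊝ 𝕚}
            (≋-trans (odd-^ 𝕚 j 𝕚²≋-1 even) (ℂ.*-identityʳ 𝕚))
            (≋-trans (odd-^ (⊝ 𝕚) j -𝕚²≋-1 even) (ℂ.*-identityʳ (⊝ 𝕚)))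
            (not-both-orthogonal a≉0 b≉0 ≈0)
  ...   | inj₂ odd = descends-if-± (suc (2 ℕ.* j)) {⊝ 𝕚} {𝕚}
            (≋-trans (odd-^ (⊝ 𝕚) j -𝕚²≋-1 odd)
              (≋-trans (⊗-⊝𝟙 (⊝ 𝕚)) (solveᶜ 1 (λ u → :⊝ (:⊝ u) :≋ u) ≋-refl 𝕚)))
            (≋-trans (odd-^ 𝕚 j 𝕚²≋-1 odd) (⊗-⊝𝟙 𝕚))
            (not-both-orthogonal a≉0 b≉0 ≈0)

-- The fundamental theorem of algebra, factorisation and power sums of roots.

module Factorisation (𝓡 : RealNumbers) (em : ExcludedMiddle 0ℓ) where

  open Roots 𝓡 em public
  open Solver

  𝟙≉𝟘 : ¬ (𝟙 ≋ 𝟘)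
  𝟙≉𝟘 𝟙≋𝟘 = 0<1 (≤-reflexive (≈-trans (≈-sym N-𝟙) (≈-trans (N-cong 𝟙≋𝟘) N-𝟘)))

  -- The squares of 1 and i are 1 and -1, those of 1 + i and 1 - i are 2i and -2i. As a is not
  -- orthogonal to both b and b i, one of the four serves.
  descends-2 : Descends 2
  descends-2 {a} {b} a≉0 b≉0 with em {P = ⟨ a , b ⊗ 𝟙 ⟩ ≈ 0#}
  ... | no  ≉0 = descends-if-± 2 (𝟙^ 2)
          (≋-trans (⊗-cong ≋-refl (ℂ.*-identityʳ 𝕚)) 𝕚²≋-1) ≉0
  ... | yes ≈0 = descends-if-± {a} {b} {two ⊗ 𝕚} 2 {𝟙 ⊕ 𝕚} {𝟙 ⊖ 𝕚}
          (≋-trans (⊗-cong ≋-refl (ℂ.*-identityʳ _)) (square 𝕚 𝕚²≋-1))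
          (≋-trans (⊗-cong ≋-refl (ℂ.*-identityʳ _)) (≋-trans (square (⊝ 𝕚) -𝕚²≋-1)
            (solveᶜ 1 (λ u → conᶜ 2ℚ :⊗ :⊝ u :≋ :⊝ (conᶜ 2ℚ :⊗ u)) ≋-refl 𝕚)))
          λ ⟨a,2b𝕚⟩≈0 → not-both-orthogonal a≉0 b≉0 ≈0 (2x≈0⇒x≈0 (≈-trans
            (≈-trans (≈-sym (⟨⟩-real (ι 2ℚ) a (b ⊗ 𝕚)))
              (⟨⟩-cong a (solveᶜ 2 (λ b i → conᶜ 2ℚ :⊗ (b :⊗ i) :≋ b :⊗ (conᶜ 2ℚ :⊗ i))
                ≋-refl b 𝕚))) ⟨a,2b𝕚⟩≈0))
    where
    two = real (ι 2ℚ)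
    2x≈0⇒x≈0 : ∀ {x} → ι 2ℚ * x ≈ 0# → x ≈ 0#
    2x≈0⇒x≈0 {x} 2x≈0 = ≤-antisym (half (≤-reflexive (≈-trans 2x≈0 (≈-sym (zeroʳ _)))))
                                  (half (≤-reflexive (≈-trans (zeroʳ _) (≈-sym 2x≈0))))
      where
      half : ∀ {x y} → ι 2ℚ * x ≤ ι 2ℚ * y → x ≤ y
      half = *-cancelˡ-≤ (ι-pos (ℚ.positive⁻¹ 2ℚ))
    square : ∀ i → i ⊗ i ≋ ⊝ 𝟙 → (𝟙 ⊕ i) ⊗ (𝟙 ⊕ i) ≋ two ⊗ i
    square i ii≋-1 = ≋-trans (solveᶜ 2 (λ o i → (o :⊕ i) :⊗ (o :⊕ i) :≋ o :⊗ o :⊕ conᶜ 2ℚ :⊗ (o :⊗ i) :⊕ i :⊗ i)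
        ≋-refl 𝟙 i)
      (≋-trans (⊕-cong (⊕-cong (⊗-identityˡ 𝟙) (⊗-cong ≋-refl (⊗-identityˡ i))) ii≋-1)
        (solveᶜ 2 (λ o i → o :⊕ conᶜ 2ℚ :⊗ i :⊕ :⊝ o :≋ conᶜ 2ℚ :⊗ i) ≋-refl 𝟙 i))

  -- A root of z² - w; its Taylor expansions involve only the exponents 1 and 2, for which
  -- directions are explicit.
  squareRoot : ∀ w → ∃[ z ] z ⊗ z ≋ w
  squareRoot w =
    let z , z²-w≋0 = root 2 directions (⊝ w) (𝟘 ∷ 𝟙 ∷ []) ℕ.≤-refl
          (λ { (_ ∷ 𝟙≋𝟘 ∷ []) → 𝟙≉𝟘 𝟙≋𝟘 })
    in z , ≋-trans (solveᶜ 2 (λ z w → z :⊗ z :≋ w :⊕ (:⊝ w :⊕ z :⊗ z)) ≋-refl z w)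
         (≋-trans (⊕-cong ≋-refl (≋-trans (⊕-cong ≋-refl (⊗-cong ≋-refl (expand z))) z²-w≋0)) (ℂ.+-identityʳ w))
    where
    expand : ∀ z → z ≋ 𝟘 ⊕ z ⊗ (𝟙 ⊕ z ⊗ 𝟘)
    expand z = ≋-sym (≋-trans (⊕-identityˡ _) (≋-trans (⊗-cong ≋-refl
      (≋-trans (⊕-cong ≋-refl (ℂ.zeroʳ z)) (ℂ.+-identityʳ 𝟙))) (ℂ.*-identityʳ z)))
    directions : ∀ j → j ℕ.< 2 → Descends (suc j)
    directions zero          _ = descends-odd 0
    directions (suc zero)    _ = descends-2
    directions (suc (suc j)) (ℕ.s≤s (ℕ.s≤s ()))

  parity : ∀ k → ∃[ j ] (k ≡ 2 ℕ.* j ⊎ k ≡ suc (2 ℕ.* j))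
  parity zero = 0 , inj₁ ≡.refl
  parity (suc k) with parity k
  ... | j , inj₁ ≡.refl = j , inj₂ ≡.refl
  ... | j , inj₂ ≡.refl = suc j , inj₁ (≡.cong suc (≡.sym (ℕ.+-suc j (j ℕ.+ 0))))

  -- An even exponent is halved by replacing u with its square root.
  descends : ∀ k → 1 ℕ.≤ k → Descends k
  descends = <-rec _ step
    where
    step : ∀ k → (∀ {j} → j ℕ.< k → 1 ℕ.≤ j → Descends j) → 1 ℕ.≤ k → Descends k
    step k rec 1≤k a≉0 b≉0 with parity k
    step k rec 1≤k a≉0 b≉0 | j , inj₂ ≡.refl = descends-odd j a≉0 b≉0
    step k rec ()  a≉0 b≉0 | zero , inj₁ ≡.refl
    step k rec 1≤k a≉0 b≉0 | suc j , inj₁ ≡.refl =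
      let u , neg = rec (ℕ.m<m+n (suc j) (ℕ.s≤s ℕ.z≤n)) (ℕ.s≤s ℕ.z≤n) a≉0 b≉0
          v , vv≋u = squareRoot u
      in descends-if (2 ℕ.* suc j) (square-^ v (suc j) vv≋u) neg

  fundamentalTheorem : ∀ a p → ¬ Zero p → ∃[ z ] evaluate (a ∷ p) z ≋ 𝟘
  fundamentalTheorem a p = root (length p) (λ j _ → descends (suc j) (ℕ.s≤s ℕ.z≤n)) a p ℕ.≤-refl

  -- Monic polynomials, given by their non-leading coefficients, highest first.
  horner : ∀ {n} → Cx → Vec Cx n → Cx → Cx
  horner c []      x = c
  horner c (a ∷ p) x = horner (c ⊗ x ⊕ a) p x

  horner-cong : ∀ {n c c′} → c ≋ c′ → (p : Vec Cx n) → ∀ x → horner c p x ≋ horner c′ p x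
  horner-cong c≋c′ []      x = c≋c′
  horner-cong c≋c′ (a ∷ p) x = horner-cong (⊕-cong (⊗-cong c≋c′ ≋-refl) ≋-refl) p x

  ascending : ∀ {n} → List Cx → Vec Cx n → List Cx
  ascending q []      = q
  ascending q (a ∷ p) = ascending (a ∷ q) p

  evaluate-ascending : ∀ {n} q (p : Vec Cx n) x → evaluate (ascending q p) x ≋ horner (evaluate q x) p x
  evaluate-ascending q []      x = ≋-refl
  evaluate-ascending q (a ∷ p) x = ≋-trans (evaluate-ascending (a ∷ q) p x)
    (horner-cong (≋-trans (⊕-comm _ _) (⊕-cong (⊗-comm _ _) ≋-refl)) p x)

  monic : ∀ {n} → Vec Cx n → Cx → Cx
  monic = horner 𝟙

  monic-root : ∀ {n} (p : Vec Cx (suc n)) → ∃[ z ] monic p z ≋ 𝟘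
  monic-root (a ∷ p) =
    let z , pz≋0 = ascending-root p a (𝟙 ∷ []) λ { (𝟙≋𝟘 ∷ []) → 𝟙≉𝟘 𝟙≋𝟘 }
    in z , ≋-trans (≋-sym (≋-trans (evaluate-ascending (a ∷ 𝟙 ∷ []) p z) (horner-cong (start z) p z))) pz≋0
    where
    start : ∀ z → evaluate (a ∷ 𝟙 ∷ []) z ≋ 𝟙 ⊗ z ⊕ a
    start z = ≋-trans (⊕-comm _ _) (⊕-cong (≋-trans (⊗-comm _ _)
      (⊗-cong (≋-trans (⊕-cong ≋-refl (ℂ.zeroʳ z)) (ℂ.+-identityʳ 𝟙)) ≋-refl)) ≋-refl)
    ascending-root : ∀ {m} (p : Vec Cx m) b q → ¬ Zero q → ∃[ z ] evaluate (ascending (b ∷ q) p) z ≋ 𝟘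
    ascending-root []      b q q≉0 = fundamentalTheorem b q q≉0
    ascending-root (c ∷ p) b q q≉0 = ascending-root p c (b ∷ q) λ { (_ ∷ q≋0) → q≉0 q≋0 }

  -- Synthetic division by x - r: the partial Horner sums at r, of which the last, the remainder, is
  -- dropped.
  quotient : ∀ {n} → Cx → Cx → Vec Cx (suc n) → Vec Cx n
  quotient r c (a ∷ [])        = []
  quotient r c (a ∷ p@(_ ∷ _)) = (c ⊗ r ⊕ a) ∷ quotient r (c ⊗ r ⊕ a) p

  horner-⊕ : ∀ {n} c d (p : Vec Cx n) x → horner (c ⊕ d) p x ≋ horner c p x ⊕ d ⊗ x ^ n
  horner-⊕ c d []      x = ⊕-cong ≋-refl (≋-sym (ℂ.*-identityʳ d))
  horner-⊕ {suc n} c d (a ∷ p) x = ≋-trans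
    (horner-cong (solveᶜ 4 (λ c d x a → (c :⊕ d) :⊗ x :⊕ a :≋ c :⊗ x :⊕ a :⊕ d :⊗ x) ≋-refl c d x a) p x)
    (≋-trans (horner-⊕ (c ⊗ x ⊕ a) (d ⊗ x) p x) (⊕-cong ≋-refl (⊗-assoc d x (x ^ n))))

  horner-quotient : ∀ {n} r c (p : Vec Cx (suc n)) x →
    horner c p x ≋ (x ⊖ r) ⊗ horner c (quotient r c p) x ⊕ horner c p r
  horner-quotient r c (a ∷ []) x =
    solveᶜ 4 (λ r c a x → c :⊗ x :⊕ a :≋ (x :⊕ :⊝ r) :⊗ c :⊕ (c :⊗ r :⊕ a)) ≋-refl r c a x
  horner-quotient {suc n} r c (a ∷ p@(_ ∷ _)) x =
    let d = c ⊗ r ⊕ a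
        e = c ⊗ (x ⊖ r)
        q = quotient r d p
    in ≋-trans (horner-cong (split c r a x) p x)
      (≋-trans (horner-⊕ d e p x)
      (≋-trans (⊕-cong (horner-quotient r d p x) ≋-refl)
      (≋-trans (collect (x ⊖ r) (horner d q x) c (x ^ suc n) (horner d p r))
        (⊕-cong (⊗-cong ≋-refl (≋-sym (≋-trans (horner-cong (⊕-comm (c ⊗ x) d) q x)
          (≋-trans (horner-⊕ d (c ⊗ x) q x) (⊕-cong ≋-refl (⊗-assoc c x (x ^ n))))))) ≋-refl))))
    where
    split : ∀ c r a x → c ⊗ x ⊕ a ≋ (c ⊗ r ⊕ a) ⊕ c ⊗ (x ⊖ r)
    split = solveᶜ 4 (λ c r a x → c :⊗ x :⊕ a :≋ (c :⊗ r :⊕ a) :⊕ c :⊗ (x :⊕ :⊝ r)) ≋-refl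
    collect : ∀ y h c w s → y ⊗ h ⊕ s ⊕ (c ⊗ y) ⊗ w ≋ y ⊗ (h ⊕ c ⊗ w) ⊕ s
    collect = solveᶜ 5 (λ y h c w s → y :⊗ h :⊕ s :⊕ (c :⊗ y) :⊗ w :≋ y :⊗ (h :⊕ c :⊗ w) :⊕ s) ≋-refl

  prodRoots : ∀ {n} → Vec Cx n → Cx → Cx
  prodRoots []       x = 𝟙
  prodRoots (z ∷ zs) x = (x ⊖ z) ⊗ prodRoots zs x

  sumRoots : ∀ {n} → Vec Cx n → Cx
  sumRoots []       = 𝟘
  sumRoots (z ∷ zs) = z ⊕ sumRoots zs

  sumSquares : ∀ {n} → Vec Cx n → Cx
  sumSquares []       = 𝟘
  sumSquares (z ∷ zs) = z ⊗ z ⊕ sumSquares zs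

  -- The coefficients of x^(n-1) and x^(n-2). The default 𝟘 keeps the formulas for the power sums
  -- valid in degrees 0 and 1.
  coeff₁ coeff₂ : ∀ {n} → Vec Cx n → Cx
  coeff₁ []      = 𝟘
  coeff₁ (a ∷ _) = a
  coeff₂ []          = 𝟘
  coeff₂ (_ ∷ [])    = 𝟘
  coeff₂ (_ ∷ b ∷ _) = b

  -- Comparison of coefficients, except when the quotient is too short: then the default 𝟘 on the
  -- left agrees with the right side because r is a root. The same happens for `coeff₂-quotient`.
  coeff₁-quotient : ∀ {n} r (p : Vec Cx (suc n)) → monic p r ≋ 𝟘 →
    coeff₁ (quotient r 𝟙 p) ≋ r ⊕ coeff₁ p
  coeff₁-quotient r (a ∷ [])    pr≋0 = ≋-trans (≋-sym pr≋0) (⊕-cong (⊗-identityˡ r) ≋-refl)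
  coeff₁-quotient r (a ∷ b ∷ p) pr≋0 = ⊕-cong (⊗-identityˡ r) ≋-refl

  coeff₂-quotient : ∀ {n} r (p : Vec Cx (suc n)) → monic p r ≋ 𝟘 →
    coeff₂ (quotient r 𝟙 p) ≋ r ⊗ (r ⊕ coeff₁ p) ⊕ coeff₂ p
  coeff₂-quotient r (a ∷ []) pr≋0 = ≋-sym (≋-trans (ℂ.+-identityʳ _)
    (≋-trans (⊗-cong ≋-refl (≋-trans (⊕-cong (≋-sym (⊗-identityˡ r)) ≋-refl) pr≋0)) (ℂ.zeroʳ r)))
  coeff₂-quotient r (a ∷ b ∷ []) pr≋0 = ≋-trans (≋-sym pr≋0) (⊕-cong
    (≋-trans (⊗-comm _ r) (⊗-cong ≋-refl (⊕-cong (⊗-identityˡ r) ≋-refl))) ≋-refl)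
  coeff₂-quotient r (a ∷ b ∷ c ∷ p) pr≋0 = ⊕-cong
    (≋-trans (⊗-comm _ r) (⊗-cong ≋-refl (⊕-cong (⊗-identityˡ r) ≋-refl))) ≋-refl

  -- The first two of Newton's identities travel with the roots, so that splitting off one linear
  -- factor proves all three statements.
  record Factored {n} (p : Vec Cx n) : Set where
    field
      roots       : Vec Cx n
      factors     : ∀ x → monic p x ≋ prodRoots roots x
      sum-roots   : sumRoots roots ≋ ⊝ coeff₁ p
      sum-squares : sumSquares roots ≋ coeff₁ p ⊗ coeff₁ p ⊖ real (ι 2ℚ) ⊗ coeff₂ p

  factor : ∀ {n} (p : Vec Cx n) → Factored p
  factor [] = record
    { roots       = []
    ; factors     = λ x → ≋-refl
    ; sum-roots   = ≋-sym -𝟘≋𝟘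
    ; sum-squares = ≋-sym (≋-trans (⊕-cong (ℂ.zeroˡ 𝟘) (≋-trans (⊝-cong (ℂ.zeroʳ _)) -𝟘≋𝟘)) (⊕-identityˡ 𝟘))
    }
    where
    -𝟘≋𝟘 : ⊝ 𝟘 ≋ 𝟘
    -𝟘≋𝟘 = ≋-trans (≋-sym (ℂ.+-identityʳ _)) (⊝-inverseˡ 𝟘)
  factor p@(a ∷ _) =
    let r , pr≋0 = monic-root p
        q = quotient r 𝟙 p
        F = factor q
        open Factored F
        c₁ = coeff₁-quotient r p pr≋0
    in record
      { roots       = r ∷ roots
      ; factors     = λ x → ≋-trans (horner-quotient r 𝟙 p x)
          (≋-trans (⊕-cong (⊗-cong ≋-refl (factors x)) pr≋0) (ℂ.+-identityʳ _))
      ; sum-roots   = ≋-trans (⊕-cong ≋-refl (≋-trans sum-roots (⊝-cong c₁)))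
          (solveᶜ 2 (λ r c → r :⊕ :⊝ (r :⊕ c) :≋ :⊝ c) ≋-refl r (coeff₁ p))
      ; sum-squares = ≋-trans (⊕-cong ≋-refl (≋-trans sum-squares
            (⊕-cong (⊗-cong c₁ c₁) (⊝-cong (⊗-cong ≋-refl (coeff₂-quotient r p pr≋0))))))
          (solveᶜ 3 (λ r c d → r :⊗ r :⊕ ((r :⊕ c) :⊗ (r :⊕ c) :⊕ :⊝ (conᶜ 2ℚ :⊗ (r :⊗ (r :⊕ c) :⊕ d)))
            :≋ c :⊗ c :⊕ :⊝ (conᶜ 2ℚ :⊗ d)) ≋-refl r (coeff₁ p) (coeff₂ p))
      }

  root-of-product : ∀ {n} (zs : Vec Cx n) {x} → prodRoots zs x ≋ 𝟘 → ∃[ i ] x ≋ Vec.lookup zs i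
  root-of-product []       𝟙≋𝟘 = contradiction 𝟙≋𝟘 𝟙≉𝟘
  root-of-product (z ∷ zs) {x} eq with ⊗-zero eq
  ... | inj₁ x-z≋0 = Fin.zero , ≋-trans
        (solveᶜ 2 (λ x z → x :≋ (x :⊕ :⊝ z) :⊕ z) ≋-refl x z)
        (≋-trans (⊕-cong x-z≋0 ≋-refl) (⊕-identityˡ z))
  ... | inj₂ rest = let i , x≋ = root-of-product zs rest in Fin.suc i , x≋

  -- A polynomial with a nonzero coefficient stays away from 0 far out, and some natural number lies
  -- that far out.
  identityTheorem : ∀ p → (∀ k → evaluate p (real (ι (fromℕℚ k))) ≋ 𝟘) → Zero p
  identityTheorem p vanishes with Zero⊎BoundedBelow p
  ... | inj₁ p≋0 = p≋0
  ... | inj₂ (c , 0<c , R , 0≤R , c≤N) = contradiction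
      (≤-trans (c≤N (real (ι (fromℕℚ (suc k)))) R≤) (≤-reflexive (≈-trans (N-cong (vanishes (suc k))) N-𝟘)))
      (ι-pos 0<c)
    where
    q = proj₁ (ι-above R)
    k = proj₁ (archimedean q)
    -- The successor ensures m ≥ 1, hence N m = m² ≥ m ≥ R.
    m = ι (fromℕℚ (suc k))
    0≤m : 0# ≤ m
    0≤m = ι-nonNeg (fromℕℚ-nonNeg (suc k))
    k≤k+1 : fromℕℚ k ℚ.≤ fromℕℚ (suc k)
    k≤k+1 = ℚ.≤-trans (ℚ.≤-reflexive (≡.sym (ℚ.+-identityˡ _))) (ℚ.+-monoˡ-≤ (fromℕℚ k) (ℚ.<⇒≤ (ℚ.positive⁻¹ 1ℚ)))
    1≤m : 1# ≤ m
    1≤m = ≤-respˡ ι-1 (ι-mono-≤ (ℚ.≤-trans (ℚ.≤-reflexive (≡.sym (ℚ.+-identityʳ 1ℚ)))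
      (ℚ.+-monoʳ-≤ 1ℚ (fromℕℚ-nonNeg k))))
    R≤ : R ≤ N (real m)
    R≤ = ≤-respʳ (≈-sym (N-real m)) (≤-trans (proj₂ (ι-above R))
      (≤-trans (ι-mono-≤ (ℚ.≤-trans (proj₂ (archimedean q)) k≤k+1))
        (≤-respˡ (*-identityʳ m) (*-monoˡ-≤ 0≤m 1≤m))))

-- Counting colourings: the vertex recurrence.

module Counting where

  open import Algebra.Properties.Semiring.Sum ℕ.+-*-semiring public
    using (sum; sum-cong-≗; ∑-distrib-+; ∑-comm; *-distribˡ-sum; *-distribʳ-sum; sum-replicate-zero)
  open import Data.Nat using (_+_; _*_)

  private variable
    n k : ℕ

  𝟏 : ∀ {P : Set} → Dec P → ℕ
  𝟏 P? = if does P? then 1 else 0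

  𝟏-cong : ∀ {P Q : Set} (P? : Dec P) (Q? : Dec Q) → (P → Q) → (Q → P) → 𝟏 P? ≡ 𝟏 Q?
  𝟏-cong (yes p) (yes q) P→Q Q→P = refl
  𝟏-cong (yes p) (no ¬q) P→Q Q→P = contradiction (P→Q p) ¬q
  𝟏-cong (no ¬p) (yes q) P→Q Q→P = contradiction (Q→P q) ¬p
  𝟏-cong (no ¬p) (no ¬q) P→Q Q→P = refl

  𝟏-× : ∀ {P Q : Set} (P? : Dec P) (Q? : Dec Q) → 𝟏 (P? ×-dec Q?) ≡ 𝟏 P? * 𝟏 Q?
  𝟏-× (yes p) (yes q) = refl
  𝟏-× (yes p) (no ¬q) = refl
  𝟏-× (no ¬p) Q?      = refl

  𝟏-yes : ∀ {P : Set} (P? : Dec P) → P → 𝟏 P? ≡ 1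
  𝟏-yes (yes _) p = refl
  𝟏-yes (no ¬p) p = contradiction p ¬p

  length-filter : ∀ {A : Set} {P : Pred A _} (P? : Decidable P) (f : Fin n → A) →
    List.length (List.filter P? (List.tabulate f)) ≡ sum (λ i → 𝟏 (P? (f i)))
  length-filter {zero}  P? f = refl
  length-filter {suc n} P? f with P? (f zero)
  ... | yes _ = cong suc (length-filter P? (f ∘ suc))
  ... | no  _ = length-filter P? (f ∘ suc)

  sum-↑ : ∀ m {n} (g : Fin (m + n) → ℕ) → sum g ≡ sum (λ i → g (i ↑ˡ n)) + sum (λ i → g (m ↑ʳ i))
  sum-↑ zero    g = refl
  sum-↑ (suc m) g = trans (cong (g zero +_) (sum-↑ m (g ∘ suc))) (sym (ℕ.+-assoc (g zero) _ _))

  sum-combine : ∀ k m (g : Fin (k * m) → ℕ) → sum g ≡ sum (λ c → sum (λ i → g (combine {k} {m} c i)))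
  sum-combine zero    m g = refl
  sum-combine (suc k) m g = trans (sum-↑ m g)
    (cong (sum (λ i → g (i ↑ˡ (k * m))) +_) (sum-combine k m (g ∘ (m ↑ʳ_))))

  -- Decoded and extended colourings agree only pointwise, so rearranging sums over colourings
  -- requires summands that respect `_≗_`.
  Extensional : ((Fin n → Fin k) → ℕ) → Set
  Extensional F = ∀ {f g} → f ≗ g → F f ≡ F g

  ∷-cong : ∀ {A : Set} (c : A) {f g : Fin n → A} → f ≗ g → (c Vector.∷ f) ≗ (c Vector.∷ g)
  ∷-cong c f≗g zero    = refl
  ∷-cong c f≗g (suc i) = f≗g i

  -- One coordinate at a time, so that the colour of a chosen vertex can be moved to any place in
  -- the iterated sum.
  sumFun : ∀ n k → ((Fin n → Fin k) → ℕ) → ℕ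
  sumFun zero    k F = F (λ ())
  sumFun (suc n) k F = sum (λ c → sumFun n k (λ f → F (c Vector.∷ f)))

  sumFun-cong : ∀ n {k} {F G : (Fin n → Fin k) → ℕ} → F ≗ G → sumFun n k F ≡ sumFun n k G
  sumFun-cong zero    F≗G = F≗G (λ ())
  sumFun-cong (suc n) F≗G = sum-cong-≗ (λ c → sumFun-cong n (λ f → F≗G (c Vector.∷ f)))

  sumFun-+ : ∀ n {k} (F G : (Fin n → Fin k) → ℕ) →
    sumFun n k (λ f → F f + G f) ≡ sumFun n k F + sumFun n k G
  sumFun-+ zero    F G = refl
  sumFun-+ (suc n) {k} F G = trans
    (sum-cong-≗ (λ c → sumFun-+ n (λ f → F (c Vector.∷ f)) (λ f → G (c Vector.∷ f))))
    (∑-distrib-+ (λ c → sumFun n k (λ f → F (c Vector.∷ f))) (λ c → sumFun n k (λ f → G (c Vector.∷ f))))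

  sumFun-zero : ∀ n {k} → sumFun n k (λ _ → 0) ≡ 0
  sumFun-zero zero        = refl
  sumFun-zero (suc n) {k} = trans (sum-cong-≗ {k} (λ c → sumFun-zero n)) (sum-replicate-zero k)

  sumFun-sum : ∀ n {k m} (F : Fin m → (Fin n → Fin k) → ℕ) →
    sumFun n k (λ f → sum (λ j → F j f)) ≡ sum (λ j → sumFun n k (F j))
  sumFun-sum n {k} {zero}  F = sumFun-zero n
  sumFun-sum n {k} {suc m} F = trans (sumFun-+ n (F zero) (λ f → sum (λ j → F (suc j) f)))
    (cong (sumFun n k (F zero) +_) (sumFun-sum n (F ∘ suc)))

  sumFun-*ʳ : ∀ n {k} (F : (Fin n → Fin k) → ℕ) c → sumFun n k (λ f → F f * c) ≡ sumFun n k F * c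
  sumFun-*ʳ zero    F c = refl
  sumFun-*ʳ (suc n) {k} F c = trans (sum-cong-≗ (λ d → sumFun-*ʳ n (λ f → F (d Vector.∷ f)) c))
    (sym (*-distribʳ-sum c (λ d → sumFun n k (λ f → F (d Vector.∷ f)))))

  finToFun-combine : ∀ {n k} (c : Fin k) (i : Fin (k ℕ.^ n)) →
    finToFun {k} {suc n} (combine {k} {k ℕ.^ n} c i) ≗ (c Vector.∷ finToFun {k} {n} i)
  finToFun-combine {n} {k} c i zero    = cong proj₁ (Fin.remQuot-combine {k} {k ℕ.^ n} c i)
  finToFun-combine {n} {k} c i (suc j) =
    cong (λ r → finToFun {k} {n} (proj₂ r) j) (Fin.remQuot-combine {k} {k ℕ.^ n} c i)

  sum-finToFun : ∀ n {k} (F : (Fin n → Fin k) → ℕ) → Extensional F →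
    sum {k ℕ.^ n} (λ i → F (finToFun {k} {n} i)) ≡ sumFun n k F
  sum-finToFun zero    F ext = trans (ℕ.+-identityʳ _) (ext (λ ()))
  sum-finToFun (suc n) {k} F ext = trans (sum-combine k (k ℕ.^ n) (λ i → F (finToFun {k} {suc n} i)))
    (sum-cong-≗ (λ c → trans (sum-cong-≗ (λ i → ext (finToFun-combine {n} {k} c i)))
      (sum-finToFun n (λ f → F (c Vector.∷ f)) (λ f≗g → ext (∷-cong c f≗g)))))

  -- Interchange of finite sums: the sum over the colour of v is first brought outermost past the
  -- coordinates before v, then moved innermost.
  sumFun-insertAt : ∀ n {k} (v : Fin (suc n)) (F : (Fin (suc n) → Fin k) → ℕ) → Extensional F →
    sumFun (suc n) k F ≡ sumFun n k (λ f → sum (λ c → F (insertAt f v c)))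
  sumFun-insertAt n {k} v F ext = trans (outermost n v F ext) (sym (sumFun-sum n (λ c f → F (insertAt f v c))))
    where
    at-zero : ∀ {n} (f : Fin n → Fin k) c → (c Vector.∷ f) ≗ insertAt f zero c
    at-zero f c zero    = refl
    at-zero f c (suc i) = refl
    at-suc : ∀ {n} (f : Fin n → Fin k) v c d → (d Vector.∷ insertAt f v c) ≗ insertAt (d Vector.∷ f) (suc v) c
    at-suc f v c d zero    = refl
    at-suc f v c d (suc i) = refl
    outermost : ∀ n (v : Fin (suc n)) (F : (Fin (suc n) → Fin k) → ℕ) → Extensional F →
      sumFun (suc n) k F ≡ sum (λ c → sumFun n k (λ f → F (insertAt f v c)))
    outermost n zero F ext =
      sum-cong-≗ {k} (λ c → sumFun-cong n {k} {λ f → F (c Vector.∷ f)} (λ f → ext (at-zero f c)))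
    outermost (suc n) (suc v) F ext = trans
      (sum-cong-≗ (λ d → outermost n v (λ f → F (d Vector.∷ f)) (λ f≗g → ext (∷-cong d f≗g))))
      (trans (∑-comm (λ d c → sumFun n k (λ f → F (d Vector.∷ insertAt f v c))))
        (sum-cong-≗ {k} (λ c → sum-cong-≗ {k} (λ d →
          sumFun-cong n {k} {λ f → F (d Vector.∷ insertAt f v c)} (λ f → ext (at-suc f v c d))))))

  Avoids : (Fin n → Bool) → (Fin n → Fin k) → Fin k → Set
  Avoids s f c = ∀ j → s j ≡ true → c ≢ f j

  avoids? : ∀ (s : Fin n → Bool) (f : Fin n → Fin k) c → Dec (Avoids s f c)
  avoids? s f c = Fin.all? λ j → (s j Bool.≟ true) →-dec ¬? (c Fin.≟ f j)

  LastOfColour : (Fin n → Bool) → (Fin n → Fin k) → Fin n → Set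
  LastOfColour s f j = ∀ i → j Fin.< i → s i ≡ true → f j ≢ f i

  lastOfColour? : ∀ (s : Fin n → Bool) (f : Fin n → Fin k) j → Dec (LastOfColour s f j)
  lastOfColour? s f j = Fin.all? λ i → (j Fin.<? i) →-dec ((s i Bool.≟ true) →-dec ¬? (f j Fin.≟ f i))

  sum-pick : ∀ (g : Fin k → ℕ) x → sum g ≡ sum (λ c → 𝟏 (¬? (c Fin.≟ x)) * g c) + g x
  sum-pick {suc k} g zero = trans (ℕ.+-comm (g zero) _) (cong (_+ g zero)
    (sum-cong-≗ (λ c → sym (ℕ.+-identityʳ (g (suc c))))))
  sum-pick {suc k} g (suc x) = trans (cong (g zero +_) (sum-pick (g ∘ suc) x))
    (trans (sym (ℕ.+-assoc (g zero) _ (g (suc x)))) (cong (_+ g (suc x))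
      (cong₂ _+_ (sym (ℕ.+-identityʳ (g zero))) (sum-cong-≗ (λ c → cong (_* g (suc c))
        (𝟏-cong (¬? (c Fin.≟ x)) (¬? (suc c Fin.≟ suc x))
          (λ c≢x e → c≢x (Fin.suc-injective e)) (λ ne e → ne (cong suc e))))))))

  -- The colours used on s are counted by the last vertex carrying them.
  count-colours : ∀ {n k} (s : Fin n → Bool) (f : Fin n → Fin k) →
    sum (λ c → 𝟏 (avoids? s f c)) + sum (λ j → if s j then 𝟏 (lastOfColour? s f j) else 0) ≡ k
  count-colours {zero} {k} s f = trans (ℕ.+-identityʳ _)
    (trans (sum-cong-≗ {k} (λ c → 𝟏-yes (avoids? s f c) (λ ()))) (ones k))
    where
    ones : ∀ k → sum {k} (λ _ → 1) ≡ k
    ones zero    = refl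
    ones (suc k) = cong suc (ones k)
  count-colours {suc n} {k} s f = trans (cong (sum (λ c → 𝟏 (avoids? s f c)) +_)
        (cong ((if s zero then 𝟏 (lastOfColour? s f zero) else 0) +_) later))
      (trans (first (s zero) refl) (count-colours (s ∘ suc) (f ∘ suc)))
    where
    A : Fin k → ℕ
    A c = 𝟏 (avoids? (s ∘ suc) (f ∘ suc) c)
    L = sum (λ j → if s (suc j) then 𝟏 (lastOfColour? (s ∘ suc) (f ∘ suc) j) else 0)
    later : sum (λ j → if s (suc j) then 𝟏 (lastOfColour? s f (suc j)) else 0) ≡ L
    later = sum-cong-≗ (λ j → cong (if s (suc j) then_else 0) (𝟏-cong (lastOfColour? s f (suc j))
      (lastOfColour? (s ∘ suc) (f ∘ suc) j)
      (λ last i j<i → last (suc i) (ℕ.s≤s j<i))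
      (λ { last (suc i) (ℕ.s≤s j<i) → last i j<i })))
    first : ∀ b → s zero ≡ b →
      sum (λ c → 𝟏 (avoids? s f c)) + ((if b then 𝟏 (lastOfColour? s f zero) else 0) + L) ≡ sum A + L
    first false s₀≡false = cong (_+ L) (sum-cong-≗ (λ c → 𝟏-cong (avoids? s f c) (avoids? (s ∘ suc) (f ∘ suc) c)
      (λ av j → av (suc j))
      (λ { av zero s₀≡true → contradiction (trans (sym s₀≡true) s₀≡false) (λ ()) ; av (suc j) → av j })))
    -- Adding vertex 0 to the neighbours removes its colour from the free ones exactly if no later
    -- neighbour carries it, which is when 0 counts as the last of its colour.
    first true s₀≡true = trans (sym (ℕ.+-assoc (sum (λ c → 𝟏 (avoids? s f c))) _ L)) (cong (_+ L)
      (trans (cong₂ _+_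
        (sum-cong-≗ (λ c → trans (𝟏-cong (avoids? s f c) (¬? (c Fin.≟ f zero) ×-dec avoids? (s ∘ suc) (f ∘ suc) c)
            (λ av → av zero s₀≡true , λ j → av (suc j))
            (λ { (c≢ , av) zero _ → c≢ ; (c≢ , av) (suc j) → av j }))
          (𝟏-× (¬? (c Fin.≟ f zero)) (avoids? (s ∘ suc) (f ∘ suc) c))))
        (𝟏-cong (lastOfColour? s f zero) (avoids? (s ∘ suc) (f ∘ suc) (f zero))
          (λ last j → last (suc j) (ℕ.s≤s ℕ.z≤n))
          (λ { av (suc j) _ → av j })))
      (sym (sum-pick A (f zero)))))

  delete : Graph (suc n) → Fin (suc n) → Graph n
  delete G v = record
    { adj         = λ u w → adj G (punchIn v u) (punchIn v w)
    ; symmetric   = λ u w → symmetric G (punchIn v u) (punchIn v w)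
    ; irreflexive = λ u → irreflexive G (punchIn v u) }

  neighbours : Graph (suc n) → Fin (suc n) → Fin n → Bool
  neighbours G v j = adj G v (punchIn v j)

  spoke : (Fin n → Bool) → Fin n → Fin n → Fin n → Bool
  spoke s j u w = does (u Fin.≟ j) ∧ (does (j Fin.<? w) ∧ s w)

  -- Colourings of H with the star at j are those of H in which j is the last of s with its colour.
  -- Its role is that of a contraction, but it keeps the vertex set and changes H only at j.
  addStar : Graph n → (Fin n → Bool) → Fin n → Graph n
  addStar H s j = record
    { adj         = λ u w → adj H u w ∨ (spoke s j u w ∨ spoke s j w u)
    ; symmetric   = λ u w → cong₂ _∨_ (symmetric H u w) (Bool.∨-comm (spoke s j u w) (spoke s j w u))
    ; irreflexive = λ v → cong₂ _∨_ (irreflexive H v) (cong₂ _∨_ (no-loop v) (no-loop v)) }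
    where
    no-loop : ∀ v → spoke s j v v ≡ false
    no-loop v with v Fin.≟ j
    ... | no _ = refl
    ... | yes refl = cong (_∧ s v) (dec-false (v Fin.<? v) (ℕ.<-irrefl refl))

  ∧-true : ∀ a b → a ∧ b ≡ true → a ≡ true × b ≡ true
  ∧-true true b eq = refl , eq

  does-true : ∀ {P : Set} (P? : Dec P) → does P? ≡ true → P
  does-true (yes p) _ = p

  spoke-true : ∀ (s : Fin n → Bool) j u w → spoke s j u w ≡ true → u ≡ j × j Fin.< w × s w ≡ true
  spoke-true s j u w eq =
    let u≡j , rest = ∧-true (does (u Fin.≟ j)) _ eq
        j<w , sw = ∧-true (does (j Fin.<? w)) _ rest
    in does-true (u Fin.≟ j) u≡j , does-true (j Fin.<? w) j<w , sw

  spoke-intro : ∀ (s : Fin n → Bool) j w → j Fin.< w → s w ≡ true → spoke s j j w ≡ true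
  spoke-intro s j w j<w sw = cong₂ _∧_ (dec-true (j Fin.≟ j) refl) (cong₂ _∧_ (dec-true (j Fin.<? w) j<w) sw)

  ∨-true : ∀ a b → a ∨ b ≡ true → a ≡ true ⊎ b ≡ true
  ∨-true true  b eq = inj₁ refl
  ∨-true false b eq = inj₂ eq

  addStar-colouring : ∀ (H : Graph n) s j (f : Fin n → Fin k) →
    IsColouring (addStar H s j) f → IsColouring H f × LastOfColour s f j
  addStar-colouring H s j f col =
    (λ u w uw → col u w (cong (_∨ (spoke s j u w ∨ spoke s j w u)) uw)) ,
    (λ i j<i sᵢ → col j i (trans (cong (λ b → adj H j i ∨ (b ∨ spoke s j i j)) (spoke-intro s j i j<i sᵢ))
      (Bool.∨-zeroʳ (adj H j i))))

  colouring-addStar : ∀ (H : Graph n) s j (f : Fin n → Fin k) →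
    IsColouring H f × LastOfColour s f j → IsColouring (addStar H s j) f
  colouring-addStar H s j f (col , last) u w uw with ∨-true (adj H u w) _ uw
  ... | inj₁ e = col u w e
  ... | inj₂ e with ∨-true (spoke s j u w) _ e
  ...   | inj₁ e₁ with refl , j<w , sw ← spoke-true s j u w e₁ = last w j<w sw
  ...   | inj₂ e₂ with refl , j<u , su ← spoke-true s j w u e₂ = λ fu≡fw → last u j<u su (sym fu≡fw)

  punchIn-view : ∀ (v u : Fin (suc n)) → u ≡ v ⊎ ∃[ j ] u ≡ punchIn v j
  punchIn-view v u with v Fin.≟ u
  ... | yes v≡u = inj₁ (sym v≡u)
  ... | no  v≢u = inj₂ (Fin.punchOut v≢u , sym (Fin.punchIn-punchOut v≢u))

  insertAt-colouring : ∀ (G : Graph (suc n)) v (f : Fin n → Fin k) c →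
    IsColouring G (insertAt f v c) → IsColouring (delete G v) f × Avoids (neighbours G v) f c
  insertAt-colouring G v f c col =
    (λ u w uw fu≡fw → col (punchIn v u) (punchIn v w) uw
      (trans (Vector.insertAt-punchIn f v c u) (trans fu≡fw (sym (Vector.insertAt-punchIn f v c w))))) ,
    (λ j vj c≡fj → col v (punchIn v j) vj
      (trans (Vector.insertAt-lookup f v c) (trans c≡fj (sym (Vector.insertAt-punchIn f v c j)))))

  colouring-insertAt : ∀ (G : Graph (suc n)) v (f : Fin n → Fin k) c →
    IsColouring (delete G v) f × Avoids (neighbours G v) f c → IsColouring G (insertAt f v c)
  colouring-insertAt G v f c (col , av) u w uw eq with punchIn-view v u | punchIn-view v w
  ... | inj₁ refl | inj₁ refl = contradiction (trans (sym uw) (irreflexive G v)) λ ()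
  ... | inj₁ refl | inj₂ (j , refl) = av j uw
        (trans (sym (Vector.insertAt-lookup f v c)) (trans eq (Vector.insertAt-punchIn f v c j)))
  ... | inj₂ (i , refl) | inj₁ refl = av i (trans (symmetric G v (punchIn v i)) uw)
        (trans (sym (Vector.insertAt-lookup f v c)) (trans (sym eq) (Vector.insertAt-punchIn f v c i)))
  ... | inj₂ (i , refl) | inj₂ (j , refl) = col i j uw
        (trans (sym (Vector.insertAt-punchIn f v c i)) (trans eq (Vector.insertAt-punchIn f v c j)))

  colourings : Graph n → ∀ k → (Fin n → Fin k) → ℕ
  colourings G k f = 𝟏 (isColouring? G f)

  colourings-cong : ∀ {G G′ : Graph n} → (∀ u v → adj G u v ≡ adj G′ u v) →
    ∀ {f g : Fin n → Fin k} → f ≗ g → colourings G k f ≡ colourings G′ k g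
  colourings-cong {G = G} {G′} G≗G′ {f} {g} f≗g = 𝟏-cong (isColouring? G f) (isColouring? G′ g)
    (λ col u v uv e → col u v (trans (G≗G′ u v) uv) (trans (f≗g u) (trans e (sym (f≗g v)))))
    (λ col u v uv e → col u v (trans (sym (G≗G′ u v)) uv) (trans (sym (f≗g u)) (trans e (f≗g v))))

  π-sumFun : ∀ (G : Graph n) k → π G k ≡ sumFun n k (colourings G k)
  π-sumFun {n} G k = trans (length-filter (λ i → isColouring? G (finToFun {k} {n} i)) id)
    (sum-finToFun n (colourings G k) (colourings-cong {G = G} {G} (λ _ _ → refl)))

  π-order-zero : ∀ (G : Graph 0) k → π G k ≡ 1
  π-order-zero G k = π-sumFun G k

  π-cong : ∀ {G G′ : Graph n} → (∀ u v → adj G u v ≡ adj G′ u v) → ∀ k → π G k ≡ π G′ k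
  π-cong {n} {G} {G′} G≗G′ k = trans (π-sumFun G k)
    (trans (sumFun-cong n (λ f → colourings-cong {G = G} {G′} G≗G′ (λ _ → refl))) (sym (π-sumFun G′ k)))

  stars : (G : Graph (suc n)) (v : Fin (suc n)) → Fin n → Graph n
  stars G v = addStar (delete G v) (neighbours G v)

  -- A colouring of G − v extends to v in k − (number of colours on the
  -- neighbours of v) ways.
  π-recurrence : ∀ (G : Graph (suc n)) v k →
    π G k + sum (λ j → if neighbours G v j then π (stars G v j) k else 0) ≡ π (delete G v) k * k
  π-recurrence {n} G v k = begin
      π G k + sum (λ j → if s j then π (stars G v j) k else 0)
        ≡⟨ cong₂ _+_ extend (trans (sum-cong-≗ (λ j → star-term j (s j)))
             (sym (sumFun-sum n (λ j f → col f * last f j)))) ⟩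
      sumFun n k (λ f → col f * free f) + sumFun n k (λ f → sum (λ j → col f * last f j))
        ≡⟨ sym (sumFun-+ n (λ f → col f * free f) (λ f → sum (λ j → col f * last f j))) ⟩
      sumFun n k (λ f → col f * free f + sum (λ j → col f * last f j))
        ≡⟨ sumFun-cong n (λ f → trans
             (cong (col f * free f +_) (sym (*-distribˡ-sum (col f) (last f))))
             (trans (sym (ℕ.*-distribˡ-+ (col f) (free f) (sum (last f)))) (cong (col f *_) (count-colours s f)))) ⟩
      sumFun n k (λ f → col f * k)
        ≡⟨ sumFun-*ʳ n col k ⟩
      sumFun n k col * k
        ≡⟨ cong (_* k) (sym (π-sumFun (delete G v) k)) ⟩
      π (delete G v) k * k ∎
    where
    open ≡.≡-Reasoning
    s = neighbours G v
    col = colourings (delete G v) k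
    free : (Fin n → Fin k) → ℕ
    free f = sum (λ c → 𝟏 (avoids? s f c))
    last : (Fin n → Fin k) → Fin n → ℕ
    last f j = if s j then 𝟏 (lastOfColour? s f j) else 0
    extend : π G k ≡ sumFun n k (λ f → col f * sum (λ c → 𝟏 (avoids? s f c)))
    extend = trans (π-sumFun G k) (trans
      (sumFun-insertAt n v (colourings G k) (colourings-cong {G = G} {G} (λ _ _ → refl)))
      (sumFun-cong n (λ f → trans
        (sum-cong-≗ (λ c → trans
          (𝟏-cong (isColouring? G (insertAt f v c)) (isColouring? (delete G v) f ×-dec avoids? s f c)
            (insertAt-colouring G v f c) (colouring-insertAt G v f c))
          (𝟏-× (isColouring? (delete G v) f) (avoids? s f c))))
        (sym (*-distribˡ-sum (col f) (λ c → 𝟏 (avoids? s f c)))))))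
    star-term : ∀ j b → (if b then π (stars G v j) k else 0) ≡
      sumFun n k (λ f → col f * (if b then 𝟏 (lastOfColour? s f j) else 0))
    star-term j true = trans (π-sumFun (stars G v j) k) (sumFun-cong n (λ f → trans
      (𝟏-cong (isColouring? (stars G v j) f) (isColouring? (delete G v) f ×-dec lastOfColour? s f j)
        (addStar-colouring (delete G v) s j f) (colouring-addStar (delete G v) s j f))
      (𝟏-× (isColouring? (delete G v) f) (lastOfColour? s f j))))
    star-term j false = sym (trans
      (sumFun-cong n {k} {λ f → col f * 0} {λ _ → 0} (λ f → ℕ.*-zeroʳ (col f))) (sumFun-zero n {k}))

-- Edge counts and the coefficients of bipartite graphs.

module Edges where

  open Counting
  open import Data.Nat using (_+_; _*_)
  open import Data.Nat.Solver using (module +-*-Solver)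

  private variable
    n : ℕ

  ∨-false : ∀ b {c} → c ≡ false → b ∨ c ≡ b
  ∨-false b refl = Bool.∨-identityʳ b

  spoke-elsewhere : ∀ (s : Fin (suc n) → Bool) j u w → spoke s j (punchIn j u) w ≡ false
  spoke-elsewhere s j u w = cong (_∧ _) (dec-false (punchIn j u Fin.≟ j) (Fin.punchInᵢ≢i j u))

  delete-addStar : ∀ (H : Graph (suc n)) s j u w →
    adj (delete (addStar H s j) j) u w ≡ adj (delete H j) u w
  delete-addStar H s j u w = ∨-false (adj H (punchIn j u) (punchIn j w))
    (cong₂ _∨_ (spoke-elsewhere s j u (punchIn j w)) (spoke-elsewhere s j w (punchIn j u)))

  size : (Fin n → Bool) → ℕ
  size s = sum (λ j → if s j then 1 else 0)

  -- Counted along the deletion of vertex 0, the recursion that also defines `χ`, so that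
  -- coefficients can be compared step by step.
  edges : Graph n → ℕ
  edges {zero}  G = 0
  edges {suc n} G = edges (delete G zero) + size (neighbours G zero)

  edges-cong : {G G′ : Graph n} → (∀ u v → adj G u v ≡ adj G′ u v) → edges G ≡ edges G′
  edges-cong {zero}  G≗G′ = refl
  edges-cong {suc n} {G} {G′} G≗G′ = cong₂ _+_
    (edges-cong {n} {delete G zero} {delete G′ zero} (λ u v → G≗G′ (suc u) (suc v)))
    (sum-cong-≗ (λ j → cong (if_then 1 else 0) (G≗G′ zero (suc j))))

  later : (Fin n → Bool) → Fin n → ℕ
  later s j = size (λ i → does (j Fin.<? i) ∧ s i)

  edges-addStar : ∀ (H : Graph n) s j → (∀ i → j Fin.< i → s i ≡ true → adj H j i ≡ false) →
    edges (addStar H s j) ≡ edges H + later s j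
  edges-addStar {suc n} H s zero free = trans
    (cong₂ _+_ (edges-cong {n} {delete (addStar H s zero) zero} {delete H zero} (delete-addStar H s zero))
      (trans (sum-cong-≗ (λ i → disjoint (adj H zero (suc i)) (s (suc i)) (free (suc i) (ℕ.s≤s ℕ.z≤n))))
        (∑-distrib-+ (λ i → if adj H zero (suc i) then 1 else 0) (λ i → if s (suc i) then 1 else 0))))
    (sym (ℕ.+-assoc (edges (delete H zero)) _ _))
    where
    disjoint : ∀ a b → (b ≡ true → a ≡ false) →
      (if a ∨ (b ∨ false) then 1 else 0) ≡ (if a then 1 else 0) + (if b then 1 else 0)
    disjoint true  true  excl = contradiction (excl refl) λ ()
    disjoint true  false excl = refl
    disjoint false true  excl = refl
    disjoint false false excl = refl
  edges-addStar {suc n} H s (suc j) free = trans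
    (cong₂ _+_ (trans
        (edges-cong {n} {delete (addStar H s (suc j)) zero} {addStar (delete H zero) (s ∘ suc) j} (λ u w → refl))
        (edges-addStar (delete H zero) (s ∘ suc) j (λ i j<i → free (suc i) (ℕ.s≤s j<i))))
      (sum-cong-≗ (λ i → cong (if_then 1 else 0) (∨-false (adj H zero (suc i)) (Bool.∧-zeroʳ (does (i Fin.≟ j)))))))
    (solve 3 (λ a b c → a :+ b :+ c := a :+ c :+ b) refl
      (edges (delete H zero)) (later (s ∘ suc) j) (size (neighbours H zero)))
    where open +-*-Solver

  -- The inner sum is the number d (d - 1) / 2 of pairs in s, with subtraction and division cleared.
  later-pairs : ∀ (s : Fin n → Bool) →
    2 * sum (λ j → if s j then later s j else 0) + size s ≡ size s * size s
  later-pairs {zero}  s = refl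
  later-pairs {suc n} s = go (s zero)
    where
    open +-*-Solver
    s′ = s ∘ suc
    T = sum (λ j → if s′ j then later s′ j else 0)
    d = size s′
    go : ∀ b → 2 * ((if b then d else 0) + T) + ((if b then 1 else 0) + d)
      ≡ ((if b then 1 else 0) + d) * ((if b then 1 else 0) + d)
    go false = later-pairs s′
    go true  = trans (solve 2 (λ d T → con 2 :* (d :+ T) :+ (con 1 :+ d) := (con 2 :* T :+ d) :+ con 2 :* d :+ con 1)
        refl d T)
      (trans (cong (λ x → x + 2 * d + 1) (later-pairs s′))
        (solve 1 (λ d → d :* d :+ con 2 :* d :+ con 1 := (con 1 :+ d) :* (con 1 :+ d)) refl d))

  -- The coefficient two below the leading one. In P_G = x P_H - Σ P_{H_j} the second term
  -- contributes with a plus sign, as P_{H_j} has second-highest coefficient -`edges` H_j.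
  secondCoefficient : Graph n → ℕ
  secondCoefficient {zero}  G = 0
  secondCoefficient {suc n} G = secondCoefficient (delete G zero)
    + sum (λ j → if neighbours G zero j then edges (stars G zero j) else 0)

  Bipartition : (Fin n → Bool) → Graph n → Set
  Bipartition β G = ∀ u w → adj G u w ≡ β u xor β w

  bipartite-edges : ∀ (G : Graph n) β → Bipartition β G → edges G ≡ size β * size (not ∘ β)
  bipartite-edges {zero}  G β bip = refl
  bipartite-edges {suc n} G β bip = trans
    (cong₂ _+_ (bipartite-edges (delete G zero) (β ∘ suc) (λ u w → bip (suc u) (suc w)))
      (sum-cong-≗ (λ j → cong (if_then 1 else 0) (bip zero (suc j)))))
    (go (β zero))
    where
    t = size (β ∘ suc)
    f = size (not ∘ β ∘ suc)
    go : ∀ b → t * f + size (λ j → b xor β (suc j)) ≡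
      ((if b then 1 else 0) + t) * ((if not b then 1 else 0) + f)
    go true  = ℕ.+-comm (t * f) f
    go false = trans (ℕ.+-comm (t * f) t) (sym (ℕ.*-suc t f))

  -- A bipartite graph has no triangles, so only pairs of edges count.
  bipartite-second : ∀ (G : Graph n) β → Bipartition β G → 2 * secondCoefficient G + edges G ≡ edges G * edges G
  bipartite-second {zero}  G β bip = refl
  bipartite-second {suc n} G β bip = begin
    2 * (secondCoefficient H + sum (λ j → if s j then edges (stars G zero j) else 0)) + (m + d)
      ≡⟨ cong (λ x → 2 * (secondCoefficient H + x) + (m + d)) stars-sum ⟩
    2 * (secondCoefficient H + (d * m + T)) + (m + d)
      ≡⟨ solve 4 (λ c m d T → con 2 :* (c :+ (d :* m :+ T)) :+ (m :+ d)
           := (con 2 :* c :+ m) :+ con 2 :* (d :* m) :+ (con 2 :* T :+ d)) refl (secondCoefficient H) m d T ⟩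
    (2 * secondCoefficient H + m) + 2 * (d * m) + (2 * T + d)
      ≡⟨ cong₂ (λ x y → x + 2 * (d * m) + y)
           (bipartite-second H (β ∘ suc) (λ u w → bip (suc u) (suc w))) (later-pairs s) ⟩
    m * m + 2 * (d * m) + d * d
      ≡⟨ solve 2 (λ m d → m :* m :+ con 2 :* (d :* m) :+ d :* d := (m :+ d) :* (m :+ d)) refl m d ⟩
    (m + d) * (m + d) ∎
    where
    open ≡.≡-Reasoning
    open +-*-Solver
    H = delete G zero
    s = neighbours G zero
    m = edges H
    d = size s
    T = sum (λ j → if s j then later s j else 0)
    same-side : ∀ a b c → a xor b ≡ true → a xor c ≡ true → b xor c ≡ false
    same-side true  false false _ _ = refl
    same-side false true  true  _ _ = refl
    -- Absence of triangles: neighbours of vertex 0 lie on one side, so every edge of a star is new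
    -- and H_j has exactly `later s j` more edges than H.
    independent : ∀ i j → s i ≡ true → s j ≡ true → adj H j i ≡ false
    independent i j sᵢ sⱼ = trans (bip (suc j) (suc i)) (same-side (β zero) (β (suc j)) (β (suc i))
      (trans (sym (bip zero (suc j))) sⱼ) (trans (sym (bip zero (suc i))) sᵢ))
    star-edges : ∀ j b → s j ≡ b → (if b then edges (stars G zero j) else 0) ≡
      (if b then 1 else 0) * m + (if b then later s j else 0)
    star-edges j false sⱼ = refl
    star-edges j true  sⱼ = trans (edges-addStar H s j (λ i _ sᵢ → independent i j sᵢ sⱼ))
      (cong (_+ later s j) (sym (ℕ.+-identityʳ m)))
    stars-sum : sum (λ j → if s j then edges (stars G zero j) else 0) ≡ d * m + T
    stars-sum = trans (sum-cong-≗ (λ j → star-edges j (s j) refl))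
      (trans (∑-distrib-+ (λ j → (if s j then 1 else 0) * m) (λ j → if s j then later s j else 0))
        (cong (_+ T) (sym (*-distribʳ-sum m (λ j → if s j then 1 else 0)))))

  alternating : ∀ {n} → Bool → Fin n → Bool
  alternating b zero    = b
  alternating b (suc i) = alternating (not b) i

  completeBipartite : ∀ n → Graph n
  completeBipartite n = record
    { adj         = λ u w → alternating true u xor alternating true w
    ; symmetric   = λ u w → Bool.xor-comm (alternating true u) (alternating true w)
    ; irreflexive = λ u → Bool.xor-same (alternating true u) }

  not-alternating : ∀ b (i : Fin n) → not (alternating b i) ≡ alternating (not b) i
  not-alternating b zero    = refl
  not-alternating b (suc i) = not-alternating (not b) i

  size-alternating : ∀ n → let t = size {n} (alternating true) ; f = size {n} (alternating false) in
    (t ≡ f ⊎ t ≡ suc f) × t + f ≡ n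
  size-alternating zero    = inj₁ refl , refl
  size-alternating (suc n) with size-alternating n
  ... | inj₁ t≡f , t+f≡n = inj₂ (cong suc (sym t≡f)) ,
        cong suc (trans (ℕ.+-comm (size {n} (alternating false)) _) t+f≡n)
  ... | inj₂ t≡1+f , t+f≡n = inj₁ (sym t≡1+f) ,
        cong suc (trans (ℕ.+-comm (size {n} (alternating false)) _) t+f≡n)

  edges-completeBipartite : ∀ n → n * n ℕ.≤ 4 * edges (completeBipartite n) + 1
  edges-completeBipartite n = ≡.subst (λ e → n * n ℕ.≤ 4 * e + 1) (sym count)
      (≡.subst (λ k → k * k ℕ.≤ 4 * (t * f) + 1) (proj₂ (size-alternating n))
        (balanced (proj₁ (size-alternating n))))
    where
    open +-*-Solver
    t = size {n} (alternating true)
    f = size {n} (alternating false)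
    count : edges (completeBipartite n) ≡ t * f
    count = trans (bipartite-edges (completeBipartite n) (alternating true) (λ u w → refl))
      (cong (t *_) (sum-cong-≗ {n} (λ j → cong (if_then 1 else 0) (not-alternating true j))))
    balanced : ∀ {t f} → t ≡ f ⊎ t ≡ suc f → (t + f) * (t + f) ℕ.≤ 4 * (t * f) + 1
    balanced {t} (inj₁ refl) = ℕ.≤-trans
      (ℕ.≤-reflexive (solve 1 (λ t → (t :+ t) :* (t :+ t) := con 4 :* (t :* t)) refl t))
      (ℕ.m≤m+n _ 1)
    balanced {_} {f} (inj₂ refl) = ℕ.≤-reflexive
      (solve 1 (λ f → (con 1 :+ f :+ f) :* (con 1 :+ f :+ f) := con 4 :* ((con 1 :+ f) :* f) :+ con 1) refl f)

  -- This is m²/n - m > n (n/8)², cleared of denominators. With y = 8m it reads n⁴ + 8 n y < y², a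
  -- consequence of y ≥ n² + 8n. The latter holds because y + 2 ≥ 2n² ≥ n² + 9n, which is where 9
  -- comes from.
  edges-large : ∀ n → 9 ℕ.≤ n → let m = edges (completeBipartite n) in
    n * n * (n * n) + 64 * (n * m) ℕ.< 64 * (m * m)
  edges-large n 9≤n = begin-strict
      n² * n² + 64 * (n * m)  ≡⟨ solve 3 (λ n² n m → n² :* n² :+ con 64 :* (n :* m)
                                   := n² :* n² :+ con 8 :* n :* (con 8 :* m)) refl n² n m ⟩
      n² * n² + 8 * n * y     <⟨ ℕ.+-monoˡ-< (8 * n * y) (ℕ.*-monoˡ-< n² {{ℕ.>-nonZero 0<n²}} n²<y) ⟩
      y * n² + 8 * n * y      ≡⟨ solve 3 (λ n² n y → y :* n² :+ con 8 :* n :* y := y :* (n² :+ con 8 :* n))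
                                refl n² n y ⟩
      y * (n² + 8 * n)        ≤⟨ ℕ.*-monoʳ-≤ y n²+8n≤y ⟩
      y * y                   ≡⟨ solve 1 (λ m → con 8 :* m :* (con 8 :* m) := con 64 :* (m :* m)) refl m ⟩
      64 * (m * m) ∎
    where
    open ℕ.≤-Reasoning
    open +-*-Solver
    n² = n * n
    m = edges (completeBipartite n)
    y = 8 * m
    0<n : 0 ℕ.< n
    0<n = ℕ.≤-trans (ℕ.s≤s ℕ.z≤n) 9≤n
    0<n² : 0 ℕ.< n²
    0<n² = ℕ.*-mono-< {0} {n} {0} {n} 0<n 0<n
    n²+8n≤y : n² + 8 * n ℕ.≤ y
    n²+8n≤y = ℕ.+-cancelʳ-≤ 2 (n² + 8 * n) y (begin
      n² + 8 * n + 2          ≤⟨ ℕ.+-monoʳ-≤ (n² + 8 * n) (ℕ.≤-trans (ℕ.s≤s (ℕ.s≤s ℕ.z≤n)) 9≤n) ⟩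
      n² + 8 * n + n          ≡⟨ solve 1 (λ n → n :* n :+ con 8 :* n :+ n := n :* n :+ con 9 :* n) refl n ⟩
      n² + 9 * n              ≤⟨ ℕ.+-monoʳ-≤ n² (ℕ.*-monoˡ-≤ n 9≤n) ⟩
      n² + n²                 ≤⟨ ℕ.+-mono-≤ (edges-completeBipartite n) (edges-completeBipartite n) ⟩
      4 * m + 1 + (4 * m + 1) ≡⟨ solve 1 (λ m → con 4 :* m :+ con 1 :+ (con 4 :* m :+ con 1) := con 8 :* m :+ con 2)
                                refl m ⟩
      y + 2 ∎)
    n²<y : n² ℕ.< y
    n²<y = ℕ.<-≤-trans (ℕ.m<m+n n² (ℕ.*-mono-< {0} {8} {0} {n} (ℕ.s≤s ℕ.z≤n) 0<n)) n²+8n≤y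

-- The chromatic polynomial over the complex numbers.

module ChromaticPolynomials (𝓡 : RealNumbers) (em : ExcludedMiddle 0ℓ) where

  open Factorisation 𝓡 em public
  open Counting
  open Solver
  open import Algebra.Properties.Semiring.Sum ℂ.semiring
    using () renaming (sum to sumᶜ; sum-cong-≋ to sumᶜ-cong)

  fromℕℚ-+ : ∀ m n → fromℕℚ (m ℕ.+ n) ≡ fromℕℚ m ℚ.+ fromℕℚ n
  fromℕℚ-+ zero    n = ≡.sym (ℚ.+-identityˡ (fromℕℚ n))
  fromℕℚ-+ (suc m) n = ≡.trans (≡.cong (1ℚ ℚ.+_) (fromℕℚ-+ m n)) (≡.sym (ℚ.+-assoc 1ℚ (fromℕℚ m) (fromℕℚ n)))

  fromℕℚ-* : ∀ m n → fromℕℚ (m ℕ.* n) ≡ fromℕℚ m ℚ.* fromℕℚ n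
  fromℕℚ-* zero    n = ≡.sym (ℚ.*-zeroˡ (fromℕℚ n))
  fromℕℚ-* (suc m) n = ≡.trans (fromℕℚ-+ n (m ℕ.* n)) (≡.trans
    (≡.cong₂ ℚ._+_ (≡.sym (ℚ.*-identityˡ (fromℕℚ n))) (fromℕℚ-* m n))
    (≡.sym (ℚ.*-distribʳ-+ (fromℕℚ n) 1ℚ (fromℕℚ m))))

  fromℕℚ-mono : ∀ {m n} → m ℕ.≤ n → fromℕℚ m ℚ.≤ fromℕℚ n
  fromℕℚ-mono {n = n} ℕ.z≤n = fromℕℚ-nonNeg n
  fromℕℚ-mono (ℕ.s≤s m≤n) = ℚ.+-monoʳ-≤ 1ℚ (fromℕℚ-mono m≤n)

  natᴿ : ℕ → Carrier
  natᴿ n = ι (fromℕℚ n)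

  natᴿ-+ : ∀ m n → natᴿ (m ℕ.+ n) ≈ natᴿ m + natᴿ n
  natᴿ-+ m n = ≈-trans (≈-reflexive (≡.cong ι (fromℕℚ-+ m n))) (ι-+ (fromℕℚ m) (fromℕℚ n))

  natᴿ-* : ∀ m n → natᴿ (m ℕ.* n) ≈ natᴿ m * natᴿ n
  natᴿ-* m n = ≈-trans (≈-reflexive (≡.cong ι (fromℕℚ-* m n))) (ι-* (fromℕℚ m) (fromℕℚ n))

  natᴿ-mono : ∀ {m n} → m ℕ.≤ n → natᴿ m ≤ natᴿ n
  natᴿ-mono m≤n = ι-mono-≤ (fromℕℚ-mono m≤n)

  natᴿ-nonNeg : ∀ n → 0# ≤ natᴿ n
  natᴿ-nonNeg n = ι-nonNeg (fromℕℚ-nonNeg n)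

  nat : ℕ → Cx
  nat n = real (natᴿ n)

  nat-+ : ∀ m n → nat (m ℕ.+ n) ≋ nat m ⊕ nat n
  nat-+ m n = ≋-trans (real-cong (natᴿ-+ m n)) (real-+ _ _)

  nat-* : ∀ m n → nat (m ℕ.* n) ≋ nat m ⊗ nat n
  nat-* m n = ≋-trans (real-cong (natᴿ-* m n)) (real-* _ _)

  nat-0 : nat 0 ≋ 𝟘
  nat-0 = real-cong ι-0

  nat-1 : nat 1 ≋ 𝟙
  nat-1 = real-cong (≈-trans (≈-reflexive (≡.cong ι (ℚ.+-identityʳ 1ℚ))) ι-1)

  nat-sum : ∀ {n} (f : Fin n → ℕ) → nat (sum f) ≋ sumᶜ (λ j → nat (f j))
  nat-sum {zero}  f = nat-0
  nat-sum {suc n} f = ≋-trans (nat-+ (f zero) _) (⊕-cong ≋-refl (nat-sum (λ j → f (suc j))))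

  nat-if : ∀ b {m z} → nat m ≋ z → nat (if b then m else 0) ≋ (if b then z else 𝟘)
  nat-if true  eq = eq
  nat-if false eq = nat-0

  if-cong : ∀ b {z w} → z ≋ w → (if b then z else 𝟘) ≋ (if b then w else 𝟘)
  if-cong true  eq = eq
  if-cong false eq = ≋-refl

  ⊝𝟘≋𝟘 : ⊝ 𝟘 ≋ 𝟘
  ⊝𝟘≋𝟘 = ≋-trans (≋-sym (ℂ.+-identityʳ _)) (⊝-inverseˡ 𝟘)

  subtractAll : ∀ {m n} → Vec Cx n → (Fin m → Bool) → (Fin m → Vec Cx n) → Vec Cx n
  subtractAll {zero}  p s q = p
  subtractAll {suc m} p s q = subtractAll
    (if s zero then Vec.zipWith _⊖_ p (q zero) else p) (λ j → s (suc j)) (λ j → q (suc j))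

  -- Serves evaluation at a point as well as the two coefficients: each is an affine map A of
  -- coefficient vectors with linear part L. For evaluation of monic polynomials, A starts Horner's
  -- scheme at 𝟙 and L at 𝟘.
  subtractAll-affine : ∀ {m n} (A L : Vec Cx n → Cx) →
    (∀ p q → A (Vec.zipWith _⊖_ p q) ≋ A p ⊖ L q) →
    ∀ p (s : Fin m → Bool) q →
    A (subtractAll p s q) ≋ A p ⊖ sumᶜ (λ j → if s j then L (q j) else 𝟘)
  subtractAll-affine {zero} A L affine p s q =
    ≋-sym (≋-trans (⊕-cong ≋-refl ⊝𝟘≋𝟘) (ℂ.+-identityʳ (A p)))
  subtractAll-affine {suc m} A L affine p s q = ≋-trans (first (s zero)) collect
    where
    rest = sumᶜ (λ j → if s (suc j) then L (q (suc j)) else 𝟘)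
    first : ∀ b → A (subtractAll (if b then Vec.zipWith _⊖_ p (q zero) else p) (λ j → s (suc j)) (λ j → q (suc j)))
      ≋ A p ⊖ (if b then L (q zero) else 𝟘) ⊖ rest
    first true  = ≋-trans (subtractAll-affine A L affine _ (λ j → s (suc j)) (λ j → q (suc j)))
      (⊕-cong (affine p (q zero)) ≋-refl)
    first false = ≋-trans (subtractAll-affine A L affine p (λ j → s (suc j)) (λ j → q (suc j)))
      (⊕-cong (≋-sym (≋-trans (⊕-cong ≋-refl ⊝𝟘≋𝟘) (ℂ.+-identityʳ (A p)))) ≋-refl)
    collect : A p ⊖ (if s zero then L (q zero) else 𝟘) ⊖ rest ≋ A p ⊖ ((if s zero then L (q zero) else 𝟘) ⊕ rest)
    collect = solveᶜ 3 (λ a x y → a :⊖ x :⊖ y :≋ a :⊖ (x :⊕ y)) ≋-refl (A p) (if s zero then L (q zero) else 𝟘) rest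

  -- The vertex recurrence at vertex 0. Appending 𝟘 multiplies by x; prefixing 𝟙 makes the leading
  -- coefficient of P_{H_j} explicit, its degree being one lower.
  χ : ∀ {n} → Graph n → Vec Cx n
  χ {zero}  G = []
  χ {suc n} G = subtractAll (χ (delete G zero) ∷ʳ 𝟘) (neighbours G zero) (λ j → 𝟙 ∷ χ (stars G zero j))

  P : ∀ {n} → Graph n → Cx → Cx
  P G = monic (χ G)

  horner-zipWith : ∀ {n} c d (p q : Vec Cx n) x →
    horner (c ⊖ d) (Vec.zipWith _⊖_ p q) x ≋ horner c p x ⊖ horner d q x
  horner-zipWith c d []      []      x = ≋-refl
  horner-zipWith c d (a ∷ p) (b ∷ q) x = ≋-trans
    (horner-cong (solveᶜ 5 (λ c d a b x → (c :⊖ d) :⊗ x :⊕ (a :⊖ b) :≋ (c :⊗ x :⊕ a) :⊖ (d :⊗ x :⊕ b))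
      ≋-refl c d a b x) (Vec.zipWith _⊖_ p q) x)
    (horner-zipWith (c ⊗ x ⊕ a) (d ⊗ x ⊕ b) p q x)

  horner-∷ʳ : ∀ {n} c (p : Vec Cx n) x → horner c (p ∷ʳ 𝟘) x ≋ x ⊗ horner c p x
  horner-∷ʳ c []      x = ≋-trans (ℂ.+-identityʳ _) (⊗-comm c x)
  horner-∷ʳ c (a ∷ p) x = horner-∷ʳ (c ⊗ x ⊕ a) p x

  private
    starSum : ∀ {n} (G : Graph (suc n)) (v : Fin (suc n)) → Cx → Cx
    starSum G v x = sumᶜ (λ j → if neighbours G v j then P (stars G v j) x else 𝟘)

  P-suc : ∀ {n} (G : Graph (suc n)) x →
    P G x ≋ x ⊗ P (delete G zero) x ⊖ starSum G zero x
  P-suc G x = ≋-trans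
    (subtractAll-affine (λ p → horner 𝟙 p x) (λ q → horner 𝟘 q x) affine
      (χ (delete G zero) ∷ʳ 𝟘) (neighbours G zero) (λ j → 𝟙 ∷ χ (stars G zero j)))
    (⊕-cong (horner-∷ʳ 𝟙 (χ (delete G zero)) x) (⊝-cong (sumᶜ-cong (λ j → if-cong (neighbours G zero j)
      (horner-cong (≋-trans (⊕-cong (ℂ.zeroˡ x) ≋-refl) (⊕-identityˡ 𝟙)) (χ (stars G zero j)) x)))))
    where
    affine : ∀ p q → horner 𝟙 (Vec.zipWith _⊖_ p q) x ≋ horner 𝟙 p x ⊖ horner 𝟘 q x
    affine p q = ≋-trans (horner-cong (≋-sym (≋-trans (⊕-cong ≋-refl ⊝𝟘≋𝟘) (ℂ.+-identityʳ 𝟙)))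
        (Vec.zipWith _⊖_ p q) x)
      (horner-zipWith 𝟙 𝟘 p q x)

  nat-π-recurrence : ∀ {n} (G : Graph (suc n)) v k → nat (π G k) ≋
    nat k ⊗ nat (π (delete G v) k) ⊖ sumᶜ (λ j → if neighbours G v j then nat (π (stars G v j) k) else 𝟘)
  nat-π-recurrence G v k = ≋-trans
    (solveᶜ 2 (λ a b → a :≋ (a :⊕ b) :⊖ b) ≋-refl (nat (π G k)) S)
    (⊕-cong (≋-trans (≋-trans (⊕-cong ≋-refl S≋) (≋-sym (nat-+ (π G k) s)))
      (≋-trans (ℂ.reflexive (≡.cong nat (π-recurrence G v k)))
        (≋-trans (nat-* (π (delete G v) k) k) (⊗-comm _ _)))) ≋-refl)
    where
    s = sum (λ j → if neighbours G v j then π (stars G v j) k else 0)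
    S = sumᶜ (λ j → if neighbours G v j then nat (π (stars G v j) k) else 𝟘)
    S≋ : S ≋ nat s
    S≋ = ≋-sym (≋-trans (nat-sum (λ j → if neighbours G v j then π (stars G v j) k else 0))
      (sumᶜ-cong (λ j → nat-if (neighbours G v j) ≋-refl)))

  P-nat : ∀ {n} (G : Graph n) k → P G (nat k) ≋ nat (π G k)
  P-nat {zero}  G k = ≋-sym (≋-trans (ℂ.reflexive (≡.cong nat (π-order-zero G k))) nat-1)
  P-nat {suc n} G k = ≋-trans (P-suc G (nat k)) (≋-trans
    (⊕-cong (⊗-cong ≋-refl (P-nat (delete G zero) k)) (⊝-cong (sumᶜ-cong (λ j →
      if-cong (neighbours G zero j) (P-nat (stars G zero j) k)))))
    (≋-sym (nat-π-recurrence G zero k)))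

  IsPolynomial : (Cx → Cx) → Set
  IsPolynomial f = ∃[ p ] (∀ x → f x ≋ evaluate p x)

  addPolynomials : List Cx → List Cx → List Cx
  addPolynomials []      q       = q
  addPolynomials (a ∷ p) []      = a ∷ p
  addPolynomials (a ∷ p) (b ∷ q) = (a ⊕ b) ∷ addPolynomials p q

  evaluate-add : ∀ p q x → evaluate (addPolynomials p q) x ≋ evaluate p x ⊕ evaluate q x
  evaluate-add []      q       x = ≋-sym (⊕-identityˡ _)
  evaluate-add (a ∷ p) []      x = ≋-sym (ℂ.+-identityʳ _)
  evaluate-add (a ∷ p) (b ∷ q) x = ≋-trans (⊕-cong ≋-refl (⊗-cong ≋-refl (evaluate-add p q x)))
    (solveᶜ 5 (λ a b x p q → (a :⊕ b) :⊕ x :⊗ (p :⊕ q) :≋ (a :⊕ x :⊗ p) :⊕ (b :⊕ x :⊗ q))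
      ≋-refl a b x (evaluate p x) (evaluate q x))

  evaluate-neg : ∀ p x → evaluate (List.map ⊝_ p) x ≋ ⊝ evaluate p x
  evaluate-neg []      x = ≋-sym ⊝𝟘≋𝟘
  evaluate-neg (a ∷ p) x = ≋-trans (⊕-cong ≋-refl (⊗-cong ≋-refl (evaluate-neg p x)))
    (solveᶜ 3 (λ a x p → :⊝ a :⊕ x :⊗ :⊝ p :≋ :⊝ (a :⊕ x :⊗ p)) ≋-refl a x (evaluate p x))

  ⊖-polynomial : ∀ {f g} → IsPolynomial f → IsPolynomial g → IsPolynomial (λ x → f x ⊖ g x)
  ⊖-polynomial (p , f≋p) (q , g≋q) = addPolynomials p (List.map ⊝_ q) , λ x →
    ≋-trans (⊕-cong (f≋p x) (≋-trans (⊝-cong (g≋q x)) (≋-sym (evaluate-neg q x))))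
      (≋-sym (evaluate-add p (List.map ⊝_ q) x))

  x⊗-polynomial : ∀ {f} → IsPolynomial f → IsPolynomial (λ x → x ⊗ f x)
  x⊗-polynomial (p , f≋p) = 𝟘 ∷ p , λ x → ≋-trans (⊗-cong ≋-refl (f≋p x)) (≋-sym (⊕-identityˡ _))

  sum-polynomial : ∀ {n} (f : Fin n → Cx → Cx) → (∀ j → IsPolynomial (f j)) →
    IsPolynomial (λ x → sumᶜ (λ j → f j x))
  sum-polynomial {zero}  f poly = [] , λ x → ≋-refl
  sum-polynomial {suc n} f poly =
    let p , f≋p = poly zero
        q , g≋q = sum-polynomial (λ j → f (suc j)) (λ j → poly (suc j))
    in addPolynomials p q , λ x → ≋-trans (⊕-cong (f≋p x) (g≋q x)) (≋-sym (evaluate-add p q x))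

  if-polynomial : ∀ b {f} → IsPolynomial f → IsPolynomial (λ x → if b then f x else 𝟘)
  if-polynomial true  poly = poly
  if-polynomial false poly = [] , λ x → ≋-refl

  monicPolynomial : ∀ {n} → Vec Cx n → List Cx
  monicPolynomial = ascending (𝟙 ∷ [])

  evaluate-monicPolynomial : ∀ {n} (p : Vec Cx n) x → evaluate (monicPolynomial p) x ≋ monic p x
  evaluate-monicPolynomial p x = ≋-trans (evaluate-ascending (𝟙 ∷ []) p x)
    (horner-cong (≋-trans (⊕-cong ≋-refl (ℂ.zeroʳ x)) (ℂ.+-identityʳ 𝟙)) p x)

  P-polynomial : ∀ {n} (G : Graph n) → IsPolynomial (P G)
  P-polynomial G = monicPolynomial (χ G) , λ x → ≋-sym (evaluate-monicPolynomial (χ G) x)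

  determined-by-naturals : ∀ {f g} → IsPolynomial f → IsPolynomial g →
    (∀ k → f (nat k) ≋ g (nat k)) → ∀ z → f z ≋ g z
  determined-by-naturals {f} {g} poly-f poly-g agree z =
    let p , f-g≋p = ⊖-polynomial {f} {g} poly-f poly-g
        p≋0 = identityTheorem p (λ k → ≋-trans (≋-sym (f-g≋p (nat k)))
          (≋-trans (⊕-cong (agree k) ≋-refl) (ℂ.-‿inverseʳ _)))
    in ≋-trans (solveᶜ 2 (λ f g → f :≋ g :⊕ (f :⊖ g)) ≋-refl (f z) (g z))
         (≋-trans (⊕-cong ≋-refl (≋-trans (f-g≋p z) (evaluate-Zero {p} p≋0 z))) (ℂ.+-identityʳ (g z)))

  P-cong : ∀ {n} {G G′ : Graph n} → (∀ u v → adj G u v ≡ adj G′ u v) → ∀ z → P G z ≋ P G′ z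
  P-cong {G = G} {G′} G≗G′ = determined-by-naturals {P G} {P G′} (P-polynomial G) (P-polynomial G′) λ k →
    ≋-trans (P-nat G k) (≋-trans (ℂ.reflexive (≡.cong nat (π-cong {G = G} {G′} G≗G′ k))) (≋-sym (P-nat G′ k)))

  -- By construction this is known for v = 0 only. For other v it holds at the natural numbers, by
  -- counting, and extends by the identity theorem. The upper bound needs it at the centre j of a
  -- star.
  P-recurrence : ∀ {n} (G : Graph (suc n)) v z →
    P G z ≋ z ⊗ P (delete G v) z ⊖ starSum G v z
  P-recurrence {n} G v = determined-by-naturals {P G} {λ z → z ⊗ P (delete G v) z ⊖ starSum G v z}
    (P-polynomial G)
    (⊖-polynomial {λ z → z ⊗ P (delete G v) z} {starSum G v}
      (x⊗-polynomial {P (delete G v)} (P-polynomial (delete G v)))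
      (sum-polynomial (λ j x → if neighbours G v j then P (stars G v j) x else 𝟘)
        (λ j → if-polynomial (neighbours G v j) {P (stars G v j)} (P-polynomial (stars G v j)))))
    λ k → ≋-trans (P-nat G k) (≋-trans (nat-π-recurrence G v k)
      (≋-sym (⊕-cong (⊗-cong ≋-refl (P-nat (delete G v) k)) (⊝-cong (sumᶜ-cong (λ j →
        if-cong (neighbours G v j) (P-nat (stars G v j) k)))))))

-- The upper bound: no roots of modulus above 8n.

module UpperBound (𝓡 : RealNumbers) (em : ExcludedMiddle 0ℓ) where

  open import Data.Integer using (+_)
  open ChromaticPolynomials 𝓡 em public
  open Counting
  open Edges
  open Solver
  open import Algebra.Properties.Semiring.Sum ℂ.semiring
    using () renaming (sum to sumᶜ; sum-cong-≋ to sumᶜ-cong)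

  4ℚ 8ℚ 16ℚ 64ℚ : ℚ
  4ℚ  = + 4 ℚ./ 1
  8ℚ  = + 8 ℚ./ 1
  16ℚ = + 16 ℚ./ 1
  64ℚ = + 64 ℚ./ 1

  natᴿ-suc : ∀ n → natᴿ (suc n) ≈ 1# + natᴿ n
  natᴿ-suc n = ≈-trans (ι-+ 1ℚ (fromℕℚ n)) (+-congʳ ι-1)

  natᴿ-pos : ∀ n → 0# < natᴿ (suc n)
  natᴿ-pos n = <-≤-trans 0<1 (≤-by (natᴿ-nonNeg n) (≈-sym (natᴿ-suc n)))

  -- With m = n + 1, the inequality 2⟨a, b⟩ ≤ N a + N b is applied to S and m y, whose bounds are
  -- equal; after cancelling m the cross term is at most 2 m M. Cancelling requires m > 0, hence the
  -- shifted index.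
  N-add-term : ∀ n {y S M} → N S ≤ natᴿ (suc n) * natᴿ (suc n) * M → N y ≤ M →
    N (y ⊕ S) ≤ natᴿ (suc (suc n)) * natᴿ (suc (suc n)) * M
  N-add-term n {y} {S} {M} NS≤ Ny≤ = ≤-respˡ (N-cong (⊕-comm S y)) (≤-respˡ (≈-sym (N-expand S y))
    (≤-trans (+-mono-≤ (+-mono-≤ NS≤ 2⟨S,y⟩≤) Ny≤)
      (≤-reflexive (≈-trans (solve 2 (λ m M → m :* m :* M :+ con 2ℚ :* (m :* M) :+ M
          := (con 1ℚ :+ m) :* (con 1ℚ :+ m) :* M) ≈-refl m M)
        (*-congʳ (*-cong m+1 m+1))))))
    where
    m = natᴿ (suc n)
    0≤m = natᴿ-nonNeg (suc n)
    m+1 : ι 1ℚ + m ≈ natᴿ (suc (suc n))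
    m+1 = ≈-sym (ι-+ 1ℚ (fromℕℚ (suc n)))
    2⟨S,y⟩≤ : ι 2ℚ * ⟨ S , y ⟩ ≤ ι 2ℚ * (m * M)
    2⟨S,y⟩≤ = *-cancelˡ-≤ (natᴿ-pos n) (≤-trans
      (≤-reflexive (≈-trans (solve 2 (λ m p → m :* (con 2ℚ :* p) := con 2ℚ :* (m :* p)) ≈-refl m ⟨ S , y ⟩)
        (*-congˡ (≈-sym (⟨⟩-real m S y)))))
      (≤-trans (2⟨⟩≤ S (real m ⊗ y)) (≤-trans
        (+-mono-≤ NS≤ (≤-respˡ (≈-sym (N-real-⊗ m y)) (*-monoˡ-≤ (*-nonNeg 0≤m 0≤m) Ny≤)))
        (≤-reflexive (solve 2 (λ m M → m :* m :* M :+ m :* m :* M := m :* (con 2ℚ :* (m :* M))) ≈-refl m M)))))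

  N-sum : ∀ {n} (x : Fin n → Cx) {M} → 0# ≤ M → (∀ j → N (x j) ≤ M) → N (sumᶜ x) ≤ natᴿ n * natᴿ n * M
  N-sum {zero} x 0≤M x≤M = ≤-respˡ (≈-sym N-𝟘) (*-nonNeg (*-nonNeg (natᴿ-nonNeg 0) (natᴿ-nonNeg 0)) 0≤M)
  N-sum {suc zero} x {M} 0≤M x≤M = ≤-respˡ (N-cong (≋-sym (ℂ.+-identityʳ (x zero))))
    (≤-respʳ (≈-sym (≈-trans (*-congʳ (*-cong one one)) (≈-trans (*-congʳ (*-identityˡ 1#)) (*-identityˡ M))))
      (x≤M zero))
    where
    one : natᴿ 1 ≈ 1#
    one = ≈-trans (natᴿ-suc 0) (≈-trans (+-congˡ ι-0) (+-identityʳ 1#))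
  N-sum {suc (suc n)} x 0≤M x≤M =
    N-add-term n (N-sum {suc n} (λ j → x (suc j)) 0≤M (λ j → x≤M (suc j))) (x≤M zero)

  0≤4 : 0# ≤ ι 4ℚ
  0≤4 = ι-nonNeg (ℚ.<⇒≤ (ℚ.positive⁻¹ 4ℚ))

  0≤16 : 0# ≤ ι 16ℚ
  0≤16 = ι-nonNeg (ℚ.<⇒≤ (ℚ.positive⁻¹ 16ℚ))

  -- Adding a star at j changes N P by a factor of at most 16, since the graph
  -- without j remains the same.
  module _ (n₀ : ℕ) (q : Cx) (large : ι 64ℚ * (natᴿ n₀ * natᴿ n₀) ≤ N q) where

    Q : Carrier
    Q = N q

    Comparable : Carrier → Carrier → Set
    Comparable x y = (Q * y ≤ ι 4ℚ * x) × (x ≤ ι 4ℚ * (Q * y))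

    -- As 64 = 4 · 16, the size of q gives 4 N S ≤ Y for Y = N q N y. The two parallelogram bounds
    -- then read 2Y ≤ 4 N x + Y and 2 N x ≤ 4Y + Y ≤ 8Y.
    compare-step : ∀ {x y S n} → n ℕ.≤ n₀ → x ≋ q ⊗ y ⊖ S →
      N S ≤ natᴿ n * natᴿ n * (ι 16ℚ * N y) → Comparable (N x) (N y)
    compare-step {x} {y} {S} {n} n≤n₀ x≋ NS≤ =
      ≤-by (difference (≤-trans lower (+-monoʳ-≤ _ 4NS≤))) (
        solve 2 (λ Qy x → Qy :+ ((con 2ℚ :* (con 2ℚ :* x) :+ Qy) :- con 2ℚ :* Qy) := con 4ℚ :* x)
          ≈-refl (Q * N y) (N x)) ,
      *-cancelˡ-≤ {ι 2ℚ} (ι-pos (ℚ.positive⁻¹ 2ℚ)) (≤-trans upper (≤-trans (+-monoʳ-≤ _ 4NS≤)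
        (≤-by (*-nonNeg (ι-nonNeg (ℚ.<⇒≤ (ℚ.positive⁻¹ 3ℚ))) 0≤Qy)
          (solve 1 (λ Qy → con 2ℚ :* (con 2ℚ :* Qy) :+ Qy :+ con 3ℚ :* Qy
            := con 2ℚ :* (con 4ℚ :* Qy)) ≈-refl (Q * N y)))))
      where
      3ℚ : ℚ
      3ℚ = + 3 ℚ./ 1
      m = natᴿ n
      0≤Qy : 0# ≤ Q * N y
      0≤Qy = *-nonNeg (N-nonNeg q) (N-nonNeg y)
      64m²≤Q : ι 64ℚ * (m * m) ≤ Q
      64m²≤Q = ≤-trans (*-monoˡ-≤ (ι-nonNeg (ℚ.<⇒≤ (ℚ.positive⁻¹ 64ℚ)))
        (*-mono-≤ (natᴿ-nonNeg n) (natᴿ-nonNeg n₀) (natᴿ-mono n≤n₀) (natᴿ-mono n≤n₀))) large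
      4NS≤ : ι 2ℚ * (ι 2ℚ * N S) ≤ Q * N y
      4NS≤ = ≤-trans (*-monoˡ-≤ 0≤2 (*-monoˡ-≤ 0≤2 NS≤))
        (≤-respˡ (solve 2 (λ m y → y :* (con 64ℚ :* (m :* m)) := con 2ℚ :* (con 2ℚ :* (m :* m :* (con 16ℚ :* y))))
          ≈-refl m (N y))
          (≤-respʳ (*-comm (N y) Q) (*-monoˡ-≤ (N-nonNeg y) 64m²≤Q)))
      lower : ι 2ℚ * (Q * N y) ≤ ι 2ℚ * (ι 2ℚ * N x) + ι 2ℚ * (ι 2ℚ * N S)
      lower = ≤-respʳ (distribˡ _ _ _) (*-monoˡ-≤ 0≤2 (≤-respˡ (N-⊗ q y) (≤-respˡ
        (N-cong (≋-trans (⊕-cong x≋ ≋-refl) (solveᶜ 2 (λ a s → a :⊖ s :⊕ s :≋ a) ≋-refl (q ⊗ y) S)))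
        (N-⊕ x S))))
      upper : ι 2ℚ * N x ≤ ι 2ℚ * (ι 2ℚ * (Q * N y)) + ι 2ℚ * (ι 2ℚ * N S)
      upper = ≤-respʳ (distribˡ _ _ _) (*-monoˡ-≤ 0≤2 (≤-respˡ (N-cong (≋-sym x≋))
        (≤-respʳ (+-cong (*-congˡ (N-⊗ q y)) (*-congˡ (N-⊝ S))) (N-⊕ (q ⊗ y) (⊝ S)))))

    -- Induction on the order, over all graphs and all v at once: the bound on P_{H_j} uses the
    -- comparison for H_j and for H, both at j and both of smaller order than G.
    compare : ∀ {n} (G : Graph (suc n)) → suc n ℕ.≤ n₀ → ∀ v → Comparable (N (P G q)) (N (P (delete G v) q))
    compare {n} G n<n₀ v = compare-step {S = sumᶜ term} {n = n} (ℕ.<⇒≤ n<n₀) (P-recurrence G v q)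
      (N-sum term (*-nonNeg 0≤16 (N-nonNeg _)) (λ j → bound j (neighbours G v j)))
      where
      H = delete G v
      term : Fin n → Cx
      term j = if neighbours G v j then P (stars G v j) q else 𝟘
      star-bound : ∀ {n} (H : Graph n) → n ℕ.≤ n₀ → ∀ s j →
        N (P (addStar H s j) q) ≤ ι 16ℚ * N (P H q)
      star-bound {suc n} H n≤n₀ s j = ≤-trans (proj₂ (compare (addStar H s j) n≤n₀ j))
        (≤-trans (*-monoˡ-≤ 0≤4 (≤-respˡ (*-congˡ (N-cong
            (P-cong {G = delete H j} {delete (addStar H s j) j} (λ u w → ≡.sym (delete-addStar H s j u w)) q)))
          (proj₁ (compare H n≤n₀ j))))
        (≤-reflexive (solve 1 (λ x → con 4ℚ :* (con 4ℚ :* x) := con 16ℚ :* x) ≈-refl (N (P H q)))))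
      bound : ∀ j b → N (if b then P (stars G v j) q else 𝟘) ≤ ι 16ℚ * N (P H q)
      bound j true  = star-bound H (ℕ.<⇒≤ n<n₀) (neighbours G v) j
      bound j false = ≤-respˡ (≈-sym N-𝟘) (*-nonNeg 0≤16 (N-nonNeg _))

    P-nonzero : 0# < Q → ∀ {n} (G : Graph n) → n ℕ.≤ n₀ → 0# < N (P G q)
    P-nonzero 0<Q {zero}  G n≤n₀ = <-≤-trans 0<1 (≤-reflexive (≈-sym N-𝟙))
    P-nonzero 0<Q {suc n} G n≤n₀ = positive-product⇒positive 0≤4 (<-≤-trans
      (pos-*-pos 0<Q (P-nonzero 0<Q (delete G zero) (ℕ.<⇒≤ n≤n₀))) (proj₁ (compare G n≤n₀ zero)))

  ι8*ι8 : ∀ x → ι 64ℚ * (x * x) ≈ (ι 8ℚ * x) * (ι 8ℚ * x)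
  ι8*ι8 = solve 1 (λ x → con 64ℚ :* (x :* x) := (con 8ℚ :* x) :* (con 8ℚ :* x)) ≈-refl

  root-bound : ∀ {n} (G : Graph n) z → P G z ≋ 𝟘 → im z ≤ ι 8ℚ * natᴿ n
  root-bound {n} G z Pz≋0 = ≮⇒≥ λ 8n<im →
    let 0≤8n = *-nonNeg (ι-nonNeg (ℚ.<⇒≤ (ℚ.positive⁻¹ 8ℚ))) (natᴿ-nonNeg n)
        0<im = ≤-<-trans 0≤8n 8n<im
        0<N  = <-≤-trans (pos-*-pos 0<im 0<im) (im²≤N z)
        large = ≤-trans (≤-reflexive (ι8*ι8 (natᴿ n)))
          (≤-trans (*-mono-≤ 0≤8n (<⇒≤ 0<im) (<⇒≤ 8n<im) (<⇒≤ 8n<im)) (im²≤N z))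
    in P-nonzero n z large 0<N G ℕ.≤-refl (≤-reflexive (≈-trans (N-cong Pz≋0) N-𝟘))

-- The lower bound from balanced complete bipartite graphs.

module LowerBound (𝓡 : RealNumbers) (em : ExcludedMiddle 0ℓ) where

  open UpperBound 𝓡 em public
  open Counting
  open Edges
  open Solver
  open import Algebra.Properties.Semiring.Sum ℂ.semiring
    using () renaming (sum to sumᶜ; sum-cong-≋ to sumᶜ-cong)

  coeff₁-zipWith : ∀ {n} (p q : Vec Cx n) → coeff₁ (Vec.zipWith _⊖_ p q) ≋ coeff₁ p ⊖ coeff₁ q
  coeff₁-zipWith []      []      = ≋-sym (ℂ.-‿inverseʳ 𝟘)
  coeff₁-zipWith (_ ∷ _) (_ ∷ _) = ≋-refl

  coeff₂-zipWith : ∀ {n} (p q : Vec Cx n) → coeff₂ (Vec.zipWith _⊖_ p q) ≋ coeff₂ p ⊖ coeff₂ q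
  coeff₂-zipWith []          []          = ≋-sym (ℂ.-‿inverseʳ 𝟘)
  coeff₂-zipWith (_ ∷ [])    (_ ∷ [])    = ≋-sym (ℂ.-‿inverseʳ 𝟘)
  coeff₂-zipWith (_ ∷ _ ∷ _) (_ ∷ _ ∷ _) = ≋-refl

  coeff₁-∷ʳ : ∀ {n} (p : Vec Cx n) → coeff₁ (p ∷ʳ 𝟘) ≋ coeff₁ p
  coeff₁-∷ʳ []      = ≋-refl
  coeff₁-∷ʳ (_ ∷ _) = ≋-refl

  coeff₂-∷ʳ : ∀ {n} (p : Vec Cx n) → coeff₂ (p ∷ʳ 𝟘) ≋ coeff₂ p
  coeff₂-∷ʳ []          = ≋-refl
  coeff₂-∷ʳ (_ ∷ [])    = ≋-refl
  coeff₂-∷ʳ (_ ∷ _ ∷ _) = ≋-refl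

  coeff₂-∷ : ∀ {n} a (p : Vec Cx n) → coeff₂ (a ∷ p) ≋ coeff₁ p
  coeff₂-∷ a []      = ≋-refl
  coeff₂-∷ a (_ ∷ _) = ≋-refl

  coeff₁-χ : ∀ {n} (G : Graph n) → coeff₁ (χ G) ≋ ⊝ nat (edges G)
  coeff₁-χ {zero}  G = ≋-sym (≋-trans (⊝-cong nat-0) ⊝𝟘≋𝟘)
  coeff₁-χ {suc n} G = ≋-trans
    (subtractAll-affine coeff₁ coeff₁ coeff₁-zipWith (χ H ∷ʳ 𝟘) s (λ j → 𝟙 ∷ χ (stars G zero j)))
    (≋-trans (⊕-cong (≋-trans (coeff₁-∷ʳ (χ H)) (coeff₁-χ H)) (⊝-cong (≋-sym d≋)))
      (≋-trans (solveᶜ 2 (λ m d → :⊝ m :⊖ d :≋ :⊝ (m :⊕ d)) ≋-refl (nat (edges H)) (nat (size s)))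
        (⊝-cong (≋-sym (nat-+ (edges H) (size s))))))
    where
    H = delete G zero
    s = neighbours G zero
    d≋ : nat (size s) ≋ sumᶜ (λ j → if s j then 𝟙 else 𝟘)
    d≋ = ≋-trans (nat-sum (λ j → if s j then 1 else 0)) (sumᶜ-cong (λ j → nat-if (s j) nat-1))

  sumᶜ-⊝ : ∀ {n} (x : Fin n → Cx) → sumᶜ (λ j → ⊝ x j) ≋ ⊝ sumᶜ x
  sumᶜ-⊝ {zero}  x = ≋-sym ⊝𝟘≋𝟘
  sumᶜ-⊝ {suc n} x = ≋-trans (⊕-cong ≋-refl (sumᶜ-⊝ (λ j → x (suc j))))
    (solveᶜ 2 (λ a b → :⊝ a :⊕ :⊝ b :≋ :⊝ (a :⊕ b)) ≋-refl (x zero) (sumᶜ (λ j → x (suc j))))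

  if-⊝ : ∀ b {z w} → z ≋ ⊝ w → (if b then z else 𝟘) ≋ ⊝ (if b then w else 𝟘)
  if-⊝ true  eq = eq
  if-⊝ false eq = ≋-sym ⊝𝟘≋𝟘

  coeff₂-χ : ∀ {n} (G : Graph n) → coeff₂ (χ G) ≋ nat (secondCoefficient G)
  coeff₂-χ {zero}  G = ≋-sym nat-0
  coeff₂-χ {suc n} G = ≋-trans
    (subtractAll-affine coeff₂ coeff₂ coeff₂-zipWith (χ H ∷ʳ 𝟘) s (λ j → 𝟙 ∷ χ (stars G zero j)))
    (≋-trans (⊕-cong (≋-trans (coeff₂-∷ʳ (χ H)) (coeff₂-χ H)) (⊝-cong sum≋))
      (≋-trans (solveᶜ 2 (λ c e → c :⊖ :⊝ e :≋ c :⊕ e) ≋-refl (nat (secondCoefficient H)) (nat E))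
        (≋-sym (nat-+ (secondCoefficient H) E))))
    where
    H = delete G zero
    s = neighbours G zero
    E = sum (λ j → if s j then edges (stars G zero j) else 0)
    sum≋ : sumᶜ (λ j → if s j then coeff₂ (𝟙 ∷ χ (stars G zero j)) else 𝟘) ≋ ⊝ nat E
    sum≋ = ≋-trans
      (sumᶜ-cong (λ j → if-⊝ (s j) (≋-trans (coeff₂-∷ 𝟙 (χ (stars G zero j))) (coeff₁-χ (stars G zero j)))))
      (≋-trans (sumᶜ-⊝ (λ j → if s j then nat (edges (stars G zero j)) else 𝟘))
        (⊝-cong (≋-sym (≋-trans (nat-sum (λ j → if s j then edges (stars G zero j) else 0))
          (sumᶜ-cong (λ j → nat-if (s j) ≋-refl))))))

  sumBy : ∀ {n} → (Cx → Carrier) → Vec Cx n → Carrier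
  sumBy f []       = 0#
  sumBy f (z ∷ zs) = f z + sumBy f zs

  re² im² : Cx → Carrier
  re² z = re z * re z
  im² z = im z * im z

  re-sumRoots : ∀ {n} (zs : Vec Cx n) → re (sumRoots zs) ≈ sumBy re zs
  re-sumRoots []       = re-real 0#
  re-sumRoots (z ∷ zs) = ≈-trans (re-⊕ z (sumRoots zs)) (+-congˡ (re-sumRoots zs))

  re-sumSquares : ∀ {n} (zs : Vec Cx n) → re (sumSquares zs) ≈ sumBy re² zs - sumBy im² zs
  re-sumSquares []       = ≈-trans (re-real 0#) (≈-sym (-‿inverseʳ 0#))
  re-sumSquares (z ∷ zs) = ≈-trans (re-⊕ (z ⊗ z) (sumSquares zs))
    (≈-trans (+-cong (re-square z) (re-sumSquares zs))
      (solve 4 (λ a b x y → (a :- b) :+ (x :- y) := (a :+ x) :- (b :+ y)) ≈-refl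
        (re² z) (im² z) (sumBy re² zs) (sumBy im² zs)))

  -- From Σ (a Re z - b)² ≥ 0. For a = n and b = m this says that the variance of the real parts
  -- about their mean m/n is nonnegative.
  deviation : ∀ {n} a b (zs : Vec Cx n) →
    ι 2ℚ * (a * b) * sumBy re zs ≤ a * a * sumBy re² zs + natᴿ n * (b * b)
  deviation a b [] = ≤-reflexive (≈-trans (zeroʳ _) (≈-sym
    (≈-trans (+-cong (zeroʳ (a * a)) (≈-trans (*-congʳ ι-0) (zeroˡ (b * b)))) (+-identityʳ 0#))))
  deviation {suc n} a b (z ∷ zs) = ≤-by
    (+-nonNeg (square-nonNeg (a * re z - b)) (difference (deviation a b zs)))
    (≈-trans (solve 6 (λ a b x S X m →
        con 2ℚ :* (a :* b) :* (x :+ S) :+ ((a :* x :- b) :* (a :* x :- b)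
          :+ ((a :* a :* X :+ m :* (b :* b)) :- con 2ℚ :* (a :* b) :* S))
        := a :* a :* (x :* x :+ X) :+ (con 1ℚ :+ m) :* (b :* b)) ≈-refl
        a b (re z) (sumBy re zs) (sumBy re² zs) (natᴿ n))
      (+-congˡ (*-congʳ (≈-sym (ι-+ 1ℚ (fromℕℚ n))))))

  sum-im²-bound : ∀ {n B} (zs : Vec Cx n) → (∀ i → im² (Vec.lookup zs i) ≤ B) → sumBy im² zs ≤ natᴿ n * B
  sum-im²-bound []       im²≤B = ≤-reflexive (≈-sym (≈-trans (*-congʳ ι-0) (zeroˡ _)))
  sum-im²-bound {suc n} {B} (z ∷ zs) im²≤B = ≤-trans
    (+-mono-≤ (im²≤B zero) (sum-im²-bound zs (λ i → im²≤B (suc i))))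
    (≤-reflexive (≈-trans (solve 2 (λ m B → B :+ m :* B := (con 1ℚ :+ m) :* B) ≈-refl (natᴿ n) B)
      (*-congʳ (≈-sym (ι-+ 1ℚ (fromℕℚ n))))))

  natᴿ-cancel-< : ∀ {m n} → m ℕ.< n → natᴿ m < natᴿ n
  natᴿ-cancel-< {m} {n} m<n n≤m = ℚ.<-irrefl ≡.refl (ℚ.<-≤-trans (below m)
      (ℚ.≤-trans (fromℕℚ-mono m<n) (ι-cancel-≤ n≤m)))
    where
    below : ∀ m → fromℕℚ m ℚ.< fromℕℚ (suc m)
    below m = ≡.subst (ℚ._< fromℕℚ (suc m)) (ℚ.+-identityˡ (fromℕℚ m)) (ℚ.+-monoˡ-< (fromℕℚ m) (ℚ.positive⁻¹ 1ℚ))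

  -- The real parts have mean m/n, so Σ re² ≥ m²/n, while Σ re² − Σ im² = m.
  module _ {n} (9≤n : 9 ℕ.≤ n) where

    private
      G = completeBipartite n
      m = edges G
      open Factored (factor (χ G))

      sum-re : sumBy re roots ≈ natᴿ m
      sum-re = ≈-trans (≈-sym (re-sumRoots roots)) (≈-trans (re-≈ (≋-trans sum-roots
        (≋-trans (⊝-cong (coeff₁-χ G)) (solveᶜ 1 (λ x → :⊝ (:⊝ x) :≋ x) ≋-refl (nat m))))) (re-real _))

      squares≋ : sumSquares roots ≋ nat m
      squares≋ = ≋-trans sum-squares (≋-trans
        (⊕-cong (⊗-cong (coeff₁-χ G) (coeff₁-χ G)) (⊝-cong (⊗-cong ≋-refl (coeff₂-χ G))))
        (≋-trans (solveᶜ 2 (λ x c → :⊝ x :⊗ :⊝ x :⊖ conᶜ 2ℚ :⊗ c :≋ x :⊗ x :⊖ conᶜ 2ℚ :⊗ c)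
            ≋-refl (nat m) (nat (secondCoefficient G)))
        (≋-trans (⊕-cong (≋-trans (≋-sym (nat-* m m)) (≋-trans
            (ℂ.reflexive (≡.cong nat (≡.sym (bipartite-second G (alternating true) (λ u w → ≡.refl)))))
            (≋-trans (nat-+ (2 ℕ.* secondCoefficient G) m) (⊕-cong (nat-* 2 (secondCoefficient G)) ≋-refl)))) ≋-refl)
          (solveᶜ 2 (λ c x → conᶜ (fromℕℚ 2) :⊗ c :⊕ x :⊖ conᶜ 2ℚ :⊗ c :≋ x)
            ≋-refl (nat (secondCoefficient G)) (nat m)))))

      sum-squares-re : sumBy re² roots ≈ natᴿ m + sumBy im² roots
      sum-squares-re = ≈-trans
        (solve 2 (λ x y → x := (x :- y) :+ y) ≈-refl (sumBy re² roots) (sumBy im² roots))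
        (+-congʳ (≈-trans (≈-sym (re-sumSquares roots)) (≈-trans (re-≈ squares≋) (re-real _))))

    -- Here m² ≤ n Σ (Re z)² ≤ n (m + n M²). If 8M < n, then 64 m² ≤ 64 n m + n⁴, against
    -- `edges-large`.
    large-imaginary-part : ∀ {M} → 0# ≤ M → (∀ i → im² (Vec.lookup roots i) ≤ M * M) → natᴿ n ≤ ι 8ℚ * M
    large-imaginary-part {M} 0≤M im²≤ = ≮⇒≥ λ 8M<n → natᴿ-cancel-< (edges-large n 9≤n) (bound (<⇒≤ 8M<n))
      where
      x = natᴿ m
      y = natᴿ n
      0≤y = natᴿ-nonNeg n
      0<y : 0# < y
      0<y = <-≤-trans (natᴿ-pos 0) (natᴿ-mono (ℕ.≤-trans (ℕ.s≤s ℕ.z≤n) 9≤n))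
      X = sumBy re² roots
      2x²≤ : ι 2ℚ * (y * x) * x ≤ y * y * X + y * (x * x)
      2x²≤ = ≤-respˡ (*-congˡ sum-re) (deviation y x roots)
      x²≤yX : x * x ≤ y * X
      x²≤yX = *-cancelˡ-≤ 0<y (≤-by (difference 2x²≤) (solve 3 (λ x y X →
        y :* (x :* x) :+ ((y :* y :* X :+ y :* (x :* x)) :- con 2ℚ :* (y :* x) :* x) := y :* (y :* X)) ≈-refl x y X))
      X≤ : X ≤ x + y * (M * M)
      X≤ = ≤-respˡ (≈-sym sum-squares-re) (+-monoʳ-≤ x (sum-im²-bound roots im²≤))
      bound : ι 8ℚ * M ≤ y → natᴿ (64 ℕ.* (m ℕ.* m)) ≤ natᴿ (n ℕ.* n ℕ.* (n ℕ.* n) ℕ.+ 64 ℕ.* (n ℕ.* m))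
      bound 8M≤y = ≤-respˡ (≈-sym left) (≤-respʳ (≈-sym right)
        (≤-trans (*-monoˡ-≤ 0≤64 (≤-trans x²≤yX (*-monoˡ-≤ 0≤y X≤)))
          (≤-by (*-nonNeg (*-nonNeg 0≤y 0≤y) (difference 64M²≤y²)) (solve 3 (λ x y M →
            con 64ℚ :* (y :* (x :+ y :* (M :* M))) :+ y :* y :* (y :* y :- con 64ℚ :* (M :* M))
              := y :* y :* (y :* y) :+ con 64ℚ :* (y :* x)) ≈-refl x y M))))
        where
        0≤64 = ι-nonNeg (ℚ.<⇒≤ (ℚ.positive⁻¹ 64ℚ))
        64M²≤y² : ι 64ℚ * (M * M) ≤ y * y
        64M²≤y² = ≤-respˡ (≈-sym (ι8*ι8 M))
          (*-mono-≤ (*-nonNeg (ι-nonNeg (ℚ.<⇒≤ (ℚ.positive⁻¹ 8ℚ))) 0≤M) 0≤y 8M≤y 8M≤y)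
        natᴿ-64 : natᴿ 64 ≈ ι 64ℚ
        natᴿ-64 = ≈-reflexive (≡.cong ι (fromℕℚ-/ 64))
        left : natᴿ (64 ℕ.* (m ℕ.* m)) ≈ ι 64ℚ * (x * x)
        left = ≈-trans (natᴿ-* 64 (m ℕ.* m)) (*-cong natᴿ-64 (natᴿ-* m m))
        right : natᴿ (n ℕ.* n ℕ.* (n ℕ.* n) ℕ.+ 64 ℕ.* (n ℕ.* m)) ≈ y * y * (y * y) + ι 64ℚ * (y * x)
        right = ≈-trans (natᴿ-+ (n ℕ.* n ℕ.* (n ℕ.* n)) (64 ℕ.* (n ℕ.* m))) (+-cong
          (≈-trans (natᴿ-* (n ℕ.* n) (n ℕ.* n)) (*-cong (natᴿ-* n n) (natᴿ-* n n)))
          (≈-trans (natᴿ-* 64 (n ℕ.* m)) (*-cong natᴿ-64 (natᴿ-* n m))))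

-- Coding the graphs of a given order by a finite set.

module GraphCodes where

  open Counting

  private
    bit : ∀ {n} → Fin ((2 ℕ.^ n) ℕ.^ n) → Fin n → Fin n → Bool
    bit {n} i u w = does (finToFun {2} {n} (finToFun {2 ℕ.^ n} {n} i u) w Fin.≟ suc zero)

    distinct : ∀ {n} → Fin n → Fin n → Bool
    distinct u w = not (does (u Fin.≟ w))

    distinct-sym : ∀ {n} (u w : Fin n) → distinct u w ≡ distinct w u
    distinct-sym u w with u Fin.≟ w
    ... | yes refl = sym (cong not (dec-true (u Fin.≟ u) refl))
    ... | no  u≢w  = sym (cong not (dec-false (w Fin.≟ u) (λ w≡u → u≢w (sym w≡u))))

  -- Symmetrising by conjunction and clearing the diagonal turns every bit matrix into a graph, and
  -- leaves matrices of graphs as they are.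
  decode : ∀ {n} → Fin ((2 ℕ.^ n) ℕ.^ n) → Graph n
  decode i = record
    { adj         = λ u w → (bit i u w ∧ bit i w u) ∧ distinct u w
    ; symmetric   = λ u w → cong₂ _∧_ (Bool.∧-comm (bit i u w) (bit i w u)) (distinct-sym u w)
    ; irreflexive = λ v → trans (cong ((bit i v v ∧ bit i v v) ∧_) (cong not (dec-true (v Fin.≟ v) refl)))
        (Bool.∧-zeroʳ (bit i v v ∧ bit i v v)) }

  encode : ∀ {n} → Graph n → Fin ((2 ℕ.^ n) ℕ.^ n)
  encode G = funToFin (λ u → funToFin (λ w → if adj G u w then suc zero else zero))

  bit-encode : ∀ {n} (G : Graph n) u w → bit (encode G) u w ≡ adj G u w
  bit-encode {n} G u w = trans
    (cong (λ i → does (finToFun {2} {n} i w Fin.≟ suc zero)) (Fin.finToFun-funToFin {n} {2 ℕ.^ n} _ u))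
    (trans (cong (λ b → does (b Fin.≟ suc zero)) (Fin.finToFun-funToFin {n} {2} _ w)) (go (adj G u w)))
    where
    go : ∀ b → does ((if b then suc zero else zero) Fin.≟ suc {2 ℕ.∸ 1} zero) ≡ b
    go true  = refl
    go false = refl

  decode-encode : ∀ {n} (G : Graph n) u w → adj (decode (encode G)) u w ≡ adj G u w
  decode-encode G u w = trans
    (cong₂ (λ a b → (a ∧ b) ∧ distinct u w) (bit-encode G u w) (trans (bit-encode G w u) (symmetric G w u)))
    (trans (cong (_∧ distinct u w) (Bool.∧-idem (adj G u w))) (off-diagonal (adj G u w) refl))
    where
    off-diagonal : ∀ a → adj G u w ≡ a → a ∧ distinct u w ≡ a
    off-diagonal false _  = refl
    off-diagonal true  uw = cong not (dec-false (u Fin.≟ w) λ { refl →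
      contradiction (trans (sym uw) (irreflexive G u)) λ () })

-- Existence and bounds of the largest imaginary part.

module MaximalImaginaryPart (𝓡 : RealNumbers) (em : ExcludedMiddle 0ℓ) where

  open import Data.Integer using (+_)
  open LowerBound 𝓡 em public
  open Edges
  open GraphCodes
  open Solver

  -- Over ℝ, comparing compound terms by unfolding is infeasible, so equal copies
  -- of the operations are substituted here, where they are opaque.
  module _ (_+′_ _*′_ : Carrier → Carrier → Carrier) (-′_ : Carrier → Carrier)
    (+≡ : ∀ x y → x + y ≡ x +′ y) (*≡ : ∀ x y → x * y ≡ x *′ y) (-≡ : ∀ x → - x ≡ -′ x) where

    ⊕-in : ∀ a b c d → (a +i b) ⊕ (c +i d) ≋ (a +′ c) +i (b +′ d)
    ⊕-in a b c d = ≋-trans (⊕-pair a b c d) (≈-reflexive (+≡ a c) & ≈-reflexive (+≡ b d))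

    ⊗-in : ∀ a b c d → (a +i b) ⊗ (c +i d) ≋
      ((a *′ c) +′ (-′ (b *′ d))) +i ((a *′ d) +′ (b *′ c))
    ⊗-in a b c d = ≋-trans (⊗-pair a b c d)
      (≈-reflexive (≡.trans (≡.cong₂ _+_ (*≡ a c) (≡.trans (≡.cong -_ (*≡ b d)) (-≡ (b *′ d))))
        (+≡ (a *′ c) (-′ (b *′ d)))) &
       ≈-reflexive (≡.trans (≡.cong₂ _+_ (*≡ a d) (*≡ b c)) (+≡ (a *′ d) (b *′ c))))

  natural : ∀ k → nat k ≋ ι (+ k ℚ./ 1) +i 0#
  natural k = ≋-trans (real-cong (≈-reflexive (≡.cong ι (fromℕℚ-/ k)))) (real-pair _)

  ChromaticRoot : ∀ {n} → Graph n → Cx → Set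
  ChromaticRoot G z = ∃[ p ] (∀ k → evaluate p (nat k) ≋ nat (π G k)) × evaluate p z ≋ 𝟘

  chromaticRoot⇒P : ∀ {n} (G : Graph n) {z} → ChromaticRoot G z → P G z ≋ 𝟘
  chromaticRoot⇒P G {z} (p , p≋π , pz≋0) = ≋-trans
    (determined-by-naturals {P G} {evaluate p} (P-polynomial G) (p , λ x → ≋-refl)
      (λ k → ≋-trans (P-nat G k) (≋-sym (p≋π k))) z) pz≋0

  P⇒chromaticRoot : ∀ {n} (G : Graph n) {z} → P G z ≋ 𝟘 → ChromaticRoot G z
  P⇒chromaticRoot G {z} Pz≋0 = monicPolynomial (χ G) ,
    (λ k → ≋-trans (evaluate-monicPolynomial (χ G) (nat k)) (P-nat G k)) ,
    ≋-trans (evaluate-monicPolynomial (χ G) z) Pz≋0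

  evaluate-conj : ∀ p z → evaluate (List.map conj p) (conj z) ≋ conj (evaluate p z)
  evaluate-conj []      z = ≋-sym (conj-real 0#)
  evaluate-conj (a ∷ p) z = ≋-trans (⊕-cong ≋-refl (⊗-cong ≋-refl (evaluate-conj p z)))
    (≋-sym (≋-trans (conj-⊕ a (z ⊗ evaluate p z)) (⊕-cong ≋-refl (conj-⊗ z (evaluate p z)))))

  -- The values at natural numbers are real, so conjugating the coefficients of a chromatic
  -- polynomial gives a chromatic polynomial of the same graph.
  chromaticRoot-conj : ∀ {n} (G : Graph n) {z} → ChromaticRoot G z → ChromaticRoot G (conj z)
  chromaticRoot-conj G {z} (p , p≋π , pz≋0) = List.map conj p ,
    (λ k → ≋-trans (evaluate-cong (List.map conj p) (≋-sym (conj-real (natᴿ k))))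
      (≋-trans (evaluate-conj p (nat k)) (≋-trans (conj-cong (p≋π k)) (conj-real (natᴿ (π G k)))))) ,
    ≋-trans (evaluate-conj p z) (≋-trans (conj-cong pz≋0) (conj-real 0#))

  prodRoots-lookup : ∀ {n} (zs : Vec Cx n) i → prodRoots zs (Vec.lookup zs i) ≋ 𝟘
  prodRoots-lookup (z ∷ zs) zero    = ≋-trans (⊗-cong (ℂ.-‿inverseʳ z) ≋-refl) (ℂ.zeroˡ _)
  prodRoots-lookup (z ∷ zs) (suc i) = ≋-trans (⊗-cong ≋-refl (prodRoots-lookup zs i)) (ℂ.zeroʳ _)

  factored-root : ∀ {n} (G : Graph n) (F : Factored (χ G)) i → ChromaticRoot G (Vec.lookup (Factored.roots F) i)
  factored-root G F i = P⇒chromaticRoot G (≋-trans (Factored.factors F _) (prodRoots-lookup (Factored.roots F) i))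

  Greatest : ∀ {n} → Graph n → Cx → Set
  Greatest G z = ChromaticRoot G z × (∀ w → ChromaticRoot G w → im w ≤ im z)

  greatest-root : ∀ {n} (G : Graph (suc n)) → ∃ (Greatest G)
  greatest-root {n} G = choose (factor (χ G))
    (maximum (λ i → im (Vec.lookup (Factored.roots (factor (χ G))) i)))
    where
    choose : (F : Factored (χ G)) →
      ∃[ i ] (∀ j → im (Vec.lookup (Factored.roots F) j) ≤ im (Vec.lookup (Factored.roots F) i)) →
      ∃ (Greatest G)
    choose F (i , largest) = Vec.lookup (Factored.roots F) i , factored-root G F i , λ w root →
      let j , w≋ = root-of-product (Factored.roots F)
            (≋-trans (≋-sym (Factored.factors F w)) (chromaticRoot⇒P G root))
      in ≤-respˡ (≈-sym (im-≈ w≋)) (largest j)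

  chromaticRoot-cong : ∀ {n} {G G′ : Graph n} → (∀ u v → adj G u v ≡ adj G′ u v) →
    ∀ {z} → ChromaticRoot G z → ChromaticRoot G′ z
  chromaticRoot-cong {G = G} {G′} G≗G′ (p , p≋π , pz≋0) =
    p , (λ k → ≋-trans (p≋π k) (ℂ.reflexive (≡.cong nat (Counting.π-cong {G = G} {G′} G≗G′ k)))) , pz≋0

  -- The first argument shows that m is positive; the number of codes is not visibly a successor.
  -- The code of any graph serves.
  maximum-over : ∀ {m} → Fin m → (f : Fin m → Carrier) → ∃[ i ] (∀ j → f j ≤ f i)
  maximum-over {suc m} _ f = maximum f

  Maximal : ℕ → Cx → Set
  Maximal n z = (∃[ G ] ChromaticRoot {n} G z) × (∀ (G : Graph n) w → ChromaticRoot G w → im w ≤ im z)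

  -- The order is a successor because the chromatic polynomial of the empty graph is 1 and has no
  -- roots. The maximum is taken over all codes, and every graph has the adjacency of a decoded one.
  maximal-root : ∀ n → ∃ (Maximal (suc n))
  maximal-root n = choose (λ i → greatest-root (decode i))
      (maximum-over (encode (completeBipartite (suc n))) (λ i → im (proj₁ (greatest-root (decode {suc n} i)))))
    where
    choose : (r : ∀ i → ∃ (Greatest (decode {suc n} i))) →
      ∃[ i ] (∀ j → im (proj₁ (r j)) ≤ im (proj₁ (r i))) → ∃ (Maximal (suc n))
    choose r (i , largest) = proj₁ (r i) , (decode i , proj₁ (proj₂ (r i))) , λ G w root → ≤-trans
      (proj₂ (proj₂ (r (encode G))) w
        (chromaticRoot-cong {G = G} {decode (encode G)} (λ u v → ≡.sym (decode-encode G u v)) root))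
      (largest (encode G))

  ∣x∣≤M⇒x²≤M² : ∀ {x M} → x ≤ M → - x ≤ M → x * x ≤ M * M
  ∣x∣≤M⇒x²≤M² {x} {M} x≤M -x≤M = ≤-by (*-nonNeg (difference x≤M) (difference -x≤M))
    (solve 2 (λ x M → x :* x :+ (M :- x) :* (M :- :- x) := M :* M) ≈-refl x M)

  ±x≤M⇒0≤M : ∀ {x M} → x ≤ M → - x ≤ M → 0# ≤ M
  ±x≤M⇒0≤M {x} {M} x≤M -x≤M = *-cancelˡ-≤ (ι-pos (ℚ.positive⁻¹ 2ℚ))
    (≤-by (+-nonNeg (difference x≤M) (difference -x≤M))
      (≈-trans (+-congʳ (zeroʳ (ι 2ℚ))) (≈-trans (+-identityˡ _)
        (solve 2 (λ x M → (M :- x) :+ (M :- :- x) := con 2ℚ :* M) ≈-refl x M))))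

  ⅛ : ℚ
  ⅛ = + 1 ℚ./ 8

  natᴿ≈ι : ∀ n → natᴿ n ≈ ι (+ n ℚ./ 1)
  natᴿ≈ι n = ≈-reflexive (≡.cong ι (fromℕℚ-/ n))

  maximal-upper : ∀ {n z} → Maximal n z → im z ≤ ι 8ℚ * ι (+ n ℚ./ 1)
  maximal-upper {n} {z} ((G , root) , _) =
    ≤-respʳ (*-congˡ (natᴿ≈ι n)) (root-bound G z (chromaticRoot⇒P G root))

  -- Conjugation makes im z a bound for both Im and -Im of every root of the complete bipartite
  -- graph, hence for |Im|.
  maximal-lower : ∀ {n z} → 9 ℕ.≤ n → Maximal n z → ι ⅛ * ι (+ n ℚ./ 1) ≤ im z
  maximal-lower {suc n} {z} 9≤n (_ , largest) = ≤-respˡ (*-congˡ (natᴿ≈ι (suc n)))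
      (≤-trans (*-monoˡ-≤ (ι-nonNeg (ℚ.<⇒≤ (ℚ.positive⁻¹ ⅛))) (large-imaginary-part 9≤n
        (±x≤M⇒0≤M (upper zero) (lower zero)) (λ i → ∣x∣≤M⇒x²≤M² (upper i) (lower i))))
      (≤-reflexive (≈-trans (≈-sym (*-assoc (ι ⅛) (ι 8ℚ) (im z)))
        (≈-trans (*-congʳ (≈-trans (≈-sym (ι-* ⅛ 8ℚ)) ι-1)) (*-identityˡ (im z))))))
    where
    G = completeBipartite (suc n)
    F = factor (χ G)
    upper : ∀ i → im (Vec.lookup (Factored.roots F) i) ≤ im z
    upper i = largest G _ (factored-root G F i)
    lower : ∀ i → - im (Vec.lookup (Factored.roots F) i) ≤ im z
    lower i = ≤-respˡ (im-conj _) (largest G _ (chromaticRoot-conj G (factored-root G F i)))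

  -- The product and the constants are parameters tied by equations, so that the terms over the
  -- concrete reals are matched by substitution.
  maximal-lower-in : ∀ (_*′_ : Carrier → Carrier → Carrier) → (∀ x y → x * y ≡ x *′ y) →
    ∀ {n z c x} → ι ⅛ ≡ c → ι (+ n ℚ./ 1) ≡ x → 9 ℕ.≤ n → Maximal n z → (c *′ x) ≤ im z
  maximal-lower-in _*′_ *≡ {n} {z} {c} {x} ≡.refl ≡.refl 9≤n maximal =
    ≡.subst (_≤ im z) (*≡ c x) (maximal-lower 9≤n maximal)

  maximal-upper-in : ∀ (_*′_ : Carrier → Carrier → Carrier) → (∀ x y → x * y ≡ x *′ y) →
    ∀ {n z c x} → ι 8ℚ ≡ c → ι (+ n ℚ./ 1) ≡ x → Maximal n z → im z ≤ (c *′ x)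
  maximal-upper-in _*′_ *≡ {n} {z} {c} {x} ≡.refl ≡.refl maximal =
    ≡.subst (im z ≤_) (*≡ c x) (maximal-upper maximal)

-- Cauchy sequences of rationals satisfy the interface.

module CauchyReals (em : ExcludedMiddle 0ℓ) where

  open import Data.Rational using (∣_∣)
  open import Data.Rational.Solver using (module +-*-Solver)
  open import Defs using (ℝ; mkℝ; seq; cauchy; _≃ᵣ_; _≤ᵣ_; _<ᵣ_; _+ᵣ_; _*ᵣ_; -ᵣ_; fromℚ; fromℕᵣ; 0ᵣ;
    0<½*; eventually-bounded; rescale; *-close)
  open +-*-Solver

  ≤-by : ∀ {x y d} → 0ℚ ℚ.≤ d → x ℚ.+ d ≡ y → x ℚ.≤ y
  ≤-by {x} 0≤d eq = subst (x ℚ.≤_) eq (subst (ℚ._≤ x ℚ.+ _) (ℚ.+-identityʳ x) (ℚ.+-monoʳ-≤ x 0≤d))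

  <-by : ∀ {x y d} → 0ℚ ℚ.< d → x ℚ.+ d ≡ y → x ℚ.< y
  <-by {x} 0<d eq = subst (x ℚ.<_) eq (subst (ℚ._< x ℚ.+ _) (ℚ.+-identityʳ x) (ℚ.+-monoʳ-< x 0<d))

  ≤-diff : ∀ x y → x ℚ.≤ y → 0ℚ ℚ.≤ y ℚ.- x
  ≤-diff x y x≤y = subst (ℚ._≤ y ℚ.- x) (ℚ.+-inverseʳ x) (ℚ.+-monoˡ-≤ (ℚ.- x) x≤y)

  <-diff : ∀ x y → x ℚ.< y → 0ℚ ℚ.< y ℚ.- x
  <-diff x y x<y = subst (ℚ._< y ℚ.- x) (ℚ.+-inverseʳ x) (ℚ.+-monoˡ-< (ℚ.- x) x<y)

  ≤∣∣ : ∀ p → p ℚ.≤ ∣ p ∣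
  ≤∣∣ p with ℚ.∣p∣≡p∨∣p∣≡-p p
  ... | inj₁ eq = ℚ.≤-reflexive (sym eq)
  ... | inj₂ eq = ℚ.≤-trans (≤-by (subst (0ℚ ℚ.≤_) eq (ℚ.0≤∣p∣ p)) (ℚ.+-inverseʳ p)) (ℚ.0≤∣p∣ p)

  ∣-∣-sym : ∀ x y → ∣ x ℚ.- y ∣ ≡ ∣ y ℚ.- x ∣
  ∣-∣-sym x y = trans (cong ∣_∣ (solve 2 (λ x y → x :- y := :- (y :- x)) refl x y)) (ℚ.∣-p∣≡∣p∣ (y ℚ.- x))

  ∣-∣-< : ∀ x y {ε} → x ℚ.- y ℚ.< ε → y ℚ.- x ℚ.< ε → ∣ x ℚ.- y ∣ ℚ.< ε
  ∣-∣-< x y {ε} x-y<ε y-x<ε with ℚ.∣p∣≡p∨∣p∣≡-p (x ℚ.- y)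
  ... | inj₁ eq = subst (ℚ._< ε) (sym eq) x-y<ε
  ... | inj₂ eq = subst (ℚ._< ε) (trans (solve 2 (λ x y → y :- x := :- (x :- y)) refl x y) (sym eq)) y-x<ε

  ∣-∣-upper : ∀ x y ε → ∣ x ℚ.- y ∣ ℚ.< ε → x ℚ.< y ℚ.+ ε
  ∣-∣-upper x y ε x-y<ε = <-by (<-diff (x ℚ.- y) ε (ℚ.≤-<-trans (≤∣∣ (x ℚ.- y)) x-y<ε))
    (solve 3 (λ x y ε → x :+ (ε :- (x :- y)) := y :+ ε) refl x y ε)

  Eventually : (ℕ → Set) → Set
  Eventually Q = ∃[ N ] (∀ n → N ℕ.≤ n → Q n)

  both : ∀ {Q R : ℕ → Set} → Eventually Q → Eventually R → Eventually (λ n → Q n × R n)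
  both (M , Q) (N , R) = M ⊔ N , λ n le → Q n (ℕ.m⊔n≤o⇒m≤o M N le) , R n (ℕ.m⊔n≤o⇒n≤o M N le)

  eventually : ∀ {Q R : ℕ → Set} → (∀ n → Q n → R n) → Eventually Q → Eventually R
  eventually Q⇒R (N , Q) = N , λ n le → Q⇒R n (Q n le)

  always : ∀ {Q : ℕ → Set} → (∀ n → Q n) → Eventually Q
  always Q = 0 , λ n _ → Q n

  -- Reals are explicit arguments here and below: `_≃ᵣ_` and `_≤ᵣ_` unfold to statements about
  -- sequences, which do not determine the Cauchy proofs.
  ≃-pointwise : ∀ x y → (∀ n → seq x n ≡ seq y n) → x ≃ᵣ y
  ≃-pointwise x y eq ε 0<ε = always λ n →
    subst (λ d → ∣ d ∣ ℚ.< ε) (sym (trans (cong (ℚ._- seq y n) (eq n)) (ℚ.+-inverseʳ (seq y n)))) 0<ε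

  ≃-refl : ∀ x → x ≃ᵣ x
  ≃-refl x = ≃-pointwise x x (λ _ → refl)

  ≃-sym : ∀ x y → x ≃ᵣ y → y ≃ᵣ x
  ≃-sym x y x≃y ε 0<ε = eventually (λ n → subst (ℚ._< ε) (∣-∣-sym (seq x n) (seq y n))) (x≃y ε 0<ε)

  ∣∣-triangle : ∀ a b {c ε} → c ≡ a ℚ.+ b → ∣ a ∣ ℚ.< ½ ℚ.* ε → ∣ b ∣ ℚ.< ½ ℚ.* ε → ∣ c ∣ ℚ.< ε
  ∣∣-triangle a b {ε = ε} refl a< b< = subst (∣ a ℚ.+ b ∣ ℚ.<_) (½+½ ε)
    (ℚ.≤-<-trans (ℚ.∣p+q∣≤∣p∣+∣q∣ a b) (ℚ.+-mono-< a< b<))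

  ≃-trans : ∀ x y z → x ≃ᵣ y → y ≃ᵣ z → x ≃ᵣ z
  ≃-trans x y z x≃y y≃z ε 0<ε = eventually
    (λ n (p , q) → ∣∣-triangle (seq x n ℚ.- seq y n) (seq y n ℚ.- seq z n)
      (solve 3 (λ a b c → a :- c := (a :- b) :+ (b :- c)) refl (seq x n) (seq y n) (seq z n)) p q)
    (both (x≃y _ (0<½* ε 0<ε)) (y≃z _ (0<½* ε 0<ε)))

  +-cong : ∀ x x′ y y′ → x ≃ᵣ x′ → y ≃ᵣ y′ → x +ᵣ y ≃ᵣ x′ +ᵣ y′
  +-cong x x′ y y′ x≃x′ y≃y′ ε 0<ε = eventually
    (λ n (p , q) → ∣∣-triangle (seq x n ℚ.- seq x′ n) (seq y n ℚ.- seq y′ n)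
      (solve 4 (λ a a′ b b′ → (a :+ b) :- (a′ :+ b′) := (a :- a′) :+ (b :- b′)) refl
        (seq x n) (seq x′ n) (seq y n) (seq y′ n)) p q)
    (both (x≃x′ _ (0<½* ε 0<ε)) (y≃y′ _ (0<½* ε 0<ε)))

  neg-cong : ∀ x y → x ≃ᵣ y → -ᵣ x ≃ᵣ -ᵣ y
  neg-cong x y x≃y ε 0<ε = eventually
    (λ n → subst (ℚ._< ε) (trans (sym (ℚ.∣-p∣≡∣p∣ (seq x n ℚ.- seq y n)))
      (cong ∣_∣ (solve 2 (λ a b → :- (a :- b) := :- a :- :- b) refl (seq x n) (seq y n))))) (x≃y ε 0<ε)

  *-cong : ∀ x x′ y y′ → x ≃ᵣ x′ → y ≃ᵣ y′ → x *ᵣ y ≃ᵣ x′ *ᵣ y′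
  *-cong x x′ y y′ x≃x′ y≃y′ ε 0<ε =
    let A , 0<A , xA = eventually-bounded (seq x) (cauchy x)
        B , 0<B , yB = eventually-bounded (seq y′) (cauchy y′)
        δ , 0<δ , eq = rescale (A ℚ.+ B) ε (ℚ.+-mono-< 0<A 0<B) 0<ε
    in eventually (λ n ((a , b) , (c , d)) → subst (∣ seq x n ℚ.* seq y n ℚ.- seq x′ n ℚ.* seq y′ n ∣ ℚ.<_) eq
         (*-close (seq x n) (seq y n) (seq x′ n) (seq y′ n) A B δ 0<A 0<B a b c d))
         (both (both xA yB) (both (x≃x′ δ 0<δ) (y≃y′ δ 0<δ)))

  commutativeRing : CommutativeRing 0ℓ 0ℓ
  commutativeRing = record
    { Carrier = ℝ ; _≈_ = _≃ᵣ_ ; _+_ = _+ᵣ_ ; _*_ = _*ᵣ_ ; -_ = -ᵣ_ ; 0# = fromℕᵣ 0 ; 1# = fromℚ 1ℚ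
    ; isCommutativeRing = record
      { isRing = record
        { +-isAbelianGroup = record
          { isGroup = record
            { isMonoid = record
              { isSemigroup = record
                { isMagma = record
                  { isEquivalence = record
                    { refl  = λ {x} → ≃-refl x
                    ; sym   = λ {x} {y} → ≃-sym x y
                    ; trans = λ {x} {y} {z} → ≃-trans x y z }
                  ; ∙-cong = λ {x} {x′} {y} {y′} → +-cong x x′ y y′ }
                ; assoc = λ x y z → ≃-pointwise ((x +ᵣ y) +ᵣ z) (x +ᵣ (y +ᵣ z))
                    (λ n → ℚ.+-assoc (seq x n) (seq y n) (seq z n)) }
              ; identity =
                  (λ x → ≃-pointwise (fromℕᵣ 0 +ᵣ x) x (λ n → ℚ.+-identityˡ (seq x n))) ,
                  (λ x → ≃-pointwise (x +ᵣ fromℕᵣ 0) x (λ n → ℚ.+-identityʳ (seq x n))) }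
            ; inverse =
                (λ x → ≃-pointwise (-ᵣ x +ᵣ x) (fromℕᵣ 0) (λ n → ℚ.+-inverseˡ (seq x n))) ,
                (λ x → ≃-pointwise (x +ᵣ -ᵣ x) (fromℕᵣ 0) (λ n → ℚ.+-inverseʳ (seq x n)))
            ; ⁻¹-cong = λ {x} {y} → neg-cong x y }
          ; comm = λ x y → ≃-pointwise (x +ᵣ y) (y +ᵣ x) (λ n → ℚ.+-comm (seq x n) (seq y n)) }
        ; *-cong = λ {x} {x′} {y} {y′} → *-cong x x′ y y′
        ; *-assoc = λ x y z → ≃-pointwise ((x *ᵣ y) *ᵣ z) (x *ᵣ (y *ᵣ z))
            (λ n → ℚ.*-assoc (seq x n) (seq y n) (seq z n))
        ; *-identity =
            (λ x → ≃-pointwise (fromℚ 1ℚ *ᵣ x) x (λ n → ℚ.*-identityˡ (seq x n))) ,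
            (λ x → ≃-pointwise (x *ᵣ fromℚ 1ℚ) x (λ n → ℚ.*-identityʳ (seq x n)))
        ; distrib =
            (λ x y z → ≃-pointwise (x *ᵣ (y +ᵣ z)) (x *ᵣ y +ᵣ x *ᵣ z)
              (λ n → ℚ.*-distribˡ-+ (seq x n) (seq y n) (seq z n))) ,
            (λ x y z → ≃-pointwise ((y +ᵣ z) *ᵣ x) (y *ᵣ x +ᵣ z *ᵣ x)
              (λ n → ℚ.*-distribʳ-+ (seq x n) (seq y n) (seq z n))) }
      ; *-comm = λ x y → ≃-pointwise (x *ᵣ y) (y *ᵣ x) (λ n → ℚ.*-comm (seq x n) (seq y n)) } }

  ≤-reflexive : ∀ x y → x ≃ᵣ y → x ≤ᵣ y
  ≤-reflexive x y x≃y ε 0<ε = eventually (λ n d → ℚ.<⇒≤ (∣-∣-upper (seq x n) (seq y n) ε d)) (x≃y ε 0<ε)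

  ≤-trans : ∀ x y z → x ≤ᵣ y → y ≤ᵣ z → x ≤ᵣ z
  ≤-trans x y z x≤y y≤z ε 0<ε = eventually
    (λ n (p , q) → ℚ.≤-trans p (ℚ.≤-trans (ℚ.+-monoˡ-≤ (½ ℚ.* ε) q)
      (ℚ.≤-reflexive (trans (ℚ.+-assoc (seq z n) _ _) (cong (seq z n ℚ.+_) (½+½ ε))))))
    (both (x≤y _ (0<½* ε 0<ε)) (y≤z _ (0<½* ε 0<ε)))

  ≤-antisym : ∀ x y → x ≤ᵣ y → y ≤ᵣ x → x ≃ᵣ y
  ≤-antisym x y x≤y y≤x ε 0<ε = eventually (λ n (p , q) → ∣-∣-< (seq x n) (seq y n)
        (close (seq x n) (seq y n) p) (close (seq y n) (seq x n) q))
      (both (x≤y _ (0<½* ε 0<ε)) (y≤x _ (0<½* ε 0<ε)))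
    where
    close : ∀ a b → a ℚ.≤ b ℚ.+ ½ ℚ.* ε → a ℚ.- b ℚ.< ε
    close a b a≤ = ℚ.≤-<-trans
      (≤-by (≤-diff a (b ℚ.+ ½ ℚ.* ε) a≤) (solve 3 (λ a b e → (a :- b) :+ ((b :+ e) :- a) := e) refl a b (½ ℚ.* ε)))
      (<-by (0<½* ε 0<ε) (½+½ ε))

  -- Excluded middle supplies an ε at which the inequality fails. By the Cauchy property, a single
  -- late index with x < y + ε/2 would force x ≤ y + ε at all late indices.
  ≰⇒> : ∀ x y → ¬ (x ≤ᵣ y) → y <ᵣ x
  ≰⇒> x y x≰y = separated (witness x≰y)
    where
    Bad : ℚ → Set
    Bad ε = 0ℚ ℚ.< ε × ¬ Eventually (λ n → seq x n ℚ.≤ seq y n ℚ.+ ε)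
    witness : ¬ (x ≤ᵣ y) → ∃[ ε ] Bad ε
    witness x≰y with em {P = ∃[ ε ] Bad ε}
    ... | yes bad = bad
    ... | no ¬bad = contradiction x≤y x≰y
      where
      x≤y : x ≤ᵣ y
      x≤y ε 0<ε with em {P = Eventually (λ n → seq x n ℚ.≤ seq y n ℚ.+ ε)}
      ... | yes ev = ev
      ... | no ¬ev = contradiction (ε , 0<ε , ¬ev) ¬bad
    separated : ∃[ ε ] Bad ε → y <ᵣ x
    separated (ε , 0<ε , ¬ev) = ½ ℚ.* ε , 0<½* ε 0<ε , K , above
      where
      -- A quarter of ε: one η for the oscillation of x and one for that of y fill the gap from ε/2
      -- to ε.
      η = ½ ℚ.* (½ ℚ.* ε)
      0<η = 0<½* _ (0<½* ε 0<ε)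
      M = proj₁ (cauchy x η 0<η)
      xM = proj₂ (cauchy x η 0<η)
      N = proj₁ (cauchy y η 0<η)
      yN = proj₂ (cauchy y η 0<η)
      K = M ⊔ N
      above : ∀ m → K ℕ.≤ m → seq y m ℚ.+ ½ ℚ.* ε ℚ.≤ seq x m
      above m K≤m = ℚ.≮⇒≥ λ x<y+½ε → ¬ev (K , λ n K≤n → ≤-by
        (ℚ.<⇒≤ (ℚ.+-mono-< (<-diff (seq x m) (seq y m ℚ.+ ½ ℚ.* ε) x<y+½ε) (ℚ.+-mono-<
          (<-diff (seq x n) (seq x m ℚ.+ η) (∣-∣-upper (seq x n) (seq x m) η
            (xM n m (ℕ.m⊔n≤o⇒m≤o M N K≤n) (ℕ.m⊔n≤o⇒m≤o M N K≤m))))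
          (<-diff (seq y m) (seq y n ℚ.+ η) (∣-∣-upper (seq y m) (seq y n) η
            (yN m n (ℕ.m⊔n≤o⇒n≤o M N K≤m) (ℕ.m⊔n≤o⇒n≤o M N K≤n)))))))
        (trans (solve 6 (λ xn xm yn ym h e → xn :+ ((ym :+ h :- xm) :+ ((xm :+ e :- xn) :+ (yn :+ e :- ym)))
            := yn :+ (h :+ (e :+ e))) refl (seq x n) (seq x m) (seq y n) (seq y m) (½ ℚ.* ε) η)
          (cong (seq y n ℚ.+_) (trans (cong (½ ℚ.* ε ℚ.+_) (½+½ (½ ℚ.* ε))) (½+½ ε)))))

  <⇒≤ : ∀ x y → x <ᵣ y → x ≤ᵣ y
  <⇒≤ x y (δ , 0<δ , ev) ε 0<ε = eventually (λ n le → ℚ.≤-trans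
    (≤-by (ℚ.<⇒≤ 0<δ) refl) (ℚ.≤-trans le (≤-by (ℚ.<⇒≤ 0<ε) refl))) ev

  ≤-total : ∀ x y → x ≤ᵣ y ⊎ y ≤ᵣ x
  ≤-total x y with em {P = x ≤ᵣ y}
  ... | yes x≤y = inj₁ x≤y
  ... | no  x≰y = inj₂ (<⇒≤ y x (≰⇒> x y x≰y))

  ≤-pointwise : ∀ x y → Eventually (λ n → seq x n ℚ.≤ seq y n) → x ≤ᵣ y
  ≤-pointwise x y ev ε 0<ε = eventually (λ n le → ℚ.≤-trans le (≤-by (ℚ.<⇒≤ 0<ε) refl)) ev

  zero-product : ∀ x y → x ≃ᵣ 0ᵣ → x *ᵣ y ≃ᵣ 0ᵣ
  zero-product x y x≃0 = ≃-trans (x *ᵣ y) (0ᵣ *ᵣ y) 0ᵣ (*-cong x 0ᵣ y y x≃0 (≃-refl y))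
    (≃-pointwise (0ᵣ *ᵣ y) 0ᵣ (λ n → ℚ.*-zeroˡ (seq y n)))

  nonNeg-* : ∀ a b → 0ℚ ℚ.≤ a → 0ℚ ℚ.≤ b → 0ℚ ℚ.≤ a ℚ.* b
  nonNeg-* a b 0≤a 0≤b = ℚ.nonNegative⁻¹ (a ℚ.* b)
    {{ℚ.nonNeg*nonNeg⇒nonNeg a {{ℚ.nonNegative 0≤a}} b {{ℚ.nonNegative 0≤b}}}}

  positive-product : ∀ x y → 0ᵣ <ᵣ x → 0ᵣ <ᵣ y → 0ᵣ ≤ᵣ x *ᵣ y
  positive-product x y (δ , 0<δ , evx) (η , 0<η , evy) = ≤-pointwise 0ᵣ (x *ᵣ y) (eventually
      (λ n (p , q) → nonNeg-* (seq x n) (seq y n) (positive 0<δ p) (positive 0<η q)) (both evx evy))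
    where
    positive : ∀ {a δ} → 0ℚ ℚ.< δ → 0ℚ ℚ.+ δ ℚ.≤ a → 0ℚ ℚ.≤ a
    positive {a} {δ} 0<δ le = ℚ.≤-trans (ℚ.<⇒≤ 0<δ) (subst (ℚ._≤ a) (ℚ.+-identityˡ δ) le)

  -- A nonnegative real may be given by negative terms, so signs cannot be multiplied termwise. If
  -- either factor is zero, so is the product; otherwise both are eventually bounded below by
  -- positive rationals.
  *-nonNeg : ∀ x y → 0ᵣ ≤ᵣ x → 0ᵣ ≤ᵣ y → 0ᵣ ≤ᵣ x *ᵣ y
  *-nonNeg x y 0≤x 0≤y = cases em em
    where
    cases : Dec (x ≤ᵣ 0ᵣ) → Dec (y ≤ᵣ 0ᵣ) → 0ᵣ ≤ᵣ x *ᵣ y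
    cases (yes x≤0) _ = ≤-reflexive 0ᵣ (x *ᵣ y) (≃-sym (x *ᵣ y) 0ᵣ
      (zero-product x y (≤-antisym x 0ᵣ x≤0 0≤x)))
    cases (no _) (yes y≤0) = ≤-reflexive 0ᵣ (x *ᵣ y) (≃-sym (x *ᵣ y) 0ᵣ
      (≃-trans (x *ᵣ y) (y *ᵣ x) 0ᵣ (≃-pointwise (x *ᵣ y) (y *ᵣ x) (λ n → ℚ.*-comm (seq x n) (seq y n)))
        (zero-product y x (≤-antisym y 0ᵣ y≤0 0≤y))))
    cases (no x≰0) (no y≰0) = positive-product x y (≰⇒> x 0ᵣ x≰0) (≰⇒> y 0ᵣ y≰0)

  fromℚ-cancel-≤ : ∀ p q → fromℚ p ≤ᵣ fromℚ q → p ℚ.≤ q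
  fromℚ-cancel-≤ p q p≤q = ℚ.≮⇒≥ λ q<p →
    let d = p ℚ.- q
        N , le = p≤q (½ ℚ.* d) (0<½* d (<-diff q p q<p))
    in ℚ.<-irrefl refl (ℚ.≤-<-trans (le N ℕ.≤-refl) (<-by (0<½* d (<-diff q p q<p))
         (trans (ℚ.+-assoc q _ _) (trans (cong (q ℚ.+_) (½+½ d)) (solve 2 (λ p q → q :+ (p :- q) := p) refl p q)))))

  above : ∀ x → ∃[ q ] x ≤ᵣ fromℚ q
  above x = let B , _ , ev = eventually-bounded (seq x) (cauchy x)
    in B , ≤-pointwise x (fromℚ B) (eventually (λ n → ℚ.≤-trans (≤∣∣ (seq x n))) ev)

  below : ∀ x → ¬ (x ≤ᵣ 0ᵣ) → ∃[ q ] 0ℚ ℚ.< q × fromℚ q ≤ᵣ x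
  below x x≰0 = let q , 0<q , ev = ≰⇒> x 0ᵣ x≰0
    in q , 0<q , ≤-pointwise (fromℚ q) x (eventually (λ n → subst (ℚ._≤ seq x n) (ℚ.+-identityˡ q)) ev)

  -- The limit is the sequence of left endpoints: from index N on they lie in the N-th interval, so
  -- they differ by at most w N.
  nested : ∀ (a w : ℕ → ℚ) → (∀ n → 0ℚ ℚ.≤ w n) → (∀ n → a n ℚ.≤ a (suc n)) →
    (∀ n → a (suc n) ℚ.+ w (suc n) ℚ.≤ a n ℚ.+ w n) → (∀ ε → 0ℚ ℚ.< ε → ∃[ n ] w n ℚ.< ε) →
    ∃[ x ] (∀ n → fromℚ (a n) ≤ᵣ x × x ≤ᵣ fromℚ (a n ℚ.+ w n))
  nested a w 0≤w up down small = x , λ n →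
      ≤-pointwise (fromℚ (a n)) x (n , λ m n≤m → proj₁ (inside n≤m)) ,
      ≤-pointwise x (fromℚ (a n ℚ.+ w n)) (n , λ m n≤m → proj₂ (inside n≤m))
    where
    monotone : ∀ {n m} → n ℕ.≤′ m → a n ℚ.≤ a m × a m ℚ.+ w m ℚ.≤ a n ℚ.+ w n
    monotone ℕ.≤′-refl = ℚ.≤-refl , ℚ.≤-refl
    monotone (ℕ.≤′-step {m} n≤m) =
      ℚ.≤-trans (proj₁ (monotone n≤m)) (up m) , ℚ.≤-trans (down m) (proj₂ (monotone n≤m))
    inside : ∀ {n m} → n ℕ.≤ m → a n ℚ.≤ a m × a m ℚ.≤ a n ℚ.+ w n
    inside {n} {m} n≤m = proj₁ (monotone (ℕ.≤⇒≤′ n≤m)) ,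
      ℚ.≤-trans (≤-by (0≤w m) refl) (proj₂ (monotone (ℕ.≤⇒≤′ n≤m)))
    near : ∀ {N m n ε} → w N ℚ.< ε → N ℕ.≤ m → N ℕ.≤ n → a m ℚ.- a n ℚ.< ε
    near {N} {m} {n} {ε} w<ε N≤m N≤n = ℚ.≤-<-trans
      (≤-by (ℚ.+-mono-≤ (≤-diff (a m) (a N ℚ.+ w N) (proj₂ (inside N≤m))) (≤-diff (a N) (a n) (proj₁ (inside N≤n))))
        (solve 4 (λ am an aN w → (am :- an) :+ ((aN :+ w :- am) :+ (an :- aN)) := w)
          refl (a m) (a n) (a N) (w N))) w<ε
    x : ℝ
    x = mkℝ a λ ε 0<ε → let N , w<ε = small ε 0<ε
      in N , λ m n N≤m N≤n → ∣-∣-< (a m) (a n) (near w<ε N≤m N≤n) (near w<ε N≤n N≤m)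

  realNumbers : RealNumbers
  realNumbers = record
    { commutativeRing = commutativeRing
    ; _≤_         = _≤ᵣ_
    ; ≤-reflexive = λ {x} {y} → ≤-reflexive x y
    ; ≤-trans     = λ {x} {y} {z} → ≤-trans x y z
    ; ≤-antisym   = λ {x} {y} → ≤-antisym x y
    ; ≤-total     = ≤-total
    ; +-monoʳ-≤   = λ x {y} {z} y≤z ε 0<ε → eventually (λ n le → ℚ.≤-trans (ℚ.+-monoʳ-≤ (seq x n) le)
                      (ℚ.≤-reflexive (sym (ℚ.+-assoc (seq x n) (seq z n) ε)))) (y≤z ε 0<ε)
    ; *-nonNeg    = λ {x} {y} → *-nonNeg x y
    ; ι           = fromℚ
    ; ι-+         = λ p q → ≃-pointwise (fromℚ (p ℚ.+ q)) (fromℚ p +ᵣ fromℚ q) (λ _ → refl)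
    ; ι-*         = λ p q → ≃-pointwise (fromℚ (p ℚ.* q)) (fromℚ p *ᵣ fromℚ q) (λ _ → refl)
    ; ι-neg       = λ p → ≃-pointwise (fromℚ (ℚ.- p)) (-ᵣ fromℚ p) (λ _ → refl)
    ; ι-0         = ≃-refl 0ᵣ
    ; ι-1         = ≃-refl (fromℚ 1ℚ)
    ; ι-mono-≤    = λ {p} {q} p≤q → ≤-pointwise (fromℚ p) (fromℚ q) (always (λ _ → p≤q))
    ; ι-cancel-≤  = λ {p} {q} → fromℚ-cancel-≤ p q
    ; ι-above     = above
    ; ι-below     = below
    ; nested      = nested }

open import Defs
open import Data.Nat using (ℕ; _≤_)

-- Transfer to the complex numbers of the statement.

module Transfer (em : ExcludedMiddle 0ℓ) where

  open CauchyReals em using (realNumbers; ≃-refl)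
  module 𝓡 = RealNumbers realNumbers
  module A = MaximalImaginaryPart realNumbers em
  open A using (Cx; re; im; _≋_; _&_; re-≈; im-≈; ≋-refl; ≋-sym; ≋-trans; _⊕_; _⊗_; ⊕-cong; ⊗-cong;
    evaluate; evaluate-cong; nat; ChromaticRoot; Maximal)
  open A using () renaming (_+i_ to _+ⁱ_)

  -- The operations of the interface compute to those of the statement. Recording this on variables
  -- lets it be passed on without unfolding compound terms.
  +-is : ∀ x y → x 𝓡.+ y ≡ x +ᵣ y
  +-is x y = refl

  *-is : ∀ x y → x 𝓡.* y ≡ x *ᵣ y
  *-is x y = refl

  neg-is : ∀ x → 𝓡.- x ≡ -ᵣ x
  neg-is x = refl

  toCx : ℂ → Cx
  toCx z = Re z +ⁱ Im z

  fromCx : Cx → ℂ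
  fromCx w = re w +i im w

  toCx-cong : ∀ {z w} → z ≃ w → toCx z ≋ toCx w
  toCx-cong (p , q) = p & q

  fromCx-cong : ∀ {z w} → toCx z ≋ toCx w → z ≃ w
  fromCx-cong e = re-≈ e , im-≈ e

  toCx-+ : ∀ z w → toCx z ⊕ toCx w ≋ toCx (z + w)
  toCx-+ z w = A.⊕-in _+ᵣ_ _*ᵣ_ -ᵣ_ +-is *-is neg-is (Re z) (Im z) (Re w) (Im w)

  toCx-* : ∀ z w → toCx z ⊗ toCx w ≋ toCx (z * w)
  toCx-* z w = A.⊗-in _+ᵣ_ _*ᵣ_ -ᵣ_ +-is *-is neg-is (Re z) (Im z) (Re w) (Im w)

  evaluate-toCx : ∀ p z → evaluate (List.map toCx p) (toCx z) ≋ toCx (eval p z)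
  evaluate-toCx []      z = A.real-pair (fromℕᵣ 0)
  evaluate-toCx (a ∷ p) z = ≋-trans
    (⊕-cong (≋-refl {toCx a}) (≋-trans (⊗-cong (≋-refl {toCx z}) (evaluate-toCx p z)) (toCx-* z (eval p z))))
    (toCx-+ a (z * eval p z))

  toCx-fromℕ : ∀ k → toCx (fromℕ k) ≋ nat k
  toCx-fromℕ k = ≋-sym (A.natural k)

  root-toCx : ∀ {n} (G : Graph n) {z} → IsChromaticRoot G z → ChromaticRoot G (toCx z)
  root-toCx G {z} (p , p≃π , pz≃0) = List.map toCx p ,
    (λ k → ≋-trans (evaluate-cong (List.map toCx p) (≋-sym (toCx-fromℕ k)))
      (≋-trans (evaluate-toCx p (fromℕ k)) (≋-trans (toCx-cong (p≃π k)) (toCx-fromℕ (π G k))))) ,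
    ≋-trans (evaluate-toCx p z) (≋-trans (toCx-cong pz≃0) (≋-sym (A.real-pair (fromℕᵣ 0))))

  -- By η for records `toCx` undoes `fromCx`, so only mapping over the coefficient list calls for an
  -- equation.
  eval-fromCx : ∀ p z → toCx (eval (List.map fromCx p) z) ≋ evaluate p (toCx z)
  eval-fromCx p z = ≡.subst (λ q → toCx (eval (List.map fromCx p) z) ≋ evaluate q (toCx z))
    (≡.trans (≡.sym (List.map-∘ p)) (List.map-id p)) (≋-sym (evaluate-toCx (List.map fromCx p) z))

  root-fromCx : ∀ {n} (G : Graph n) {w} → ChromaticRoot G w → IsChromaticRoot G (fromCx w)
  root-fromCx G {w} (p , p≋π , pw≋0) = List.map fromCx p ,
    (λ k → fromCx-cong (≋-trans (eval-fromCx p (fromℕ k))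
      (≋-trans (evaluate-cong p (toCx-fromℕ k)) (≋-trans (p≋π k) (≋-sym (toCx-fromℕ (π G k))))))) ,
    fromCx-cong (≋-trans (eval-fromCx p (fromCx w)) (≋-trans pw≋0 (A.real-pair (fromℕᵣ 0))))

  isMaximaginary : ∀ {n z} → Maximal n z → IsMaximaginary n (im z)
  isMaximaginary {n} {z} ((G , root) , largest) =
    (G , fromCx z , root-fromCx G root , ≃-refl (im z)) ,
    (λ G w root → largest G (toCx w) (root-toCx G root))

  fromℚ-pos : ∀ q → 0ℚ ℚ.< q → 0ᵣ <ᵣ fromℚ q
  fromℚ-pos q 0<q = q , 0<q , 0 , λ _ _ → ℚ.≤-reflexive (ℚ.+-identityˡ q)

  linear-lower : ∀ {n z} → 9 ≤ n → Maximal n z → fromℚ A.⅛ *ᵣ fromℕᵣ n ≤ᵣ im z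
  linear-lower 9≤n maximal = A.maximal-lower-in _*ᵣ_ *-is refl refl 9≤n maximal

  linear-upper : ∀ {n z} → Maximal n z → im z ≤ᵣ fromℚ A.8ℚ *ᵣ fromℕᵣ n
  linear-upper maximal = A.maximal-upper-in _*ᵣ_ *-is refl refl maximal

  linear-bounds : ∀ {n z} → 9 ≤ n → Maximal n z → ∃[ M ] IsMaximaginary n M ×
    (fromℚ A.⅛ *ᵣ fromℕᵣ n ≤ᵣ M) × (M ≤ᵣ fromℚ A.8ℚ *ᵣ fromℕᵣ n)
  linear-bounds {n} {z} 9≤n maximal =
    im z , isMaximaginary maximal , linear-lower 9≤n maximal , linear-upper {n} {z} maximal

theorem2p1 : ExcludedMiddle 0ℓ →
    ∃[ C₁ ] ∃[ C₂ ] (0ᵣ <ᵣ C₁) × (0ᵣ <ᵣ C₂) ×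
    (∃[ N ] (∀ (n : ℕ) → 1 ≤ n → N ≤ n →
    ∃[ M ] IsMaximaginary n M × (C₁ *ᵣ fromℕᵣ n ≤ᵣ M) × (M ≤ᵣ C₂ *ᵣ fromℕᵣ n)))
theorem2p1 em = fromℚ A.⅛ , fromℚ A.8ℚ , fromℚ-pos A.⅛ (ℚ.positive⁻¹ A.⅛) , fromℚ-pos A.8ℚ (ℚ.positive⁻¹ A.8ℚ) ,
    -- Order 9 is where `edges-large` begins to apply.
    9 , λ { (suc n) _ 9≤n → linear-bounds 9≤n (proj₂ (A.maximal-root n)) }
  where open Transfer em
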